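{- Let $M$ be a connected matroid of rank $2$ on $n$ elements. Then \[ \operatorname{ehr}(\mathscr{P}(T_{2,n}),t)\ \preceq\ \operatorname{ehr}(\mathscr{P}(M),t)\ \preceq\ \operatorname{ehr}(\mathscr{P}(U_{2,n}),t). \] Moreover, if $M$ is neither minimal (isomorphic to $T_{2,n}$) nor uniform (equal to $U_{2,n}$), then both inequalities are strict on the coefficients of positive degree, i.e. for each $1\le j\le n-1$ the coefficient of $t^j$ in $\operatorname{ehr}(\mathscr{P}(M),t)$ is strictly larger than that in $\operatorname{ehr}(\mathscr{P}(T_{2,n}),t)$ and strictly smaller than that in $\operatorname{ehr}(\mathscr{P}(U_{2,n}),t)$. In particular, the matroid base polytope $\mathscr{P}(N)$ of every matroid $N$ of rank $2$ (connected or not) is Ehrhart positive.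
   Context: For a matroid $M$ on $\{1,\ldots,n\}$ with set of bases $\mathscr{B}$, the matroid (base) polytope is $\mathscr{P}(M)=\operatorname{conv}\{e_B : B\in\mathscr{B}\}\subseteq\mathbb{R}^n$, where $e_B=\sum_{i\in B}e_i$. For a lattice polytope $\mathscr{P}\subseteq\mathbb{R}^n$ of dimension $d$, its Ehrhart polynomial $\operatorname{ehr}(\mathscr{P},t)$ is the polynomial (of degree $d$) in $t$ with $\operatorname{ehr}(\mathscr{P},t)=\#(t\mathscr{P}\cap\mathbb{Z}^n)$ for all integers $t\geq 0$. The polytope $\mathscr{P}$ is Ehrhart positive if all coefficients (of $t^0,\ldots,t^d$) of $\operatorname{ehr}(\mathscr{P},t)$ are positive. For $p,q\in\mathbb{R}[t]$, $p(t)\preceq q(t)$ means that $q(t)-p(t)$ has only nonnegative coefficients. A matroid is connected if it is not a direct sum of matroids on smaller ground sets. $U_{2,n}$ is the uniform matroid of rank $2$ on $\{1,\ldots,n\}$, whose bases are all $2$-subsets. $T_{2,n}$ is the minimal matroid of rank $2$ on $\{1,\ldots,n\}$: its bases are $\{1,2\}$ together with all sets $\{i,j\}$ with $i\in\{1,2\}$ and $j\in\{3,\ldots,n\}$.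
   Formalization: The polytopes, their dilates and dimension are taken in rational instead of real n-space, and the Ehrhart polynomials have rational coefficients; for these 0/1 polytopes the lattice point counts and dimensions are the same. -}

module Defs where

open import Data.Bool using (true; false; if_then_else_)
open import Data.Bool.Properties using (∨-identityʳ)
open import Data.Fin using (Fin; zero; suc; toℕ; fromℕ<; _↑ˡ_; _↑ʳ_)
open import Data.Fin.Permutation using (Permutation; _⟨$⟩ˡ_)
open import Data.Fin.Properties using (any?; toℕ-fromℕ<; toℕ-injective)
open import Data.Fin.Subset
  using (Subset; ⊥; ⁅_⁆; _∈_; _∉_; _⊆_; _∪_; _-_; ∣_∣)
open import Data.Fin.Subset.Properties
  using ( _∈?_; ∣p∣≤n; p⊂q⇒∣p∣<∣q∣; x∈p∧x≢y⇒x∈p-y; x∈p∪q⁺; x∈⁅x⁆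
        ; x≢y⇒x∉⁅y⁆; p─⊥≡p; ∪-identityʳ; ∪-comm; ∣⁅x⁆∣≡1; ∣⊥∣≡0 )
open import Data.Integer using (ℤ; +_)
open import Data.List using (List; []; _∷_; length)
import Data.List.Membership.Propositional as ListMem
open import Data.List.Relation.Unary.Unique.Propositional using (Unique)
open import Data.Nat as ℕ using (ℕ; zero; suc; _≤_; _<_; z≤n; s≤s)
import Data.Nat.Properties as ℕₚ
open import Data.Product using (∃; ∃₂; _×_; _,_)
open import Data.Rational as ℚ using (ℚ; 0ℚ; 1ℚ)
open import Data.Rational.Properties using (+-0-commutativeMonoid)
open import Data.Sum using (_⊎_; inj₁; inj₂)
open import Data.Vec as Vec using (Vec; []; _∷_; _++_; lookup; tabulate; take; drop)
open import Data.Vec.Functional using (Vector)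
open import Function using (_⇔_; _∘_)
open import Relation.Binary.PropositionalEquality
  using (_≡_; _≢_; refl; sym; trans; cong; cong₂; subst)
open import Relation.Nullary using (¬_; yes; no; contradiction)
open import Relation.Nullary.Decidable using (_×-dec_; ¬?; map′; decidable-stable)
open import Relation.Unary using (Pred; Decidable)
open import Level using (0ℓ)

open import Algebra.Properties.CommutativeMonoid.Sum +-0-commutativeMonoid public
  using (sum)

------------------------------------------------------------------------
-- Matroids

record Matroid (n : ℕ) : Set₁ where
  field
    IsBasis  : Pred (Subset n) 0ℓ
    isBasis? : Decidable IsBasis
    nonempty : ∃ IsBasis
    exchange : ∀ {A B x} → IsBasis A → IsBasis B → x ∈ A → x ∉ B →
               ∃ λ y → y ∈ B × y ∉ A × IsBasis ((A - x) ∪ ⁅ y ⁆)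

open Matroid public

HasRank : ∀ {n} → Matroid n → ℕ → Set
HasRank M r = ∀ {B} → IsBasis M B → ∣ B ∣ ≡ r

rank≤size : ∀ {n r} (M : Matroid n) → HasRank M r → r ≤ n
rank≤size M rk =
  let B , b = nonempty M in subst (_≤ _) (rk b) (∣p∣≤n B)

image : ∀ {m n} → Permutation m n → Subset m → Subset n
image π B = tabulate λ j → lookup B (π ⟨$⟩ˡ j)

infix 4 _≅_

_≅_ : ∀ {m n} → Matroid m → Matroid n → Set
_≅_ {m} {n} M N =
  ∃ λ (π : Permutation m n) → ∀ B → IsBasis M B ⇔ IsBasis N (image π B)

------------------------------------------------------------------------
-- Direct sums and connectedness

private

  exchange-++ˡ : ∀ {k l} (A : Subset (k ℕ.+ l)) (x y : Fin k) →
    let A′ = (A - (x ↑ˡ l)) ∪ ⁅ y ↑ˡ l ⁆ in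
    take k A′ ≡ (take k A - x) ∪ ⁅ y ⁆ × drop k A′ ≡ drop k A
  exchange-++ˡ {k} {l} A x y =
    let p , q = del k A x
        r , s = add k (A - (x ↑ˡ l)) y
    in trans r (cong (_∪ ⁅ y ⁆) p) , trans s q
    where
    del : ∀ k (A : Subset (k ℕ.+ l)) (x : Fin k) →
      take k (A - (x ↑ˡ l)) ≡ take k A - x × drop k (A - (x ↑ˡ l)) ≡ drop k A
    del (suc k) (a ∷ A) zero =
        cong (false ∷_) (trans (cong (take k) (p─⊥≡p A)) (sym (p─⊥≡p (take k A))))
      , cong (drop k) (p─⊥≡p A)
    del (suc k) (a ∷ A) (suc x) =
      let p , q = del k A x in cong (_ ∷_) p , q

    add : ∀ k (A : Subset (k ℕ.+ l)) (y : Fin k) →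
      take k (A ∪ ⁅ y ↑ˡ l ⁆) ≡ take k A ∪ ⁅ y ⁆ × drop k (A ∪ ⁅ y ↑ˡ l ⁆) ≡ drop k A
    add (suc k) (a ∷ A) zero
      rewrite ∪-identityʳ A | ∪-identityʳ (take k A) = refl , refl
    add (suc k) (a ∷ A) (suc y) =
      let p , q = add k A y in cong (_ ∷_) p , q

  exchange-++ʳ : ∀ k {l} (A : Subset (k ℕ.+ l)) (x y : Fin l) →
    let A′ = (A - (k ↑ʳ x)) ∪ ⁅ k ↑ʳ y ⁆ in
    take k A′ ≡ take k A × drop k A′ ≡ (drop k A - x) ∪ ⁅ y ⁆
  exchange-++ʳ zero    A       x y = refl , refl
  exchange-++ʳ (suc k) (a ∷ A) x y =
    let p , q = exchange-++ʳ k A x y in cong₂ _∷_ (∨-identityʳ a) p , q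

  data Split (k {l} : ℕ) : Fin (k ℕ.+ l) → Set where
    left  : ∀ i → Split k (i ↑ˡ l)
    right : ∀ j → Split k (k ↑ʳ j)

  split : ∀ k {l} (x : Fin (k ℕ.+ l)) → Split k x
  split zero    x       = right x
  split (suc k) zero    = left zero
  split (suc k) (suc x) with split k x
  ... | left i  = left (suc i)
  ... | right j = right j

  ∈-take⁺ : ∀ {k l} {A : Subset (k ℕ.+ l)} {i : Fin k} → (i ↑ˡ l) ∈ A → i ∈ take k A
  ∈-take⁺ {A = a ∷ A} {zero}  Vec.here      = Vec.here
  ∈-take⁺ {A = a ∷ A} {suc i} (Vec.there p) = Vec.there (∈-take⁺ p)

  ∈-take⁻ : ∀ {k l} {A : Subset (k ℕ.+ l)} {i : Fin k} → i ∈ take k A → (i ↑ˡ l) ∈ A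
  ∈-take⁻ {A = a ∷ A} {zero}  Vec.here      = Vec.here
  ∈-take⁻ {A = a ∷ A} {suc i} (Vec.there p) = Vec.there (∈-take⁻ p)

  ∈-drop⁺ : ∀ k {l} {A : Subset (k ℕ.+ l)} {j : Fin l} → (k ↑ʳ j) ∈ A → j ∈ drop k A
  ∈-drop⁺ zero                p             = p
  ∈-drop⁺ (suc k) {A = a ∷ A} (Vec.there p) = ∈-drop⁺ k p

  ∈-drop⁻ : ∀ k {l} {A : Subset (k ℕ.+ l)} {j : Fin l} → j ∈ drop k A → (k ↑ʳ j) ∈ A
  ∈-drop⁻ zero                p = p
  ∈-drop⁻ (suc k) {A = a ∷ A} p = Vec.there (∈-drop⁻ k p)

  take-++ : ∀ {k l} (A : Subset k) (B : Subset l) → take k (A ++ B) ≡ A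
  take-++ []      B = refl
  take-++ (a ∷ A) B = cong (a ∷_) (take-++ A B)

  drop-++ : ∀ {k l} (A : Subset k) (B : Subset l) → drop k (A ++ B) ≡ B
  drop-++ []      B = refl
  drop-++ (a ∷ A) B = drop-++ A B

infixr 5 _⊕_

_⊕_ : ∀ {k l} → Matroid k → Matroid l → Matroid (k ℕ.+ l)
_⊕_ {k} {l} M N = record
  { IsBasis  = λ B → IsBasis M (take k B) × IsBasis N (drop k B)
  ; isBasis? = λ B → isBasis? M (take k B) ×-dec isBasis? N (drop k B)
  ; nonempty =
      let B , b = nonempty M
          C , c = nonempty N
      in B ++ C , subst (IsBasis M) (sym (take-++ B C)) b
                , subst (IsBasis N) (sym (drop-++ B C)) c
  ; exchange = λ {A} {B} {x} → exch {A} {B} (split k x)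
  }
  where
  exch : ∀ {A B x} → Split k x →
    IsBasis M (take k A) × IsBasis N (drop k A) →
    IsBasis M (take k B) × IsBasis N (drop k B) →
    x ∈ A → x ∉ B →
    ∃ λ y → y ∈ B × y ∉ A ×
      IsBasis M (take k ((A - x) ∪ ⁅ y ⁆)) × IsBasis N (drop k ((A - x) ∪ ⁅ y ⁆))
  exch {A} (left i) (aM , aN) (bM , bN) x∈A x∉B =
    let y , y∈B , y∉A , new = exchange M aM bM (∈-take⁺ x∈A) (x∉B ∘ ∈-take⁻)
        p , q = exchange-++ˡ A i y
    in y ↑ˡ l , ∈-take⁻ y∈B , y∉A ∘ ∈-take⁺
       , subst (IsBasis M) (sym p) new , subst (IsBasis N) (sym q) aN
  exch {A} (right j) (aM , aN) (bM , bN) x∈A x∉B =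
    let y , y∈B , y∉A , new = exchange N aN bN (∈-drop⁺ k x∈A) (x∉B ∘ ∈-drop⁻ k)
        p , q = exchange-++ʳ k A j y
    in k ↑ʳ y , ∈-drop⁻ k y∈B , y∉A ∘ ∈-drop⁺ k
       , subst (IsBasis M) (sym p) aM , subst (IsBasis N) (sym q) new

Connected : ∀ {n} → Matroid n → Set₁
Connected {n} M =
  ∀ {k l} → k < n → l < n → (M₁ : Matroid k) (M₂ : Matroid l) → ¬ (M ≅ M₁ ⊕ M₂)

------------------------------------------------------------------------
-- Uniform matroids and minimal matroids of rank 2

private

  ∣p-x∣ : ∀ {n} {p : Subset n} {x} → x ∈ p → suc ∣ p - x ∣ ≡ ∣ p ∣
  ∣p-x∣ {p = _ ∷ p}     Vec.here      = cong (suc ∘ ∣_∣) (p─⊥≡p p)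
  ∣p-x∣ {p = true ∷ p}  (Vec.there h) = cong suc (∣p-x∣ h)
  ∣p-x∣ {p = false ∷ p} (Vec.there h) = ∣p-x∣ h

  ∣p∪y∣ : ∀ {n} {p : Subset n} {y} → y ∉ p → ∣ p ∪ ⁅ y ⁆ ∣ ≡ suc ∣ p ∣
  ∣p∪y∣ {p = true ∷ p}  {zero}  h = contradiction Vec.here h
  ∣p∪y∣ {p = false ∷ p} {zero}  h rewrite ∪-identityʳ p = refl
  ∣p∪y∣ {p = true ∷ p}  {suc y} h = cong suc (∣p∪y∣ (h ∘ Vec.there))
  ∣p∪y∣ {p = false ∷ p} {suc y} h = ∣p∪y∣ (h ∘ Vec.there)

  p-x⊆p : ∀ {n} {p : Subset n} {x} → p - x ⊆ p
  p-x⊆p {p = _ ∷ p}    {zero}  (Vec.there h) = Vec.there (subst (_ ∈_) (p─⊥≡p p) h)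
  p-x⊆p {p = true ∷ p} {suc x} Vec.here      = Vec.here
  p-x⊆p {p = _ ∷ p}    {suc x} (Vec.there h) = Vec.there (p-x⊆p h)

  ∣exchange∣ : ∀ {n} {A : Subset n} {x y} → x ∈ A → y ∉ A → ∣ (A - x) ∪ ⁅ y ⁆ ∣ ≡ ∣ A ∣
  ∣exchange∣ x∈A y∉A = trans (∣p∪y∣ (y∉A ∘ p-x⊆p)) (∣p-x∣ x∈A)

  findNew : ∀ {n} {A B : Subset n} {x} → ∣ A ∣ ≡ ∣ B ∣ → x ∈ A → x ∉ B →
            ∃ λ y → y ∈ B × y ∉ A
  findNew {A = A} {B} {x} eq x∈A x∉B
    with any? (λ y → (y ∈? B) ×-dec ¬? (y ∈? A))
  ... | yes w = w
  ... | no ¬w = contradiction (sym eq) (ℕₚ.<⇒≢ (p⊂q⇒∣p∣<∣q∣ (B⊆A , x , x∈A , x∉B)))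
    where
    B⊆A : B ⊆ A
    B⊆A {y} y∈B = decidable-stable (y ∈? A) (λ y∉A → ¬w (y , y∈B , y∉A))

  subsetOfSize : ∀ {r n} → r ≤ n → ∃ λ (B : Subset n) → ∣ B ∣ ≡ r
  subsetOfSize {n = n} z≤n = ⊥ , ∣⊥∣≡0 n
  subsetOfSize (s≤s h)     = let B , e = subsetOfSize h in true ∷ B , cong suc e

uniform : ∀ {r n} → r ≤ n → Matroid n
uniform {r} r≤n = record
  { IsBasis  = λ B → ∣ B ∣ ≡ r
  ; isBasis? = λ B → ∣ B ∣ ℕ.≟ r
  ; nonempty = subsetOfSize r≤n
  ; exchange = λ a b x∈A x∉B →
      let y , y∈B , y∉A = findNew (trans a (sym b)) x∈A x∉B
      in y , y∈B , y∉A , trans (∣exchange∣ x∈A y∉A) a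
  }

-- The elements 1, 2, …, n are those of Fin n with toℕ equal to 0, 1, …, n - 1.
MinimalBasis : ∀ {n} → Pred (Subset n) 0ℓ
MinimalBasis B =
    (∃₂ λ i j → toℕ i ≡ 0 × toℕ j ≡ 1 × B ≡ ⁅ i ⁆ ∪ ⁅ j ⁆)
  ⊎ (∃₂ λ i j → toℕ i < 2 × 2 ≤ toℕ j × B ≡ ⁅ i ⁆ ∪ ⁅ j ⁆)

private

  Minimal′ : ∀ {n} → Pred (Subset n) 0ℓ
  Minimal′ B = ∣ B ∣ ≡ 2 × ∃ λ i → i ∈ B × toℕ i < 2

  ∣pair∣ : ∀ {n} {i j : Fin n} → i ≢ j → ∣ ⁅ i ⁆ ∪ ⁅ j ⁆ ∣ ≡ 2
  ∣pair∣ {i = i} {j} i≢j =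
    trans (∣p∪y∣ (x≢y⇒x∉⁅y⁆ (i≢j ∘ sym))) (cong suc (∣⁅x⁆∣≡1 i))

  empty : ∀ {n} (p : Subset n) → ∣ p ∣ ≡ 0 → p ≡ ⊥
  empty []          _ = refl
  empty (false ∷ p) h = cong (false ∷_) (empty p h)

  singleton : ∀ {n} (p : Subset n) → ∣ p ∣ ≡ 1 → ∃ λ j → p ≡ ⁅ j ⁆
  singleton (true ∷ p)  h = zero , cong (true ∷_) (empty p (ℕₚ.suc-injective h))
  singleton (false ∷ p) h = let j , e = singleton p h in suc j , cong (false ∷_) e

  readd : ∀ {n} {p : Subset n} {x} → x ∈ p → p ≡ ⁅ x ⁆ ∪ (p - x)
  readd {p = _ ∷ p} Vec.here =
    cong (true ∷_) (sym (trans (cong (⊥ ∪_) (p─⊥≡p p)) (trans (∪-comm ⊥ p) (∪-identityʳ p))))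
  readd {p = true ∷ p}  (Vec.there h) = cong (true ∷_) (readd h)
  readd {p = false ∷ p} (Vec.there h) = cong (false ∷_) (readd h)

  x∉p-x : ∀ {n} {p : Subset n} {x} → x ∉ p - x
  x∉p-x {p = _ ∷ p} {suc x} (Vec.there h) = x∉p-x h

  from : ∀ {n} {B : Subset n} → MinimalBasis B → Minimal′ B
  from (inj₁ (i , j , i≡0 , j≡1 , refl)) =
    ∣pair∣ {i = i} {j} (λ { refl → contradiction (trans (sym i≡0) j≡1) λ () })
    , i , x∈p∪q⁺ (inj₁ (x∈⁅x⁆ i)) , subst (_< 2) (sym i≡0) (s≤s z≤n)
  from (inj₂ (i , j , i<2 , 2≤j , refl)) =
    ∣pair∣ {i = i} {j} (λ { refl → ℕₚ.<⇒≱ i<2 2≤j })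
    , i , x∈p∪q⁺ (inj₁ (x∈⁅x⁆ i)) , i<2

  small : ∀ {n} {i j : Fin n} → toℕ i < 2 → toℕ j < 2 → i ≢ j →
          (toℕ i ≡ 0 × toℕ j ≡ 1) ⊎ (toℕ i ≡ 1 × toℕ j ≡ 0)
  small {i = i} {j} i<2 j<2 i≢j = go (toℕ i) (toℕ j) i<2 j<2 (i≢j ∘ toℕ-injective)
    where
    go : ∀ a b → a < 2 → b < 2 → a ≢ b → (a ≡ 0 × b ≡ 1) ⊎ (a ≡ 1 × b ≡ 0)
    go 0 0 _ _ h = contradiction refl h
    go 0 1 _ _ _ = inj₁ (refl , refl)
    go 1 0 _ _ _ = inj₂ (refl , refl)
    go 1 1 _ _ h = contradiction refl h
    go (suc (suc _)) _ (s≤s (s≤s ())) _ _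
    go 0 (suc (suc _)) _ (s≤s (s≤s ())) _
    go 1 (suc (suc _)) _ (s≤s (s≤s ())) _

  to : ∀ {n} {B : Subset n} → Minimal′ B → MinimalBasis B
  to {B = B} (card , i , i∈B , i<2)
    with singleton (B - i) (ℕₚ.suc-injective (trans (∣p-x∣ i∈B) card))
  ... | j , B-i≡j with trans (readd i∈B) (cong (⁅ i ⁆ ∪_) B-i≡j) | toℕ j ℕ.<? 2
  ... | B≡ij | no j≮2  = inj₂ (i , j , i<2 , ℕₚ.≮⇒≥ j≮2 , B≡ij)
  ... | B≡ij | yes j<2
    with small i<2 j<2 (λ { refl → x∉p-x {p = B} (subst (i ∈_) (sym B-i≡j) (x∈⁅x⁆ i)) })
  ... | inj₁ (i≡0 , j≡1) = inj₁ (i , j , i≡0 , j≡1 , B≡ij)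
  ... | inj₂ (i≡1 , j≡0) = inj₁ (j , i , j≡0 , i≡1 , trans B≡ij (∪-comm ⁅ i ⁆ ⁅ j ⁆))

  exchange′ : ∀ {n} {A B : Subset n} {x} → Minimal′ A → Minimal′ B → x ∈ A → x ∉ B →
              ∃ λ y → y ∈ B × y ∉ A × Minimal′ ((A - x) ∪ ⁅ y ⁆)
  exchange′ {A = A} {B} {x} (a , _) (b , k , k∈B , k<2) x∈A x∉B
    with any? (λ z → (z ∈? (A - x)) ×-dec (toℕ z ℕ.<? 2))
  ... | yes (z , z∈ , z<2) =
    let y , y∈B , y∉A = findNew (trans a (sym b)) x∈A x∉B
    in y , y∈B , y∉A , trans (∣exchange∣ x∈A y∉A) a , z , x∈p∪q⁺ (inj₁ z∈) , z<2
  ... | no ¬z =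
    k , k∈B , k∉A , trans (∣exchange∣ x∈A k∉A) a , k , x∈p∪q⁺ (inj₂ (x∈⁅x⁆ k)) , k<2
    where
    k∉A : k ∉ A
    k∉A k∈A = ¬z (k , x∈p∧x≢y⇒x∈p-y k∈A (λ { refl → x∉B k∈B }) , k<2)

minimal₂ : ∀ {n} → 2 ≤ n → Matroid n
minimal₂ 2≤n = record
  { IsBasis  = MinimalBasis
  ; isBasis? = λ B → map′ to from
      ((∣ B ∣ ℕ.≟ 2) ×-dec any? (λ i → (i ∈? B) ×-dec (toℕ i ℕ.<? 2)))
  ; nonempty = _ , inj₁ ( fromℕ< (ℕₚ.≤-trans (s≤s z≤n) 2≤n) , fromℕ< 2≤n
                        , toℕ-fromℕ< _ , toℕ-fromℕ< 2≤n , refl )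
  ; exchange = λ a b x∈A x∉B →
      let y , y∈B , y∉A , new = exchange′ (from a) (from b) x∈A x∉B
      in y , y∈B , y∉A , to new
  }

------------------------------------------------------------------------
-- Polytopes

-- Rational points suffice throughout: all vertices are lattice points, so a
-- rational point is a real convex combination of them exactly when it is a
-- rational one, and affine dimension may be computed over ℚ.
Point : ℕ → Set
Point = Vector ℚ

fromℕ : ℕ → ℚ
fromℕ k = + k ℚ./ 1

conv : ∀ {n} → Pred (Point n) 0ℓ → Pred (Point n) 0ℓ
conv S x = ∃ λ k → ∃₂ λ (v : Fin k → Point _) (w : Vector ℚ k) →
    (∀ a → S (v a))
  × (∀ a → 0ℚ ℚ.≤ w a)
  × sum w ≡ 1ℚ
  × (∀ i → x i ≡ sum λ a → w a ℚ.* v a i)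

indicator : ∀ {n} → Subset n → Point n
indicator B i = if lookup B i then 1ℚ else 0ℚ

polytope : ∀ {n} → Matroid n → Pred (Point n) 0ℓ
polytope M = conv λ x → ∃ λ B → IsBasis M B × (∀ i → x i ≡ indicator B i)

dilate : ∀ {n} → ℕ → Pred (Point n) 0ℓ → Pred (Point n) 0ℓ
dilate t P x = ∃ λ y → P y × (∀ i → x i ≡ fromℕ t ℚ.* y i)

LatticePoint : ∀ {n} → Pred (Point n) 0ℓ → Pred (Vec ℤ n) 0ℓ
LatticePoint P z = P λ i → lookup z i ℚ./ 1

AffinelyIndependent : ∀ {k n} → (Fin k → Point n) → Set
AffinelyIndependent {k} v = ∀ (c : Vector ℚ k) →
  sum c ≡ 0ℚ → (∀ i → sum (λ a → c a ℚ.* v a i) ≡ 0ℚ) → ∀ a → c a ≡ 0ℚ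

HasDimension : ∀ {n} → Pred (Point n) 0ℓ → ℕ → Set
HasDimension P d =
    (∃ λ (v : Fin (suc d) → Point _) → (∀ a → P (v a)) × AffinelyIndependent v)
  × (∀ (v : Fin (suc (suc d)) → Point _) → (∀ a → P (v a)) → ¬ AffinelyIndependent v)

------------------------------------------------------------------------
-- Ehrhart polynomials

-- Coefficients are listed from the constant term upwards; trailing zeros are
-- allowed, so polynomials are compared through coeff. Ehrhart polynomials have
-- rational coefficients, being determined by their values on ℕ.
Polynomial : Set
Polynomial = List ℚ

coeff : Polynomial → ℕ → ℚ
coeff []      _       = 0ℚ
coeff (a ∷ p) zero    = a
coeff (a ∷ p) (suc j) = coeff p j

eval : Polynomial → ℚ → ℚ
eval []      t = 0ℚ
eval (a ∷ p) t = a ℚ.+ t ℚ.* eval p t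

infix 4 _⪯_

_⪯_ : Polynomial → Polynomial → Set
p ⪯ q = ∀ j → 0ℚ ℚ.≤ coeff q j ℚ.- coeff p j

HasCardinality : {A : Set} → Pred A 0ℓ → ℕ → Set
HasCardinality {A} P N = ∃ λ (xs : List A) →
  Unique xs × (∀ x → x ListMem.∈ xs ⇔ P x) × length xs ≡ N

IsEhrhartPolynomial : ∀ {n} → Pred (Point n) 0ℓ → Polynomial → Set
IsEhrhartPolynomial P p = ∀ t → ∃ λ N →
  HasCardinality (LatticePoint (dilate t P)) N × eval p (fromℕ t) ≡ fromℕ N

EhrhartPositive : ∀ {n} → Pred (Point n) 0ℓ → Set
EhrhartPositive P = ∃₂ λ p d →
  IsEhrhartPolynomial P p × HasDimension P d × (∀ j → j ≤ d → 0ℚ ℚ.< coeff p j)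

module Submission where

-- Let M have rank 2, n elements that are not loops, and parallel classes of sizes a₁, …, aₛ. The lattice
-- points of t 𝒫(M) are the x ∈ ℕⁿ with coordinate sum 2t whose class sums are all at most t. At most one
-- class sum can exceed t, so their number is h n (2t) - Σ φ(aₖ), where φ(a) counts the x whose first a
-- coordinates have sum above t. Viewing x as a multiset i₁ ≤ … ≤ i₂ₜ, this event says i_{t+1} ≤ a, hence
-- φ(a) = ψ(1) + … + ψ(a) with ψ(c) = (t+c-1 over c-1) (t+n-c-1 over n-c), a product of linear factors.
-- Comparing these factors gives ψ(a) < ψ(c), in every coefficient of positive degree, whenever a < c and
-- a + c ≤ n. So the correction Σ φ(aₖ) increases when two classes of sizes a ≥ b are replaced by a + 1 and
-- b - 1; for three or more classes it is largest for sizes (n-2, 1, 1) and smallest for (1, …, 1).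
-- For (n-2, 1, 1) the polynomial is (t+n-2 over n-2) (1 + t (n-2) / (n-1)), which has positive coefficients,
-- and two classes give a product of simplices.

open import Defs
open import Data.Bool as Bool using (Bool; true; false; if_then_else_)
import Data.Bool.Properties as Boolₚ
import Data.Empty
open import Data.Fin as Fin using (Fin; zero; suc)
open import Data.Fin.Patterns using (0F; 1F; 2F)
import Data.Fin.Permutation as Permutation
import Data.Fin.Properties as Finₚ
open import Data.Fin.Subset as Subset using (Subset; ⁅_⁆; _∪_; ∣_∣)
import Data.Fin.Subset.Properties as Subsetₚ
open import Data.Integer as ℤ using (ℤ) renaming (+_ to pos)
import Data.Integer.Properties as ℤₚ
open import Data.List as List using (List; []; _∷_; length)
import Data.List.Membership.Propositional as ListMem
open import Data.List.Membership.Propositional.Properties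
  using (∈-map⁺; ∈-map⁻; ∈-++⁺ˡ; ∈-++⁺ʳ; ∈-++⁻; ∈-filter⁺; ∈-filter⁻)
open import Data.List.Membership.Propositional.Properties.WithK using (unique∧set⇒bag)
import Data.List.Properties as Listₚ
open import Data.List.Relation.Binary.BagAndSetEquality using (∼bag⇒↭)
open import Data.List.Relation.Binary.Permutation.Propositional.Properties using (↭-length)
import Data.List.Relation.Unary.All as All
import Data.List.Relation.Unary.AllPairs as AllPairs
import Data.List.Relation.Unary.Any as Any
import Data.List.Relation.Unary.Unique.Propositional.Properties as Uniqueₚ
open import Data.Maybe as Maybe using (Maybe; just; nothing)
import Data.Maybe.Properties as Maybeₚ
open import Data.Nat as ℕ using (ℕ; zero; suc; pred; _+_; _*_; _∸_; _≤_; _<_; z≤n; s≤s)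
import Data.Nat.Properties as ℕₚ
import Data.Nat.Solver as ℕ-Solver
open import Data.Product using (∃; ∃₂; _×_; _,_; proj₁; proj₂)
open import Data.Rational as ℚ using (ℚ; 0ℚ; 1ℚ)
  renaming (_+_ to _+ℚ_; _*_ to _*ℚ_; _-_ to _-ℚ_; -_ to -ℚ_; _≤_ to _≤ℚ_; _<_ to _<ℚ_)
import Data.Rational.Properties as ℚₚ
open import Data.Rational.Solver using (module +-*-Solver)
import Data.Rational.Unnormalised as ℚᵘ
import Data.Rational.Unnormalised.Properties as ℚᵘₚ
open import Data.Sum using (_⊎_; inj₁; inj₂; [_,_]′)
open import Data.Vec as Vec using (Vec; []; _∷_; lookup)
import Data.Vec.Functional as VecF
import Data.Vec.Functional.Properties as VecFₚ
import Data.Vec.Properties as Vecₚ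
open import Function using (_∘_; id; _⇔_; mk⇔; Equivalence)
open import Level using (0ℓ)
open import Relation.Binary using (Tri; tri<; tri≈; tri>)
open import Relation.Binary.PropositionalEquality
  using (_≡_; _≢_; refl; sym; trans; cong; cong₂; subst; subst₂; module ≡-Reasoning)
open import Relation.Nullary using (¬_; Dec; yes; no; does; contradiction)
open import Relation.Nullary.Decidable using (¬?; _×-dec_; _→-dec_; decidable-stable)
open import Relation.Unary using (Pred; Decidable; _≐_)

open import Algebra.Properties.CommutativeMonoid.Sum ℕₚ.+-0-commutativeMonoid using ()
  renaming ( sum to sumℕ; ∑-distrib-+ to sumℕ-+; sum-cong-≗ to sumℕ-cong
           ; ∑-comm to sumℕ-comm; sum-replicate-zero to sumℕ-0 )
open import Algebra.Properties.CommutativeMonoid.Sum ℚₚ.+-0-commutativeMonoid using ()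
  renaming ( ∑-distrib-+ to sumℚ-+; sum-cong-≗ to sumℚ-cong; ∑-comm to sumℚ-comm
           ; sum-remove to sumℚ-remove; sum-replicate-zero to sumℚ-0 )
open Equivalence using (to; from)

-- Rational numbers

-- Three nonempty classes are needed because `ψ(a) < ψ(c)` is available only for `a + c ≤ n`: a
-- transfer between two classes stays in this range as long as a third one keeps their joint size
-- below `n`. Connectedness provides the third class: loops would split off as a summand of rank 0,
-- and two classes alone form a sum of two uniform matroids of rank 1. No polynomial in `t` is built
-- for `h n (2t)`. It is common to all loopless matroids on `n` elements, so it is eliminated by
-- means of the sizes `(n-2, 1, 1)`, whose count has a closed form; every other polynomial is that
-- one plus a difference of corrections. Positivity with three or more classes is inherited from
-- this smallest polynomial. Loops only force zero coordinates, so for positivity `n` becomes the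
-- number of nonloops. Positivity also requires the exact dimension, which drops by one when there
-- are just two classes. It is found by viewing the bases as the edges of a complete multipartite
-- graph.

fromℤ : ℤ → ℚ
fromℤ z = z ℚ./ 1

toℚᵘ-fromℤ : ∀ z → ℚ.toℚᵘ (fromℤ z) ℚᵘ.≃ ℚᵘ.mkℚᵘ z 0
toℚᵘ-fromℤ z = ℚₚ.toℚᵘ-fromℚᵘ (ℚᵘ.mkℚᵘ z 0)

fromℤ-+ : ∀ a b → fromℤ (a ℤ.+ b) ≡ fromℤ a +ℚ fromℤ b
fromℤ-+ a b = ℚₚ.toℚᵘ-injective (begin
  ℚ.toℚᵘ (fromℤ (a ℤ.+ b))                         ≈⟨ toℚᵘ-fromℤ (a ℤ.+ b) ⟩
  ℚᵘ.mkℚᵘ (a ℤ.+ b) 0                              ≈⟨ ℚᵘ.*≡*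
      (cong (ℤ._* pos 1) (sym (cong₂ ℤ._+_ (ℤₚ.*-identityʳ a) (ℤₚ.*-identityʳ b)))) ⟩
  ℚᵘ.mkℚᵘ a 0 ℚᵘ.+ ℚᵘ.mkℚᵘ b 0                     ≈⟨ ℚᵘₚ.+-cong (toℚᵘ-fromℤ a) (toℚᵘ-fromℤ b) ⟨
  ℚ.toℚᵘ (fromℤ a) ℚᵘ.+ ℚ.toℚᵘ (fromℤ b)           ≈⟨ ℚₚ.toℚᵘ-homo-+ (fromℤ a) (fromℤ b) ⟨
  ℚ.toℚᵘ (fromℤ a +ℚ fromℤ b)                      ∎)
  where open ℚᵘₚ.≃-Reasoning

fromℤ-* : ∀ a b → fromℤ (a ℤ.* b) ≡ fromℤ a *ℚ fromℤ b
fromℤ-* a b = ℚₚ.toℚᵘ-injective (begin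
  ℚ.toℚᵘ (fromℤ (a ℤ.* b))                         ≈⟨ toℚᵘ-fromℤ (a ℤ.* b) ⟩
  ℚᵘ.mkℚᵘ a 0 ℚᵘ.* ℚᵘ.mkℚᵘ b 0                     ≈⟨ ℚᵘₚ.*-cong (toℚᵘ-fromℤ a) (toℚᵘ-fromℤ b) ⟨
  ℚ.toℚᵘ (fromℤ a) ℚᵘ.* ℚ.toℚᵘ (fromℤ b)           ≈⟨ ℚₚ.toℚᵘ-homo-* (fromℤ a) (fromℤ b) ⟨
  ℚ.toℚᵘ (fromℤ a *ℚ fromℤ b)                      ∎)
  where open ℚᵘₚ.≃-Reasoning

fromℤ-mono-≤ : ∀ {a b} → a ℤ.≤ b → fromℤ a ≤ℚ fromℤ b
fromℤ-mono-≤ {a} {b} a≤b = ℚₚ.toℚᵘ-cancel-≤ (ℚᵘₚ.≤-trans (ℚᵘₚ.≤-reflexive (toℚᵘ-fromℤ a))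
  (ℚᵘₚ.≤-trans (ℚᵘ.*≤* (ℤₚ.*-monoʳ-≤-nonNeg (pos 1) a≤b)) (ℚᵘₚ.≤-reflexive (ℚᵘₚ.≃-sym (toℚᵘ-fromℤ b)))))

fromℤ-cancel-≤ : ∀ {a b} → fromℤ a ≤ℚ fromℤ b → a ℤ.≤ b
fromℤ-cancel-≤ {a} {b} h with ℚᵘₚ.≤-trans (ℚᵘₚ.≤-reflexive (ℚᵘₚ.≃-sym (toℚᵘ-fromℤ a)))
  (ℚᵘₚ.≤-trans (ℚₚ.toℚᵘ-mono-≤ h) (ℚᵘₚ.≤-reflexive (toℚᵘ-fromℤ b)))
... | ℚᵘ.*≤* a*1≤b*1 = ℤₚ.*-cancelʳ-≤-pos a b (pos 1) a*1≤b*1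

fromℤ-injective : ∀ {a b} → fromℤ a ≡ fromℤ b → a ≡ b
fromℤ-injective e = ℤₚ.≤-antisym (fromℤ-cancel-≤ (ℚₚ.≤-reflexive e)) (fromℤ-cancel-≤ (ℚₚ.≤-reflexive (sym e)))

fromℕ-+ : ∀ a b → fromℕ (a + b) ≡ fromℕ a +ℚ fromℕ b
fromℕ-+ a b = fromℤ-+ (pos a) (pos b)

fromℕ-* : ∀ a b → fromℕ (a * b) ≡ fromℕ a *ℚ fromℕ b
fromℕ-* a b = trans (cong fromℤ (ℤₚ.pos-* a b)) (fromℤ-* (pos a) (pos b))

fromℕ-injective : ∀ {a b} → fromℕ a ≡ fromℕ b → a ≡ b
fromℕ-injective e = ℤₚ.+-injective (fromℤ-injective e)

fromℕ-mono-≤ : ∀ {a b} → a ≤ b → fromℕ a ≤ℚ fromℕ b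
fromℕ-mono-≤ a≤b = fromℤ-mono-≤ (ℤ.+≤+ a≤b)

fromℕ-cancel-≤ : ∀ {a b} → fromℕ a ≤ℚ fromℕ b → a ≤ b
fromℕ-cancel-≤ h = ℤₚ.drop‿+≤+ (fromℤ-cancel-≤ h)

0<fromℕ-suc : ∀ k → 0ℚ <ℚ fromℕ (suc k)
0<fromℕ-suc k = ℚₚ.positive⁻¹ _ {{ℚₚ.normalize-pos (suc k) 1}}

0<1ℚ : 0ℚ <ℚ 1ℚ
0<1ℚ = 0<fromℕ-suc 0

private
  positive-suc : ∀ k → ℚ.Positive (fromℕ (suc k))
  positive-suc k = ℚₚ.normalize-pos (suc k) 1

recip : ℕ → ℚ
recip k = ℚ.1/_ (fromℕ (suc k)) {{ℚₚ.pos⇒nonZero (fromℕ (suc k)) {{positive-suc k}}}}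

recip-inverse : ∀ k → fromℕ (suc k) *ℚ recip k ≡ 1ℚ
recip-inverse k = ℚₚ.*-inverseʳ (fromℕ (suc k)) {{ℚₚ.pos⇒nonZero (fromℕ (suc k)) {{positive-suc k}}}}

0<recip : ∀ k → 0ℚ <ℚ recip k
0<recip k = ℚₚ.positive⁻¹ (recip k) {{ℚₚ.1/pos⇒pos (fromℕ (suc k)) {{positive-suc k}}}}

*-monoʳ-<⁺ : ∀ {a b c} → 0ℚ <ℚ a → b <ℚ c → a *ℚ b <ℚ a *ℚ c
*-monoʳ-<⁺ {a} 0<a = ℚₚ.*-monoʳ-<-pos a {{ℚ.positive 0<a}}

*-monoˡ-<⁺ : ∀ {a b c} → 0ℚ <ℚ a → b <ℚ c → b *ℚ a <ℚ c *ℚ a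
*-monoˡ-<⁺ {a} 0<a = ℚₚ.*-monoˡ-<-pos a {{ℚ.positive 0<a}}

*-monoʳ-≤⁺ : ∀ {a b c} → 0ℚ ≤ℚ a → b ≤ℚ c → a *ℚ b ≤ℚ a *ℚ c
*-monoʳ-≤⁺ {a} 0≤a = ℚₚ.*-monoˡ-≤-nonNeg a {{ℚ.nonNegative 0≤a}}

*-monoˡ-≤⁺ : ∀ {a b c} → 0ℚ ≤ℚ a → b ≤ℚ c → b *ℚ a ≤ℚ c *ℚ a
*-monoˡ-≤⁺ {a} 0≤a = ℚₚ.*-monoʳ-≤-nonNeg a {{ℚ.nonNegative 0≤a}}

*-nonNeg : ∀ {a b} → 0ℚ ≤ℚ a → 0ℚ ≤ℚ b → 0ℚ ≤ℚ a *ℚ b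
*-nonNeg {a} {b} 0≤a 0≤b = subst (_≤ℚ a *ℚ b) (ℚₚ.*-zeroʳ a) (*-monoʳ-≤⁺ 0≤a 0≤b)

*-pos : ∀ {a b} → 0ℚ <ℚ a → 0ℚ <ℚ b → 0ℚ <ℚ a *ℚ b
*-pos {a} {b} 0<a 0<b = subst (_<ℚ a *ℚ b) (ℚₚ.*-zeroʳ a) (*-monoʳ-<⁺ 0<a 0<b)

*-cancelˡ-≡ : ∀ {a b c} → a ≢ 0ℚ → a *ℚ b ≡ a *ℚ c → b ≡ c
*-cancelˡ-≡ {a} {b} {c} a≢0 e = trans (sym (undo b)) (trans (cong (a⁻¹ *ℚ_) e) (undo c))
  where
  instance _ = ℚ.≢-nonZero a≢0
  a⁻¹ = ℚ.1/ a
  undo : ∀ x → a⁻¹ *ℚ (a *ℚ x) ≡ x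
  undo x = trans (sym (ℚₚ.*-assoc a⁻¹ a x)) (trans (cong (_*ℚ x) (ℚₚ.*-inverseˡ a)) (ℚₚ.*-identityˡ x))

*-zero-cancel : ∀ {a b} → a ≢ 0ℚ → a *ℚ b ≡ 0ℚ → b ≡ 0ℚ
*-zero-cancel {a} a≢0 e = *-cancelˡ-≡ a≢0 (trans e (sym (ℚₚ.*-zeroʳ a)))

fromℕ-suc≢0 : ∀ k → fromℕ (suc k) ≢ 0ℚ
fromℕ-suc≢0 k e = ℚₚ.<⇒≢ (0<fromℕ-suc k) (sym e)

recip-inverseˡ : ∀ k → recip k *ℚ fromℕ (suc k) ≡ 1ℚ
recip-inverseˡ k = trans (ℚₚ.*-comm (recip k) (fromℕ (suc k))) (recip-inverse k)

recip-≤ : ∀ {k l} → k ≤ l → recip l ≤ℚ recip k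
recip-≤ {k} {l} k≤l = subst₂ _≤ℚ_ lhs rhs
  (*-monoʳ-≤⁺ {rl} (ℚₚ.<⇒≤ (0<recip l)) (*-monoˡ-≤⁺ {rk} (ℚₚ.<⇒≤ (0<recip k)) (fromℕ-mono-≤ (s≤s k≤l))))
  where
  rk = recip k
  rl = recip l
  lhs : rl *ℚ (fromℕ (suc k) *ℚ rk) ≡ rl
  lhs = trans (cong (rl *ℚ_) (recip-inverse k)) (ℚₚ.*-identityʳ rl)
  rhs : rl *ℚ (fromℕ (suc l) *ℚ rk) ≡ rk
  rhs = trans (sym (ℚₚ.*-assoc rl (fromℕ (suc l)) rk)) (trans (cong (_*ℚ rk) (recip-inverseˡ l)) (ℚₚ.*-identityˡ rk))

recip-injective : ∀ {k l} → recip k ≡ recip l → k ≡ l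
recip-injective {k} {l} e = ℕₚ.suc-injective (fromℕ-injective
  (*-cancelˡ-≡ {recip k} {fromℕ (suc k)} {fromℕ (suc l)} (λ r≡0 → ℚₚ.<⇒≢ (0<recip k) (sym r≡0))
    (trans (recip-inverseˡ k) (sym (trans (cong (_*ℚ fromℕ (suc l)) e) (recip-inverseˡ l))))))

≤∧≢⇒<ℚ : ∀ {a b} → a ≤ℚ b → a ≢ b → a <ℚ b
≤∧≢⇒<ℚ {a} {b} a≤b a≢b = go (ℚₚ.<-cmp a b)
  where
  go : Tri (a <ℚ b) (a ≡ b) (b <ℚ a) → a <ℚ b
  go (tri< lt _ _) = lt
  go (tri≈ _ e _)  = contradiction e a≢b
  go (tri> _ _ gt) = contradiction (ℚₚ.<-≤-trans gt a≤b) (ℚₚ.<-irrefl refl)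

recip-< : ∀ {k l} → k < l → recip l <ℚ recip k
recip-< {k} {l} k<l = ≤∧≢⇒<ℚ (recip-≤ (ℕₚ.<⇒≤ k<l)) (ℕₚ.<⇒≢ k<l ∘ sym ∘ recip-injective)

-- Polynomials

infixl 6 _⊞_

_⊞_ : Polynomial → Polynomial → Polynomial
[]      ⊞ q       = q
(a ∷ p) ⊞ []      = a ∷ p
(a ∷ p) ⊞ (b ∷ q) = (a +ℚ b) ∷ (p ⊞ q)

scale : ℚ → Polynomial → Polynomial
scale c = List.map (c *ℚ_)

shift : Polynomial → Polynomial
shift p = 0ℚ ∷ p

infixr 7 1+_t·_

1+_t·_ : ℚ → Polynomial → Polynomial
1+ c t· p = p ⊞ shift (scale c p)

coeff-⊞ : ∀ p q j → coeff (p ⊞ q) j ≡ coeff p j +ℚ coeff q j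
coeff-⊞ []      q       j       = sym (ℚₚ.+-identityˡ _)
coeff-⊞ (a ∷ p) []      j       = sym (ℚₚ.+-identityʳ _)
coeff-⊞ (a ∷ p) (b ∷ q) zero    = refl
coeff-⊞ (a ∷ p) (b ∷ q) (suc j) = coeff-⊞ p q j

coeff-scale : ∀ c p j → coeff (scale c p) j ≡ c *ℚ coeff p j
coeff-scale c []      j       = sym (ℚₚ.*-zeroʳ c)
coeff-scale c (a ∷ p) zero    = refl
coeff-scale c (a ∷ p) (suc j) = coeff-scale c p j

coeff-1+t·-zero : ∀ c p → coeff (1+ c t· p) zero ≡ coeff p zero
coeff-1+t·-zero c p = trans (coeff-⊞ p (shift (scale c p)) zero) (ℚₚ.+-identityʳ _)

coeff-1+t·-suc : ∀ c p j → coeff (1+ c t· p) (suc j) ≡ coeff p (suc j) +ℚ c *ℚ coeff p j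
coeff-1+t·-suc c p j =
  trans (coeff-⊞ p (shift (scale c p)) (suc j)) (cong (coeff p (suc j) +ℚ_) (coeff-scale c p j))

eval-⊞ : ∀ p q t → eval (p ⊞ q) t ≡ eval p t +ℚ eval q t
eval-⊞ []      q       t = sym (ℚₚ.+-identityˡ _)
eval-⊞ (a ∷ p) []      t = sym (ℚₚ.+-identityʳ _)
eval-⊞ (a ∷ p) (b ∷ q) t = trans (cong (λ e → (a +ℚ b) +ℚ t *ℚ e) (eval-⊞ p q t))
  (solve 5 (λ a b t p q → (a :+ b) :+ t :* (p :+ q) := (a :+ t :* p) :+ (b :+ t :* q)) refl a b t (eval p t) (eval q t))
  where open +-*-Solver

eval-scale : ∀ c p t → eval (scale c p) t ≡ c *ℚ eval p t
eval-scale c []      t = sym (ℚₚ.*-zeroʳ c)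
eval-scale c (a ∷ p) t = trans (cong (λ e → c *ℚ a +ℚ t *ℚ e) (eval-scale c p t))
  (solve 4 (λ c a t p → c :* a :+ t :* (c :* p) := c :* (a :+ t :* p)) refl c a t (eval p t))
  where open +-*-Solver

eval-shift : ∀ p t → eval (shift p) t ≡ t *ℚ eval p t
eval-shift p t = ℚₚ.+-identityˡ _

eval-1+t· : ∀ c p t → eval (1+ c t· p) t ≡ (1ℚ +ℚ c *ℚ t) *ℚ eval p t
eval-1+t· c p t = trans (eval-⊞ p (shift (scale c p)) t)
    (trans (cong (eval p t +ℚ_) (trans (eval-shift (scale c p) t) (cong (t *ℚ_) (eval-scale c p t))))
  (solve 3 (λ c t p → p :+ t :* (c :* p) := (con 1ℚ :+ c :* t) :* p) refl c t (eval p t)))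
  where open +-*-Solver

eval-zero : ∀ p t → (∀ j → coeff p j ≡ 0ℚ) → eval p t ≡ 0ℚ
eval-zero []      t z = refl
eval-zero (a ∷ p) t z = trans (cong₂ (λ x y → x +ℚ t *ℚ y) (z 0) (eval-zero p t (z ∘ suc)))
  (trans (ℚₚ.+-identityˡ _) (ℚₚ.*-zeroʳ t))

-- The quotient of a ∷ p by t - r does not depend on a.
quotient : ℚ → Polynomial → Polynomial
quotient r []      = []
quotient r (b ∷ p) = eval (b ∷ p) r ∷ quotient r p

length-quotient : ∀ r p → length (quotient r p) ≡ length p
length-quotient r []      = refl
length-quotient r (b ∷ p) = cong suc (length-quotient r p)

coeff-quotient-zero : ∀ r p → coeff (quotient r p) zero ≡ eval p r
coeff-quotient-zero r []      = refl
coeff-quotient-zero r (b ∷ p) = refl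

-- Horner's scheme read backwards: these are the coefficients of `t - r` times the quotient, apart
-- from the constant one, which `quotient` does not see.
coeff-quotient : ∀ r p j → coeff p j ≡ coeff (quotient r p) j -ℚ r *ℚ coeff (quotient r p) (suc j)
coeff-quotient r []      j       = sym (trans (cong (λ e → 0ℚ -ℚ e) (ℚₚ.*-zeroʳ r)) refl)
coeff-quotient r (b ∷ p) (suc j) = coeff-quotient r p j
coeff-quotient r (b ∷ p) zero    = sym (trans (cong (λ e → (b +ℚ r *ℚ eval p r) -ℚ r *ℚ e) (coeff-quotient-zero r p))
  (solve 3 (λ b r e → (b :+ r :* e) :- r :* e := b) refl b r (eval p r)))
  where open +-*-Solver

eval-quotient : ∀ r a p t → eval (a ∷ p) t ≡ eval (a ∷ p) r +ℚ (t -ℚ r) *ℚ eval (quotient r p) t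
eval-quotient r a [] t =
  solve 3 (λ a r t → a :+ t :* con 0ℚ := (a :+ r :* con 0ℚ) :+ (t :- r) :* con 0ℚ) refl a r t
  where open +-*-Solver
eval-quotient r a (b ∷ p) t = trans (cong (λ e → a +ℚ t *ℚ e) (eval-quotient r b p t))
  (solve 5 (λ a r t x y → a :+ t :* (x :+ (t :- r) :* y) := (a :+ r :* x) :+ (t :- r) :* (x :+ t :* y)) refl
     a r t (eval (b ∷ p) r) (eval (quotient r p) t))
  where open +-*-Solver

-- Dividing by `t - N` leaves a shorter list that still vanishes at every natural number above `N`,
-- so induction on the length applies with the bound raised by one. Zero quotient coefficients force
-- zero coefficients of `p`, and the root `N` itself then gives the constant term.
roots⇒zero : ∀ m p → length p ≡ m → ∀ N → (∀ t → N ≤ t → eval p (fromℕ t) ≡ 0ℚ) → ∀ j → coeff p j ≡ 0ℚ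
roots⇒zero m       []      len N root j = refl
roots⇒zero (suc m) (a ∷ p) len N root = λ { zero → a≡0 ; (suc j) → p≡0 j }
  where
  r = fromℕ N
  root′ : ∀ t → suc N ≤ t → eval (quotient r p) (fromℕ t) ≡ 0ℚ
  root′ t N<t = *-zero-cancel {fromℕ t -ℚ r} t-r≢0
    (trans (sym (ℚₚ.+-identityˡ rest)) (trans (cong (_+ℚ rest) (sym (root N ℕₚ.≤-refl)))
      (trans (sym (eval-quotient r a p (fromℕ t))) (root t (ℕₚ.<⇒≤ N<t)))))
    where
    rest = (fromℕ t -ℚ r) *ℚ eval (quotient r p) (fromℕ t)
    t-r≢0 : fromℕ t -ℚ r ≢ 0ℚ
    t-r≢0 e = ℕₚ.<⇒≢ N<t (sym (fromℕ-injective
      (trans (solve 2 (λ t r → t := (t :- r) :+ r) refl (fromℕ t) r) (trans (cong (_+ℚ r) e) (ℚₚ.+-identityˡ r)))))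
      where open +-*-Solver
  q≡0 : ∀ j → coeff (quotient r p) j ≡ 0ℚ
  q≡0 = roots⇒zero m (quotient r p) (trans (length-quotient r p) (ℕₚ.suc-injective len)) (suc N) root′
  p≡0 : ∀ j → coeff p j ≡ 0ℚ
  p≡0 j = trans (coeff-quotient r p j)
    (trans (cong₂ (λ x y → x -ℚ r *ℚ y) (q≡0 j) (q≡0 (suc j))) (cong (λ e → 0ℚ -ℚ e) (ℚₚ.*-zeroʳ r)))
  a≡0 : a ≡ 0ℚ
  a≡0 = trans (sym (trans (cong (λ e → a +ℚ r *ℚ e) (eval-zero p r p≡0))
      (trans (cong (a +ℚ_) (ℚₚ.*-zeroʳ r)) (ℚₚ.+-identityʳ a))))
    (root N ℕₚ.≤-refl)

-- The theorem speaks of arbitrary polynomials with the right values at natural numbers; this ties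
-- their coefficients to those of the explicit ones.
eval-determines-coeff : ∀ p q → (∀ t → eval p (fromℕ t) ≡ eval q (fromℕ t)) → ∀ j → coeff p j ≡ coeff q j
eval-determines-coeff p q e j =
  trans (solve 2 (λ x y → x := (x :+ (:- con 1ℚ) :* y) :+ y) refl (coeff p j) (coeff q j))
    (trans (cong (_+ℚ coeff q j) (trans (sym (trans (coeff-⊞ p _ j) (cong (coeff p j +ℚ_) (coeff-scale (-ℚ 1ℚ) q j))))
        (zeros j)))
      (ℚₚ.+-identityˡ _))
  where
  open +-*-Solver
  zeros : ∀ j → coeff (p ⊞ scale (-ℚ 1ℚ) q) j ≡ 0ℚ
  zeros = roots⇒zero _ (p ⊞ scale (-ℚ 1ℚ) q) refl 0 λ t _ →
    trans (eval-⊞ p _ (fromℕ t)) (trans (cong₂ _+ℚ_ (e t) (eval-scale (-ℚ 1ℚ) q (fromℕ t)))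
      (solve 1 (λ y → y :+ (:- con 1ℚ) :* y := con 0ℚ) refl (eval q (fromℕ t))))

-- h k t is the number of vectors in ℕᵏ with coordinate sum t, i.e. the binomial (t + k - 1 over t).
h : ℕ → ℕ → ℕ
h zero    zero    = 1
h zero    (suc t) = 0
h (suc k) zero    = 1
h (suc k) (suc t) = h k (suc t) + h (suc k) t

h-zeroʳ : ∀ k → h k 0 ≡ 1
h-zeroʳ zero    = refl
h-zeroʳ (suc k) = refl

-- The absorption identities of binomial coefficients. In each induction step both identities
-- together turn one of the two terms of Pascal's rule into a multiple of the other, hence the
-- mutual recursion.
h-raise-t : ∀ k t → suc t * h (suc k) (suc t) ≡ (suc k + t) * h (suc k) t
h-raise-k : ∀ k t → suc k * h (2 + k) t ≡ (suc k + t) * h (suc k) t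

h-raise-t zero    t = refl
h-raise-t (suc k) t = begin
  suc t * (A + B)              ≡⟨ ℕₚ.*-distribˡ-+ (suc t) A B ⟩
  suc t * A + suc t * B        ≡⟨ cong (_+ suc t * B) (trans (h-raise-t k t) (sym (h-raise-k k t))) ⟩
  suc k * B + suc t * B        ≡⟨ ℕₚ.*-distribʳ-+ B (suc k) (suc t) ⟨
  (suc k + suc t) * B          ≡⟨ cong (_* B) (ℕₚ.+-suc (suc k) t) ⟩
  (2 + k + t) * B              ∎
  where
  open ≡-Reasoning
  A = h (suc k) (suc t)
  B = h (2 + k) t
h-raise-k k zero    = cong (_* 1) (sym (ℕₚ.+-identityʳ (suc k)))
h-raise-k k (suc t) = begin
  suc k * (A + B)              ≡⟨ ℕₚ.*-distribˡ-+ (suc k) A B ⟩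
  suc k * A + suc k * B        ≡⟨ cong (suc k * A +_) (trans (h-raise-k k t) (sym (h-raise-t k t))) ⟩
  suc k * A + suc t * A        ≡⟨ ℕₚ.*-distribʳ-+ A (suc k) (suc t) ⟨
  (suc k + suc t) * A          ∎
  where
  open ≡-Reasoning
  A = h (suc k) (suc t)
  B = h (2 + k) t

-- Binomial coefficients as polynomials

one : Polynomial
one = 1ℚ ∷ []

eval-one : ∀ t → eval one t ≡ 1ℚ
eval-one t = trans (cong (1ℚ +ℚ_) (ℚₚ.*-zeroʳ t)) (ℚₚ.+-identityʳ 1ℚ)

-- rising k p is the binomial coefficient (t + k over k), as a polynomial in t, times p.
rising : ℕ → Polynomial → Polynomial
rising zero    p = p
rising (suc k) p = 1+ recip k t· rising k p

h-rising : ∀ k t → (1ℚ +ℚ recip k *ℚ fromℕ t) *ℚ fromℕ (h (suc k) t) ≡ fromℕ (h (2 + k) t)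
h-rising k t = begin
  (1ℚ +ℚ r *ℚ T) *ℚ H                ≡⟨ cong (λ e → (e +ℚ r *ℚ T) *ℚ H) (recip-inverseˡ k) ⟨
  (r *ℚ K +ℚ r *ℚ T) *ℚ H            ≡⟨ solve 4 (λ r K T H → (r :* K :+ r :* T) :* H := r :* ((K :+ T) :* H)) refl r K T H ⟩
  r *ℚ ((K +ℚ T) *ℚ H)               ≡⟨ cong (λ e → r *ℚ (e *ℚ H)) (fromℕ-+ (suc k) t) ⟨
  r *ℚ (fromℕ (suc k + t) *ℚ H)      ≡⟨ cong (r *ℚ_) (fromℕ-* (suc k + t) (h (suc k) t)) ⟨
  r *ℚ fromℕ ((suc k + t) * h (suc k) t) ≡⟨ cong (λ e → r *ℚ fromℕ e) (h-raise-k k t) ⟨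
  r *ℚ fromℕ (suc k * h (2 + k) t)   ≡⟨ cong (r *ℚ_) (fromℕ-* (suc k) (h (2 + k) t)) ⟩
  r *ℚ (K *ℚ H′)                     ≡⟨ ℚₚ.*-assoc r K H′ ⟨
  (r *ℚ K) *ℚ H′                     ≡⟨ cong (_*ℚ H′) (recip-inverseˡ k) ⟩
  1ℚ *ℚ H′                           ≡⟨ ℚₚ.*-identityˡ H′ ⟩
  H′                                 ∎
  where
  open ≡-Reasoning
  open +-*-Solver
  r = recip k
  K = fromℕ (suc k)
  T = fromℕ t
  H = fromℕ (h (suc k) t)
  H′ = fromℕ (h (2 + k) t)

h-1 : ∀ t → h 1 t ≡ 1
h-1 zero    = refl
h-1 (suc t) = h-1 t

eval-rising : ∀ k p t → eval (rising k p) (fromℕ t) ≡ fromℕ (h (suc k) t) *ℚ eval p (fromℕ t)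
eval-rising zero    p t = sym (trans (cong (λ e → fromℕ e *ℚ eval p (fromℕ t)) (h-1 t)) (ℚₚ.*-identityˡ (eval p (fromℕ t))))
eval-rising (suc k) p t = begin
  eval (1+ recip k t· rising k p) (fromℕ t)  ≡⟨ eval-1+t· (recip k) (rising k p) (fromℕ t) ⟩
  f *ℚ eval (rising k p) (fromℕ t)           ≡⟨ cong (f *ℚ_) (eval-rising k p t) ⟩
  f *ℚ (H *ℚ P)                              ≡⟨ ℚₚ.*-assoc f H P ⟨
  (f *ℚ H) *ℚ P                              ≡⟨ cong (_*ℚ P) (h-rising k t) ⟩
  fromℕ (h (2 + k) t) *ℚ P                   ∎
  where
  open ≡-Reasoning
  f = 1ℚ +ℚ recip k *ℚ fromℕ t
  H = fromℕ (h (suc k) t)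
  P = eval p (fromℕ t)

eval-rising² : ∀ x y t → eval (rising x (rising y one)) (fromℕ t) ≡ fromℕ (h (suc x) t * h (suc y) t)
eval-rising² x y t = begin
  eval (rising x (rising y one)) (fromℕ t)   ≡⟨ eval-rising x (rising y one) t ⟩
  X *ℚ eval (rising y one) (fromℕ t)         ≡⟨ cong (X *ℚ_) (eval-rising y one t) ⟩
  X *ℚ (Y *ℚ eval one (fromℕ t))             ≡⟨ cong (λ e → X *ℚ (Y *ℚ e)) (eval-one (fromℕ t)) ⟩
  X *ℚ (Y *ℚ 1ℚ)                             ≡⟨ cong (X *ℚ_) (ℚₚ.*-identityʳ Y) ⟩
  X *ℚ Y                                     ≡⟨ fromℕ-* (h (suc x) t) (h (suc y) t) ⟨
  fromℕ (h (suc x) t * h (suc y) t)          ∎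
  where
  open ≡-Reasoning
  X = fromℕ (h (suc x) t)
  Y = fromℕ (h (suc y) t)

-- For t > 0, ψ p y t counts the multisets i₁ ≤ … ≤ i₂ₜ in a chain of p + y + 2 elements with iₜ₊₁
-- equal to the (p + 1)-st element.
ψ : ℕ → ℕ → ℕ → ℕ
ψ p y zero    = 0
ψ p y (suc t) = h (suc p) (suc t) * h (2 + y) t

-- The second factor `h (2 + y) (t - 1)` is `t / (y + 1)` times `h (1 + y) t`. Splitting off
-- `t / (y + 1)` leaves a product of binomials of total degree `p + y`, the same for all `p` when
-- `n` is fixed, and such products can be compared factor by factor.
Ψ : ℕ → ℕ → Polynomial
Ψ p y = shift (scale (recip y) (rising p (rising y one)))

eval-Ψ : ∀ p y t → eval (Ψ p y) (fromℕ t) ≡ fromℕ (ψ p y t)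
eval-Ψ p y zero    = trans (ℚₚ.+-identityˡ (0ℚ *ℚ E)) (ℚₚ.*-zeroˡ E)
  where E = eval (scale (recip y) (rising p (rising y one))) 0ℚ
eval-Ψ p y (suc t) = begin
  eval (Ψ p y) (fromℕ (suc t))                         ≡⟨ eval-shift (scale r (rising p (rising y one))) T ⟩
  T *ℚ eval (scale r (rising p (rising y one))) T      ≡⟨ cong (T *ℚ_) (eval-scale r (rising p (rising y one)) T) ⟩
  T *ℚ (r *ℚ eval (rising p (rising y one)) T)         ≡⟨ cong (λ e → T *ℚ (r *ℚ e)) (eval-rising² p y (suc t)) ⟩
  T *ℚ (r *ℚ fromℕ (h (suc p) (suc t) * h (suc y) (suc t))) ≡⟨ cong (λ e → T *ℚ (r *ℚ e))
      (fromℕ-* (h (suc p) (suc t)) (h (suc y) (suc t))) ⟩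
  T *ℚ (r *ℚ (P *ℚ Y))                                 ≡⟨ solve 4
      (λ T r P Y → T :* (r :* (P :* Y)) := P :* (r :* (T :* Y))) refl T r P Y ⟩
  P *ℚ (r *ℚ (T *ℚ Y))                                 ≡⟨ cong (λ e → P *ℚ (r *ℚ e)) (fromℕ-* (suc t) (h (suc y) (suc t))) ⟨
  P *ℚ (r *ℚ fromℕ (suc t * h (suc y) (suc t)))        ≡⟨ cong (λ e → P *ℚ (r *ℚ fromℕ e))
      (trans (h-raise-t y t) (sym (h-raise-k y t))) ⟩
  P *ℚ (r *ℚ fromℕ (suc y * h (2 + y) t))              ≡⟨ cong (λ e → P *ℚ (r *ℚ e)) (fromℕ-* (suc y) (h (2 + y) t)) ⟩
  P *ℚ (r *ℚ (Y₁ *ℚ Y₂))                               ≡⟨ cong (P *ℚ_) (ℚₚ.*-assoc r Y₁ Y₂) ⟨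
  P *ℚ ((r *ℚ Y₁) *ℚ Y₂)                               ≡⟨ cong (λ e → P *ℚ (e *ℚ Y₂)) (recip-inverseˡ y) ⟩
  P *ℚ (1ℚ *ℚ Y₂)                                      ≡⟨ cong (P *ℚ_) (ℚₚ.*-identityˡ Y₂) ⟩
  P *ℚ Y₂                                              ≡⟨ fromℕ-* (h (suc p) (suc t)) (h (2 + y) t) ⟨
  fromℕ (h (suc p) (suc t) * h (2 + y) t)              ∎
  where
  open ≡-Reasoning
  open +-*-Solver
  r = recip y
  T = fromℕ (suc t)
  P = fromℕ (h (suc p) (suc t))
  Y = fromℕ (h (suc y) (suc t))
  Y₁ = fromℕ (suc y)
  Y₂ = fromℕ (h (2 + y) t)

-- Coefficientwise comparison

Nonnegative : Polynomial → Set
Nonnegative p = ∀ j → 0ℚ ≤ℚ coeff p j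

PositiveUpTo : ℕ → Polynomial → Set
PositiveUpTo m p = ∀ j → j ≤ m → 0ℚ <ℚ coeff p j

infix 4 _≤ᶜ_

_≤ᶜ_ : Polynomial → Polynomial → Set
p ≤ᶜ q = ∀ j → coeff p j ≤ℚ coeff q j

1+t·-nonneg : ∀ {c p} → 0ℚ ≤ℚ c → Nonnegative p → Nonnegative (1+ c t· p)
1+t·-nonneg {c} {p} 0≤c 0≤p zero    = subst (0ℚ ≤ℚ_) (sym (coeff-1+t·-zero c p)) (0≤p 0)
1+t·-nonneg {c} {p} 0≤c 0≤p (suc j) = subst (0ℚ ≤ℚ_) (sym (coeff-1+t·-suc c p j))
  (ℚₚ.+-mono-≤ (0≤p (suc j)) (*-nonNeg 0≤c (0≤p j)))

-- The coefficient of degree `suc m` in `p` itself may be zero; the shifted copy of `p` makes the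
-- sum positive.
1+t·-positive : ∀ {c p m} → 0ℚ <ℚ c → Nonnegative p → PositiveUpTo m p → PositiveUpTo (suc m) (1+ c t· p)
1+t·-positive {c} {p} 0<c 0≤p 0<p zero    _         = subst (0ℚ <ℚ_) (sym (coeff-1+t·-zero c p)) (0<p 0 z≤n)
1+t·-positive {c} {p} 0<c 0≤p 0<p (suc j) (s≤s j≤m) = subst (0ℚ <ℚ_) (sym (coeff-1+t·-suc c p j))
  (ℚₚ.+-mono-≤-< (0≤p (suc j)) (*-pos 0<c (0<p j j≤m)))

1+t·-mono : ∀ {c d p q} → 0ℚ ≤ℚ c → c ≤ℚ d → Nonnegative q → p ≤ᶜ q → 1+ c t· p ≤ᶜ 1+ d t· q
1+t·-mono {c} {d} {p} {q} 0≤c c≤d 0≤q p≤q zero    =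
  subst₂ _≤ℚ_ (sym (coeff-1+t·-zero c p)) (sym (coeff-1+t·-zero d q)) (p≤q 0)
1+t·-mono {c} {d} {p} {q} 0≤c c≤d 0≤q p≤q (suc j) =
  subst₂ _≤ℚ_ (sym (coeff-1+t·-suc c p j)) (sym (coeff-1+t·-suc d q j))
    (ℚₚ.+-mono-≤ (p≤q (suc j)) (ℚₚ.≤-trans (*-monoʳ-≤⁺ 0≤c (p≤q j)) (*-monoˡ-≤⁺ (0≤q j) c≤d)))

one-nonneg : Nonnegative one
one-nonneg zero    = ℚₚ.<⇒≤ 0<1ℚ
one-nonneg (suc j) = ℚₚ.≤-refl

one-positive : PositiveUpTo 0 one
one-positive zero z≤n = 0<1ℚ

rising-nonneg : ∀ k {p} → Nonnegative p → Nonnegative (rising k p)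
rising-nonneg zero    0≤p = 0≤p
rising-nonneg (suc k) {p} 0≤p = 1+t·-nonneg {recip k} {rising k p} (ℚₚ.<⇒≤ (0<recip k)) (rising-nonneg k 0≤p)

rising-positive : ∀ k {p m} → Nonnegative p → PositiveUpTo m p → PositiveUpTo (k + m) (rising k p)
rising-positive zero    0≤p 0<p = 0<p
rising-positive (suc k) {p} 0≤p 0<p =
  1+t·-positive {recip k} {rising k p} (0<recip k) (rising-nonneg k 0≤p) (rising-positive k 0≤p 0<p)

rising² : ℕ → ℕ → Polynomial
rising² x y = rising x (rising y one)

rising²-nonneg : ∀ x y → Nonnegative (rising² x y)
rising²-nonneg x y = rising-nonneg x (rising-nonneg y one-nonneg)

rising²-positive : ∀ x y → PositiveUpTo (x + y) (rising² x y)
rising²-positive x y = subst (λ e → PositiveUpTo (x + e) (rising² x y)) (ℕₚ.+-identityʳ y)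
  (rising-positive x {rising y one} {y + 0} (rising-nonneg y one-nonneg)
      (rising-positive y {one} {0} one-nonneg one-positive))

-- The two coefficient lists are built in different orders, so the proof goes through their values.
-- It is needed because `1+_t·_` exposes only the outermost factor, and `rising²-step` has to
-- compare factors from different blocks.
rising²-comm : ∀ x y j → coeff (rising² x y) j ≡ coeff (rising² y x) j
rising²-comm x y = eval-determines-coeff (rising² x y) (rising² y x) λ t →
  trans (eval-rising² x y t) (trans (cong fromℕ (ℕₚ.*-comm (h (suc x) t) (h (suc y) t))) (sym (eval-rising² y x t)))

-- Up to the common factor rising² x y this compares 1 + t / (y + 1) with 1 + t / (x + 1).
rising²-step : ∀ {x y} → x ≤ y → rising² x (suc y) ≤ᶜ rising² (suc x) y
rising²-step {x} {y} x≤y j =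
  subst₂ _≤ℚ_ (rising²-comm (suc y) x j) (refl {x = coeff (rising² (suc x) y) j})
    (1+t·-mono {recip y} {recip x} {rising² y x} {rising² x y} (ℚₚ.<⇒≤ (0<recip y)) (recip-≤ x≤y) (rising²-nonneg x y)
      (λ i → ℚₚ.≤-reflexive (rising²-comm y x i)) j)

-- One unit is moved at a time by `rising²-step`. As long as `x < y` the condition survives a move,
-- and once `x = y` the two sides agree up to the order of the factors.
rising²-mono : ∀ d {x y} → x ≤ y → rising² x (y + d) ≤ᶜ rising² (x + d) y
rising²-mono zero {x} {y} x≤y j =
  subst₂ (λ a b → coeff (rising² x a) j ≤ℚ coeff (rising² b y) j) (sym (ℕₚ.+-identityʳ y)) (sym (ℕₚ.+-identityʳ x))
      ℚₚ.≤-refl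
rising²-mono (suc d) {x} {y} x≤y j = go (ℕₚ.m≤n⇒m<n∨m≡n x≤y)
  where
  go : x < y ⊎ x ≡ y → coeff (rising² x (y + suc d)) j ≤ℚ coeff (rising² (x + suc d) y) j
  go (inj₂ refl) = ℚₚ.≤-reflexive (rising²-comm x (x + suc d) j)
  go (inj₁ x<y)  = subst₂ (λ a b → coeff (rising² x a) j ≤ℚ coeff (rising² b y) j)
    (sym (ℕₚ.+-suc y d)) (sym (ℕₚ.+-suc x d))
    (ℚₚ.≤-trans (rising²-step {x} {y + d} (ℕₚ.≤-trans x≤y (ℕₚ.m≤m+n y d)) j) (rising²-mono d x<y j))

-- The products compare only weakly. Strictness comes from the prefactor `recip`, which grows when
-- its argument falls from `y + suc d` to `y`, multiplied by a coefficient that is positive up to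
-- the degree.
Ψ-strict : ∀ x y d → x ≤ y → ∀ j → 1 ≤ j → j ≤ suc (x + suc d + y) →
           coeff (Ψ x (y + suc d)) j <ℚ coeff (Ψ (x + suc d) y) j
Ψ-strict x y d x≤y (suc i) _ (s≤s i≤) =
  subst₂ _<ℚ_ (sym (coeff-scale (recip (y + suc d)) (rising² x (y + suc d)) i))
              (sym (coeff-scale (recip y) (rising² (x + suc d) y) i))
    (ℚₚ.≤-<-trans
      (*-monoʳ-≤⁺ (ℚₚ.<⇒≤ (0<recip (y + suc d))) (rising²-mono (suc d) x≤y i))
      (*-monoˡ-<⁺ (rising²-positive (x + suc d) y i i≤)
        (recip-< {y} {y + suc d} (ℕₚ.m<m+n y (s≤s z≤n)))))

-- Sums of a function of the class sizes

sum-mono-≤ : ∀ {k} {f g : Fin k → ℚ} → (∀ i → f i ≤ℚ g i) → sum f ≤ℚ sum g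
sum-mono-≤ {zero}  f≤g = ℚₚ.≤-refl
sum-mono-≤ {suc k} f≤g = ℚₚ.+-mono-≤ (f≤g zero) (sum-mono-≤ (f≤g ∘ suc))

sum-const-+ : ∀ m k (c : ℚ) → sum {m + k} (λ _ → c) ≡ sum {m} (λ _ → c) +ℚ sum {k} (λ _ → c)
sum-const-+ zero    k c = sym (ℚₚ.+-identityˡ (sum {k} (λ _ → c)))
sum-const-+ (suc m) k c =
  trans (cong (c +ℚ_) (sum-const-+ m k c)) (sym (ℚₚ.+-assoc c (sum {m} (λ _ → c)) (sum {k} (λ _ → c))))

zero⊎positive : ∀ k → k ≡ 0 ⊎ 0 < k
zero⊎positive zero    = inj₁ refl
zero⊎positive (suc k) = inj₂ (s≤s z≤n)

TwoZero : ℕ → ℕ → ℕ → Set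
TwoZero a b c = (a ≡ 0 × b ≡ 0) ⊎ (a ≡ 0 × c ≡ 0) ⊎ (b ≡ 0 × c ≡ 0)

-- Increments increase along every pair p < q with p + q + 2 ≤ n; this replaces convexity of the partial
-- sums, which fails beyond n / 2.
module PartialSums (n : ℕ) (δ : ℕ → ℚ) (δ-< : ∀ {p q} → p < q → 2 + p + q ≤ n → δ p <ℚ δ q) where

  Δ : ℕ → ℚ
  Δ zero    = 0ℚ
  Δ (suc p) = Δ p +ℚ δ p

  private
    -- The two sides differ by `δ b - δ a`: one element passes from a class of size `suc a` to one
    -- of size `b`.
    move : ∀ {a b} → a < b → suc a + b < n → Δ (suc a) +ℚ Δ b <ℚ Δ a +ℚ Δ (suc b)
    move {a} {b} a<b lt =
      subst₂ _<ℚ_ (solve 3 (λ x y d → (x :+ y) :+ d := (x :+ d) :+ y) refl (Δ a) (Δ b) (δ a))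
                  (ℚₚ.+-assoc (Δ a) (Δ b) (δ b))
        (ℚₚ.+-monoʳ-< (Δ a +ℚ Δ b) (δ-< a<b lt))
      where open +-*-Solver

    shift-index : ∀ e d b → e + suc d + b ≡ suc (e + d) + b
    shift-index e d b = cong (_+ b) (ℕₚ.+-suc e d)

    -- Elements are moved one by one from the smaller class to the larger until the smaller has size
    -- `e`. The smaller class stays the smaller one and the joint size does not change, so `move`
    -- remains applicable throughout.
    spread-≤′ : ∀ e d d′ → d ≤ d′ → e + d + (e + d′) < n → Δ (e + d) +ℚ Δ (e + d′) ≤ℚ Δ e +ℚ Δ (e + (d + d′))
    spread-<′ : ∀ e d d′ → suc d ≤ d′ → e + suc d + (e + d′) < n →
                Δ (e + suc d) +ℚ Δ (e + d′) <ℚ Δ e +ℚ Δ (e + (suc d + d′))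

    spread-≤′ e zero    d′ _   _  = ℚₚ.≤-reflexive (cong (λ x → Δ x +ℚ Δ (e + d′)) (ℕₚ.+-identityʳ e))
    spread-≤′ e (suc d) d′ d≤d′ lt = ℚₚ.<⇒≤ (spread-<′ e d d′ d≤d′ lt)

    spread-<′ e d d′ d<d′ lt = ℚₚ.<-≤-trans
      (subst (λ x → Δ x +ℚ Δ (e + d′) <ℚ Δ (e + d) +ℚ Δ (suc (e + d′))) (sym (ℕₚ.+-suc e d))
        (move (ℕₚ.+-monoʳ-< e d<d′) (subst (_< n) (shift-index e d (e + d′)) lt)))
      (subst₂ (λ x y → Δ (e + d) +ℚ Δ x ≤ℚ Δ e +ℚ Δ (e + y)) (ℕₚ.+-suc e d′) (ℕₚ.+-suc d d′)
        (spread-≤′ e d (suc d′) (ℕₚ.m≤n⇒m≤1+n (ℕₚ.<⇒≤ d<d′))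
          (subst (_< n) (trans (shift-index e d (e + d′))
              (trans (sym (ℕₚ.+-suc (e + d) (e + d′))) (cong (e + d +_) (sym (ℕₚ.+-suc e d′))))) lt)))

    swap-sides : ∀ e d d′ → e + d + (e + d′) < n → e + d′ + (e + d) < n
    swap-sides e d d′ = subst (_< n) (ℕₚ.+-comm (e + d) (e + d′))

  spread-≤ : ∀ e d d′ → e + d + (e + d′) < n → Δ (e + d) +ℚ Δ (e + d′) ≤ℚ Δ e +ℚ Δ (e + (d + d′))
  spread-≤ e d d′ lt = go (ℕₚ.≤-total d d′)
    where
    go : d ≤ d′ ⊎ d′ ≤ d → Δ (e + d) +ℚ Δ (e + d′) ≤ℚ Δ e +ℚ Δ (e + (d + d′))
    go (inj₁ d≤d′) = spread-≤′ e d d′ d≤d′ lt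
    go (inj₂ d′≤d) = subst₂ _≤ℚ_ (ℚₚ.+-comm (Δ (e + d′)) (Δ (e + d))) (cong (λ x → Δ e +ℚ Δ (e + x)) (ℕₚ.+-comm d′ d))
      (spread-≤′ e d′ d d′≤d (swap-sides e d d′ lt))

  spread-< : ∀ e d d′ → 0 < d → 0 < d′ → e + d + (e + d′) < n → Δ (e + d) +ℚ Δ (e + d′) <ℚ Δ e +ℚ Δ (e + (d + d′))
  spread-< e (suc d) (suc d′) _ _ lt = go (ℕₚ.≤-total d d′)
    where
    go : d ≤ d′ ⊎ d′ ≤ d → Δ (e + suc d) +ℚ Δ (e + suc d′) <ℚ Δ e +ℚ Δ (e + (suc d + suc d′))
    go (inj₁ d≤d′) = spread-<′ e d (suc d′) (s≤s d≤d′) lt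
    go (inj₂ d′≤d) = subst₂ _<ℚ_ (ℚₚ.+-comm (Δ (e + suc d′)) (Δ (e + suc d)))
        (cong (λ x → Δ e +ℚ Δ (e + x)) (ℕₚ.+-comm (suc d′) (suc d)))
      (spread-<′ e d′ (suc d) (s≤s d′≤d) (swap-sides e (suc d) (suc d′) lt))

  -- Merging two classes is spreading until one of them is empty, and `Δ 0` is zero.
  superadditive : ∀ a b → a + b < n → Δ a +ℚ Δ b ≤ℚ Δ (a + b)
  superadditive a b lt = subst (Δ a +ℚ Δ b ≤ℚ_) (ℚₚ.+-identityˡ (Δ (a + b))) (spread-≤ 0 a b lt)

  superadditive-< : ∀ a b → 0 < a → 0 < b → a + b < n → Δ a +ℚ Δ b <ℚ Δ (a + b)
  superadditive-< a b 0<a 0<b lt = subst (Δ a +ℚ Δ b <ℚ_) (ℚₚ.+-identityˡ (Δ (a + b))) (spread-< 0 a b 0<a 0<b lt)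

  superadditive-sum : ∀ {k} (a : Fin k → ℕ) → sumℕ a < n → sum (Δ ∘ a) ≤ℚ Δ (sumℕ a)
  superadditive-sum {zero}  a lt = ℚₚ.≤-refl
  superadditive-sum {suc k} a lt = ℚₚ.≤-trans
    (ℚₚ.+-monoʳ-≤ (Δ (a zero)) (superadditive-sum (a ∘ suc) (ℕₚ.≤-<-trans (ℕₚ.m≤n+m _ (a zero)) lt)))
    (superadditive (a zero) (sumℕ (a ∘ suc)) lt)

  -- Three classes are singled out. All remaining ones are merged into the third (`L₁`), then the
  -- first is reduced to size 1 in favour of the third (`L₂`), then the second likewise. At every
  -- stage some nonempty class is left aside, so the sizes involved add up to less than `n`; this is
  -- what `lt₁`, `lt₂` and `lt₃` record.
  module Merge {k} (a b c : ℕ) (r : Fin k → ℕ) (r-pos : ∀ i → 0 < r i)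
               (total : suc a + (suc b + (suc c + sumℕ r)) ≡ n) where

    private
      R = sumℕ r
      A = c + R
      L = Δ (suc a) +ℚ (Δ (suc b) +ℚ (Δ (suc c) +ℚ sum (Δ ∘ r)))
      L₁ = Δ (suc a) +ℚ (Δ (suc b) +ℚ Δ (suc A))
      L₂ = Δ 1 +ℚ (Δ (suc b) +ℚ Δ (suc (a + A)))

      total′ : n ≡ suc (suc (suc (a + (b + A))))
      total′ = sym (trans (cong suc (sym (trans (ℕₚ.+-suc a (suc (b + A))) (cong suc (ℕₚ.+-suc a (b + A))))))
        (trans (cong (λ x → suc a + suc x) (sym (ℕₚ.+-suc b A))) total))

      lt₁ : suc c + R < n
      lt₁ = subst (suc c + R <_) (sym total′)
          (s≤s (s≤s (ℕₚ.≤-trans (ℕₚ.m≤n+m A b) (ℕₚ.≤-trans (ℕₚ.m≤n+m (b + A) a) (ℕₚ.n≤1+n _)))))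

      lt₂ : suc a + suc A < n
      lt₂ = subst (suc a + suc A <_) (sym total′) (s≤s (subst (_< 2 + (a + (b + A))) (sym (ℕₚ.+-suc a A))
        (s≤s (s≤s (ℕₚ.+-monoʳ-≤ a (ℕₚ.m≤n+m A b))))))

      lt₃ : suc b + suc (a + A) < n
      lt₃ = subst (suc b + suc (a + A) <_) (sym total′) (s≤s (subst (_< 2 + (a + (b + A))) (sym (ℕₚ.+-suc b (a + A)))
        (s≤s (s≤s (ℕₚ.≤-reflexive (x∙yz≈y∙xz b a A))))))
        where open import Algebra.Properties.CommutativeSemigroup ℕₚ.+-commutativeSemigroup using (x∙yz≈y∙xz)

      swap-front : ∀ x y z → x +ℚ (y +ℚ z) ≡ y +ℚ (x +ℚ z)
      swap-front x y z = solve 3 (λ x y z → x :+ (y :+ z) := y :+ (x :+ z)) refl x y z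
        where open +-*-Solver

      R<n : R < n
      R<n = ℕₚ.≤-<-trans (ℕₚ.m≤n+m R (suc c)) lt₁

      step₁ : L ≤ℚ L₁
      step₁ = ℚₚ.+-monoʳ-≤ (Δ (suc a)) (ℚₚ.+-monoʳ-≤ (Δ (suc b))
        (ℚₚ.≤-trans (ℚₚ.+-monoʳ-≤ (Δ (suc c)) (superadditive-sum r R<n)) (superadditive (suc c) R lt₁)))

      step₁-< : 0 < k → L <ℚ L₁
      step₁-< 0<k = ℚₚ.+-monoʳ-< (Δ (suc a)) (ℚₚ.+-monoʳ-< (Δ (suc b))
        (ℚₚ.≤-<-trans (ℚₚ.+-monoʳ-≤ (Δ (suc c)) (superadditive-sum r R<n))
            (superadditive-< (suc c) R (s≤s z≤n) (0<R r r-pos 0<k) lt₁)))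
        where
        0<R : ∀ {k} (r : Fin k → ℕ) → (∀ i → 0 < r i) → 0 < k → 0 < sumℕ r
        0<R r r-pos (s≤s _) = ℕₚ.≤-trans (r-pos zero) (ℕₚ.m≤m+n (r zero) _)

      rot₂ : Δ (suc b) +ℚ (Δ (suc a) +ℚ Δ (suc A)) ≡ L₁
      rot₂ = swap-front (Δ (suc b)) (Δ (suc a)) (Δ (suc A))

      rot₂′ : Δ (suc b) +ℚ (Δ 1 +ℚ Δ (suc (a + A))) ≡ L₂
      rot₂′ = swap-front (Δ (suc b)) (Δ 1) (Δ (suc (a + A)))

      step₂ : L₁ ≤ℚ L₂
      step₂ = subst₂ _≤ℚ_ rot₂ rot₂′ (ℚₚ.+-monoʳ-≤ (Δ (suc b)) (spread-≤ 1 a A lt₂))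

      step₂-< : 0 < a → 0 < A → L₁ <ℚ L₂
      step₂-< 0<a 0<A = subst₂ _<ℚ_ rot₂ rot₂′ (ℚₚ.+-monoʳ-< (Δ (suc b)) (spread-< 1 a A 0<a 0<A lt₂))

    Extreme : ℚ
    Extreme = Δ 1 +ℚ (Δ 1 +ℚ Δ (n ∸ 2))

    private
      top : b + (a + A) ≡ n ∸ 2 ∸ 1
      top = trans (x∙yz≈y∙xz b a A) (cong (λ x → x ∸ 2 ∸ 1) (sym total′))
        where open import Algebra.Properties.CommutativeSemigroup ℕₚ.+-commutativeSemigroup using (x∙yz≈y∙xz)

      top′ : suc (b + (a + A)) ≡ n ∸ 2
      -- By `total′` the number `n` is at least 3, so a successor undoes the last truncated
      -- subtraction.
      top′ = trans (cong suc top) (subst (λ x → suc (x ∸ 2 ∸ 1) ≡ x ∸ 2) (sym total′) refl)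

      step₃ : L₂ ≤ℚ Extreme
      step₃ = ℚₚ.+-monoʳ-≤ (Δ 1) (subst (λ x → Δ (suc b) +ℚ Δ (suc (a + A)) ≤ℚ Δ 1 +ℚ Δ x) top′ (spread-≤ 1 b (a + A) lt₃))

      step₃-< : 0 < b → 0 < a + A → L₂ <ℚ Extreme
      step₃-< 0<b 0<a+A = ℚₚ.+-monoʳ-< (Δ 1)
          (subst (λ x → Δ (suc b) +ℚ Δ (suc (a + A)) <ℚ Δ 1 +ℚ Δ x) top′ (spread-< 1 b (a + A) 0<b 0<a+A lt₃))

    merge-≤ : Δ (suc a) +ℚ (Δ (suc b) +ℚ (Δ (suc c) +ℚ sum (Δ ∘ r))) ≤ℚ Extreme
    merge-≤ = ℚₚ.≤-trans step₁ (ℚₚ.≤-trans step₂ step₃)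

    -- A class outside the three makes the first stage strict. Without one, failure of `TwoZero`
    -- means that two of the three classes have at least two elements, and whichever two they are,
    -- one of the last two transfers is strict.
    merge-< : ¬ (k ≡ 0 × TwoZero a b c) → Δ (suc a) +ℚ (Δ (suc b) +ℚ (Δ (suc c) +ℚ sum (Δ ∘ r))) <ℚ Extreme
    merge-< ¬ext = go (zero⊎positive k) (zero⊎positive a) (zero⊎positive b) (zero⊎positive c)
      where
      via₂ : L₁ <ℚ L₂ → L <ℚ Extreme
      via₂ lt = ℚₚ.≤-<-trans step₁ (ℚₚ.<-≤-trans lt step₃)
      via₃ : L₂ <ℚ Extreme → L <ℚ Extreme
      via₃ lt = ℚₚ.≤-<-trans step₁ (ℚₚ.≤-<-trans step₂ lt)
      0<A : 0 < c → 0 < A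
      0<A 0<c = ℕₚ.≤-trans 0<c (ℕₚ.m≤m+n c R)
      go : k ≡ 0 ⊎ 0 < k → a ≡ 0 ⊎ 0 < a → b ≡ 0 ⊎ 0 < b → c ≡ 0 ⊎ 0 < c → L <ℚ Extreme
      go (inj₂ 0<k) _ _ _ = ℚₚ.<-≤-trans (step₁-< 0<k) (ℚₚ.≤-trans step₂ step₃)
      go (inj₁ k≡0) (inj₂ 0<a) _ (inj₂ 0<c) = via₂ (step₂-< 0<a (0<A 0<c))
      go (inj₁ k≡0) (inj₂ 0<a) (inj₂ 0<b) _ = via₃ (step₃-< 0<b (ℕₚ.≤-trans 0<a (ℕₚ.m≤m+n a A)))
      go (inj₁ k≡0) (inj₁ _) (inj₂ 0<b) (inj₂ 0<c) = via₃ (step₃-< 0<b (ℕₚ.≤-trans (0<A 0<c) (ℕₚ.m≤n+m A a)))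
      go (inj₁ k≡0) (inj₁ a≡0) (inj₁ b≡0) _ = contradiction (k≡0 , inj₁ (a≡0 , b≡0)) ¬ext
      go (inj₁ k≡0) (inj₁ a≡0) _ (inj₁ c≡0) = contradiction (k≡0 , inj₂ (inj₁ (a≡0 , c≡0))) ¬ext
      go (inj₁ k≡0) _ (inj₁ b≡0) (inj₁ c≡0) = contradiction (k≡0 , inj₂ (inj₂ (b≡0 , c≡0))) ¬ext

  private
    Δ1 : Δ 1 ≡ δ 0
    Δ1 = ℚₚ.+-identityˡ (δ 0)

  -- The opposite extreme: a class is broken into singletons. Each increment `δ p` with `p > 0`
  -- exceeds `δ 0`, and the range condition for this pair only asks that the class is not
  -- everything.
  split-≤ : ∀ a → a < n → sum {a} (λ _ → Δ 1) ≤ℚ Δ a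
  split-< : ∀ a → 1 < a → a < n → sum {a} (λ _ → Δ 1) <ℚ Δ a

  split-≤ zero          _  = ℚₚ.≤-refl
  split-≤ (suc zero)    _  = ℚₚ.≤-reflexive (ℚₚ.+-identityʳ (Δ 1))
  split-≤ (suc (suc a)) lt = ℚₚ.<⇒≤ (split-< (suc (suc a)) (s≤s (s≤s z≤n)) lt)

  split-< (suc a) (s≤s 0<a) lt = subst (_<ℚ Δ (suc a)) (ℚₚ.+-comm (sum {a} (λ _ → Δ 1)) (Δ 1))
    (ℚₚ.+-mono-≤-< (split-≤ a (ℕₚ.<-trans (ℕₚ.n<1+n a) lt)) (subst (_<ℚ δ a) (sym Δ1) (δ-< 0<a lt)))

  split-sum-≤ : ∀ {k} (a : Fin k → ℕ) → (∀ i → a i < n) → sum {sumℕ a} (λ _ → Δ 1) ≤ℚ sum (Δ ∘ a)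
  split-sum-≤ {zero}  a lt = ℚₚ.≤-refl
  split-sum-≤ {suc k} a lt = subst (_≤ℚ sum (Δ ∘ a)) (sym (sum-const-+ (a zero) (sumℕ (a ∘ suc)) (Δ 1)))
    (ℚₚ.+-mono-≤ (split-≤ (a zero) (lt zero)) (split-sum-≤ (a ∘ suc) (lt ∘ suc)))

  split-sum-< : ∀ {k} (a : Fin k → ℕ) → (∀ i → a i < n) → (∃ λ i → 1 < a i) → sum {sumℕ a} (λ _ → Δ 1) <ℚ sum (Δ ∘ a)
  split-sum-< {suc k} a lt (zero , 1<a) = subst (_<ℚ sum (Δ ∘ a)) (sym (sum-const-+ (a zero) (sumℕ (a ∘ suc)) (Δ 1)))
    (ℚₚ.+-mono-<-≤ (split-< (a zero) 1<a (lt zero)) (split-sum-≤ (a ∘ suc) (lt ∘ suc)))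
  split-sum-< {suc k} a lt (suc i , 1<a) = subst (_<ℚ sum (Δ ∘ a)) (sym (sum-const-+ (a zero) (sumℕ (a ∘ suc)) (Δ 1)))
    (ℚₚ.+-mono-≤-< (split-≤ (a zero) (lt zero)) (split-sum-< (a ∘ suc) (lt ∘ suc) (i , 1<a)))

-- Counting the vectors in which one class is too heavy

private
  module ℕ-Ring = ℕ-Solver.+-*-Solver

-- F a b j k = Σ_{i ≤ k} h a (j + i) · h b (k - i) counts the vectors in ℕᵃ × ℕᵇ with coordinate sum
-- j + k whose first part has sum at least j.
F : ℕ → ℕ → ℕ → ℕ → ℕ
F a b j zero    = h a j
F a b j (suc k) = h a j * h b (suc k) + F a b (suc j) k

-- The gain when one coordinate `z` changes sides: the vectors whose first `a` entries sum to at
-- most `j`, but to at least `j + 1` together with `z`. In such a vector the unit number `j + 1`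
-- belongs to `z`. Removing this unit cuts `z` in two, leaving `j` units on the first `a` entries
-- and one piece, and `k` units on the other piece and the remaining `b` entries.
F-step : ∀ a b j k → F (suc a) b (suc j) k ≡ F a (suc b) (suc j) k + h (suc a) j * h (suc b) k
F-step a b j zero    = cong (h a (suc j) +_) (sym (ℕₚ.*-identityʳ (h (suc a) j)))
F-step a b j (suc k) = trans (cong (h (suc a) (suc j) * h b (suc k) +_) (F-step a b (suc j) k))
  (solve 5 (λ x y u v w → (x :+ y) :* u :+ (w :+ (x :+ y) :* v) := (x :* (u :+ v) :+ w) :+ y :* (u :+ v)) refl
     (h a (suc j)) (h (suc a) j) (h b (suc k)) (h (suc b) k) (F a (suc b) (suc (suc j)) k))
  where open ℕ-Ring

F-zeroˡ : ∀ b j k → F 0 b (suc j) k ≡ 0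
F-zeroˡ b j zero    = refl
F-zeroˡ b j (suc k) = F-zeroˡ b (suc j) k

F-zeroʳ : ∀ a j k → F a 0 j k ≡ h a (j + k)
F-zeroʳ a j zero    = cong (h a) (sym (ℕₚ.+-identityʳ j))
F-zeroʳ a j (suc k) = trans (cong₂ _+_ (ℕₚ.*-zeroʳ (h a j)) (F-zeroʳ a (suc j) k)) (cong (h a) (sym (ℕₚ.+-suc j k)))

-- The number of vectors in ℕⁿ with coordinate sum 2t whose first a < n coordinates have sum above t.
φ : ℕ → ℕ → ℕ → ℕ
φ n zero    t = 0
φ n (suc p) t = φ n p t + ψ p (n ∸ (2 + p)) t

Φ : ℕ → ℕ → Polynomial
Φ n zero    = []
Φ n (suc p) = Φ n p ⊞ Ψ p (n ∸ (2 + p))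

eval-Φ : ∀ n a t → eval (Φ n a) (fromℕ t) ≡ fromℕ (φ n a t)
eval-Φ n zero    t = refl
eval-Φ n (suc p) t = trans (eval-⊞ (Φ n p) (Ψ p (n ∸ (2 + p))) (fromℕ t))
  (trans (cong₂ _+ℚ_ (eval-Φ n p t) (eval-Ψ p (n ∸ (2 + p)) t)) (sym (fromℕ-+ (φ n p t) (ψ p (n ∸ (2 + p)) t))))

φ-zero : ∀ n a → φ n a 0 ≡ 0
φ-zero n zero    = refl
φ-zero n (suc p) = trans (ℕₚ.+-identityʳ (φ n p 0)) (φ-zero n p)

-- Telescoping of `F-step`, whose increments at `j = suc k` are the `ψ p`. With `t = suc k` the
-- threshold `2 + k` is `t + 1` and the remainder `k` is `t - 1`. The total `n` stays fixed while
-- coordinates change sides.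
φ-F : ∀ a b k → φ (a + suc b) a (suc k) ≡ F a (suc b) (2 + k) k
φ-F a b k = go a b refl
  where
  n = a + suc b
  go : ∀ a b → a + suc b ≡ n → φ n a (suc k) ≡ F a (suc b) (2 + k) k
  go zero    b e = sym (F-zeroˡ (suc b) (suc k) k)
  go (suc p) b e = trans
    (cong₂ _+_ (go p (suc b) (trans (ℕₚ.+-suc p (suc b)) e)) (cong (λ y → ψ p y (suc k)) y≡b))
    (sym (F-step p (suc b) (suc k) k))
    where
    y≡b : n ∸ (2 + p) ≡ b
    y≡b = trans (cong (_∸ (2 + p)) (trans (sym e) (cong suc (ℕₚ.+-suc p b)))) (ℕₚ.m+n∸m≡n p b)

h-2 : ∀ t → h 2 t ≡ suc t
h-2 zero    = refl
h-2 (suc t) = cong₂ _+_ (h-1 t) (h-2 t)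

-- With an empty second part `F` counts all vectors of sum `2 t`. Two applications of `F-step` move
-- two coordinates over, and there `F` has become the correction of a class of size `n - 2`.
h-double : ∀ m k → h (2 + m) (suc k + suc k) ≡ φ (2 + m) m (suc k) + h (suc m) (suc k) * suc k + h (2 + m) (suc k)
h-double m k = begin
  h (2 + m) (suc k + suc k)                                        ≡⟨ cong (h (2 + m)) (ℕₚ.+-suc (suc k) k) ⟩
  h (2 + m) (2 + k + k)                                            ≡⟨ F-zeroʳ (2 + m) (2 + k) k ⟨
  F (2 + m) 0 (2 + k) k                                            ≡⟨ F-step (suc m) 0 (suc k) k ⟩
  F (suc m) 1 (2 + k) k + h (2 + m) (suc k) * h 1 k                ≡⟨ cong₂ _+_ (F-step m 1 (suc k) k)
      (cong (h (2 + m) (suc k) *_) (h-1 k)) ⟩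
  F m 2 (2 + k) k + h (suc m) (suc k) * h 2 k + h (2 + m) (suc k) * 1
    ≡⟨ cong₂ _+_ (cong₂ _+_ (trans (sym (φ-F m 1 k)) (cong (λ n → φ n m (suc k)) (ℕₚ.+-comm m 2)))
        (cong (h (suc m) (suc k) *_) (h-2 k))) (ℕₚ.*-identityʳ _) ⟩
  φ (2 + m) m (suc k) + h (suc m) (suc k) * suc k + h (2 + m) (suc k) ∎
  where open ≡-Reasoning

slope : ℕ → ℚ
slope m = fromℕ m *ℚ recip m

-- The Ehrhart polynomial of the minimal matroid of rank 2 on m + 2 elements.
ehrT : ℕ → Polynomial
ehrT m = 1+ slope m t· rising m one

eval-rising-one : ∀ k t → eval (rising k one) (fromℕ t) ≡ fromℕ (h (suc k) t)
eval-rising-one k t = trans (eval-rising k one t)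
  (trans (cong (fromℕ (h (suc k) t) *ℚ_) (eval-one (fromℕ t))) (ℚₚ.*-identityʳ (fromℕ (h (suc k) t))))

-- The count for the sizes `(m, 1, 1)`, solved for the total number of vectors. In this form it
-- replaces `h (2 + m) (t + t)` wherever an Ehrhart polynomial is evaluated.
total-count : ∀ m t → fromℕ (h (2 + m) (t + t)) ≡
  eval (ehrT m) (fromℕ t) +ℚ (fromℕ (φ (2 + m) 1 t) +ℚ (fromℕ (φ (2 + m) 1 t) +ℚ fromℕ (φ (2 + m) m t)))
total-count m zero = sym (trans (cong₂ _+ℚ_ evalT (trans (cong (λ x → 0ℚ +ℚ (0ℚ +ℚ fromℕ x)) (φ-zero (2 + m) m)) refl))
    refl)
  where
  evalT : eval (ehrT m) 0ℚ ≡ 1ℚ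
  evalT = trans (eval-1+t· (slope m) (rising m one) 0ℚ)
    (trans (cong₂ _*ℚ_ (trans (cong (1ℚ +ℚ_) (ℚₚ.*-zeroʳ (slope m))) (ℚₚ.+-identityʳ 1ℚ)) (eval-rising-one m 0))
        (ℚₚ.*-identityˡ 1ℚ))
total-count m (suc k) = begin
  fromℕ (h (2 + m) (t + t))                     ≡⟨ cong fromℕ (h-double m k) ⟩
  fromℕ (f + H₁ * t + h (2 + m) t)              ≡⟨ fromℕ-+ (f + H₁ * t) (h (2 + m) t) ⟩
  fromℕ (f + H₁ * t) +ℚ fromℕ (h (2 + m) t)     ≡⟨ cong₂ _+ℚ_
      (trans (fromℕ-+ f (H₁ * t)) (cong (fromℕ f +ℚ_) (fromℕ-* H₁ t))) (sym (h-rising m t)) ⟩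
  -- Writing `T` as `r (1 + M) T` splits off `M r T`, the term with the slope of `ehrT`. The two
  -- copies of `r T H` that remain are the corrections of the two singletons.
  fromℕ f +ℚ H *ℚ T +ℚ (1ℚ +ℚ r *ℚ T) *ℚ H      ≡⟨ cong (λ e → fromℕ f +ℚ H *ℚ e +ℚ (1ℚ +ℚ r *ℚ T) *ℚ H) unit ⟩
  fromℕ f +ℚ H *ℚ (r *ℚ (1ℚ +ℚ M) *ℚ T) +ℚ (1ℚ +ℚ r *ℚ T) *ℚ H
    ≡⟨ solve 5 (λ f H r M T → f :+ H :* (r :* (con 1ℚ :+ M) :* T) :+ (con 1ℚ :+ r :* T) :* H
          := (con 1ℚ :+ (M :* r) :* T) :* H :+ (r :* (T :* H) :+ (r :* (T :* H) :+ f))) refl (fromℕ f) H r M T ⟩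
  (1ℚ +ℚ slope m *ℚ T) *ℚ H +ℚ (r *ℚ (T *ℚ H) +ℚ (r *ℚ (T *ℚ H) +ℚ fromℕ f))
    ≡⟨ cong₂ (λ x y → x +ℚ (y +ℚ (y +ℚ fromℕ f)))
        (trans (eval-1+t· (slope m) (rising m one) T) (cong ((1ℚ +ℚ slope m *ℚ T) *ℚ_) (eval-rising-one m t))) φ1 ⟨
  eval (ehrT m) T +ℚ (fromℕ (φ (2 + m) 1 t) +ℚ (fromℕ (φ (2 + m) 1 t) +ℚ fromℕ f)) ∎
  where
  open ≡-Reasoning
  open +-*-Solver
  t = suc k
  f = φ (2 + m) m t
  H₁ = h (suc m) t
  H = fromℕ H₁
  T = fromℕ t
  r = recip m
  M = fromℕ m
  unit : T ≡ r *ℚ (1ℚ +ℚ M) *ℚ T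
  unit = sym (trans (cong (_*ℚ T) (trans (cong (r *ℚ_) (sym (fromℕ-+ 1 m))) (recip-inverseˡ m))) (ℚₚ.*-identityˡ T))
  φ1 : fromℕ (φ (2 + m) 1 t) ≡ r *ℚ (T *ℚ H)
  φ1 = begin
    fromℕ (h 1 k * h (2 + m) k)                 ≡⟨ cong (λ e → fromℕ (e * h (2 + m) k)) (h-1 k) ⟩
    fromℕ (1 * h (2 + m) k)                     ≡⟨ cong fromℕ (ℕₚ.*-identityˡ (h (2 + m) k)) ⟩
    fromℕ (h (2 + m) k)                         ≡⟨ ℚₚ.*-identityˡ (fromℕ (h (2 + m) k)) ⟨
    1ℚ *ℚ fromℕ (h (2 + m) k)                   ≡⟨ cong (_*ℚ fromℕ (h (2 + m) k)) (recip-inverseˡ m) ⟨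
    (r *ℚ fromℕ (suc m)) *ℚ fromℕ (h (2 + m) k) ≡⟨ ℚₚ.*-assoc r (fromℕ (suc m)) (fromℕ (h (2 + m) k)) ⟩
    r *ℚ (fromℕ (suc m) *ℚ fromℕ (h (2 + m) k)) ≡⟨ cong (r *ℚ_) (fromℕ-* (suc m) (h (2 + m) k)) ⟨
    r *ℚ fromℕ (suc m * h (2 + m) k)            ≡⟨ cong (λ e → r *ℚ fromℕ e) (trans (h-raise-k m k) (sym (h-raise-t m k))) ⟩
    r *ℚ fromℕ (t * H₁)                         ≡⟨ cong (r *ℚ_) (fromℕ-* t H₁) ⟩
    r *ℚ (T *ℚ H)                               ∎

-- Ehrhart polynomials in terms of class sizes

sumₚ : ∀ {s} → (Fin s → Polynomial) → Polynomial
sumₚ {zero}  p = []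
sumₚ {suc s} p = p zero ⊞ sumₚ (p ∘ suc)

coeff-sumₚ : ∀ {s} (p : Fin s → Polynomial) j → coeff (sumₚ p) j ≡ sum (λ i → coeff (p i) j)
coeff-sumₚ {zero}  p j = refl
coeff-sumₚ {suc s} p j = trans (coeff-⊞ (p zero) (sumₚ (p ∘ suc)) j) (cong (coeff (p zero) j +ℚ_) (coeff-sumₚ (p ∘ suc) j))

eval-sumₚ : ∀ {s} (p : Fin s → Polynomial) t → eval (sumₚ p) t ≡ sum (λ i → eval (p i) t)
eval-sumₚ {zero}  p t = refl
eval-sumₚ {suc s} p t = trans (eval-⊞ (p zero) (sumₚ (p ∘ suc)) t) (cong (eval (p zero) t +ℚ_) (eval-sumₚ (p ∘ suc) t))

fromℕ-sum : ∀ {s} (f : Fin s → ℕ) → fromℕ (sumℕ f) ≡ sum (fromℕ ∘ f)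
fromℕ-sum {zero}  f = refl
fromℕ-sum {suc s} f = trans (fromℕ-+ (f zero) (sumℕ (f ∘ suc))) (cong (fromℕ (f zero) +ℚ_) (fromℕ-sum (f ∘ suc)))

-- The Ehrhart polynomial of a loopless matroid of rank 2 on m + 2 elements with parallel classes of sizes a.
ehr : ∀ {s} → ℕ → (Fin s → ℕ) → Polynomial
ehr m a = ehrT m ⊞ ((Φ n 1 ⊞ (Φ n 1 ⊞ Φ n m)) ⊞ scale (-ℚ 1ℚ) (sumₚ (Φ n ∘ a)))
  where n = 2 + m

coeff-ehr : ∀ {s} m (a : Fin s → ℕ) j → let n = 2 + m in coeff (ehr m a) j ≡
  coeff (ehrT m) j +ℚ ((coeff (Φ n 1) j +ℚ (coeff (Φ n 1) j +ℚ coeff (Φ n m) j)) -ℚ sum (λ i → coeff (Φ n (a i)) j))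
coeff-ehr m a j = trans (coeff-⊞ (ehrT m) _ j) (cong (coeff (ehrT m) j +ℚ_)
  (trans (coeff-⊞ (Φ n 1 ⊞ (Φ n 1 ⊞ Φ n m)) (scale (-ℚ 1ℚ) (sumₚ (Φ n ∘ a))) j)
    (cong₂ _+ℚ_ (trans (coeff-⊞ (Φ n 1) (Φ n 1 ⊞ Φ n m) j) (cong (coeff (Φ n 1) j +ℚ_) (coeff-⊞ (Φ n 1) (Φ n m) j)))
      (trans (coeff-scale (-ℚ 1ℚ) (sumₚ (Φ n ∘ a)) j)
          (trans (cong (-ℚ 1ℚ *ℚ_) (coeff-sumₚ (Φ n ∘ a) j)) (minus (sum (λ i → coeff (Φ n (a i)) j))))))))
  where
  n = 2 + m
  minus : ∀ x → -ℚ 1ℚ *ℚ x ≡ -ℚ x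
  minus = solve 1 (λ x → (:- con 1ℚ) :* x := :- x) refl
    where open +-*-Solver

eval-ehr : ∀ {s} m (a : Fin s → ℕ) N t → N + sumℕ (λ i → φ (2 + m) (a i) t) ≡ h (2 + m) (t + t) →
           eval (ehr m a) (fromℕ t) ≡ fromℕ N
eval-ehr m a N t count = begin
  eval (ehr m a) T                                ≡⟨ eval-⊞ (ehrT m) (rest ⊞ neg) T ⟩
  E₀ +ℚ eval (rest ⊞ neg) T                       ≡⟨ cong (E₀ +ℚ_) (eval-⊞ rest neg T) ⟩
  E₀ +ℚ (eval rest T +ℚ eval neg T)               ≡⟨ cong₂ (λ x y → E₀ +ℚ (x +ℚ y)) evalRest evalNeg ⟩
  E₀ +ℚ (R +ℚ (-ℚ 1ℚ) *ℚ S)                       ≡⟨ solve 3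
      (λ E R S → E :+ (R :+ (:- con 1ℚ) :* S) := (E :+ R) :+ (:- S)) refl E₀ R S ⟩
  (E₀ +ℚ R) -ℚ S                                  ≡⟨ cong (_-ℚ S)
      (trans (sym (total-count m t)) (trans (cong fromℕ (sym count))
          (trans (fromℕ-+ N _) (cong (fromℕ N +ℚ_) (fromℕ-sum (λ i → φ n (a i) t)))))) ⟩
  (fromℕ N +ℚ S) -ℚ S                             ≡⟨ solve 2 (λ x S → (x :+ S) :- S := x) refl (fromℕ N) S ⟩
  fromℕ N                                         ∎
  where
  open ≡-Reasoning
  open +-*-Solver
  n = 2 + m
  T = fromℕ t
  E₀ = eval (ehrT m) T
  rest = Φ n 1 ⊞ (Φ n 1 ⊞ Φ n m)
  neg = scale (-ℚ 1ℚ) (sumₚ (Φ n ∘ a))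
  R = fromℕ (φ n 1 t) +ℚ (fromℕ (φ n 1 t) +ℚ fromℕ (φ n m t))
  S = sum (λ i → fromℕ (φ n (a i) t))
  evalRest : eval rest T ≡ R
  evalRest = trans (eval-⊞ (Φ n 1) (Φ n 1 ⊞ Φ n m) T) (cong₂ _+ℚ_ (eval-Φ n 1 t)
    (trans (eval-⊞ (Φ n 1) (Φ n m) T) (cong₂ _+ℚ_ (eval-Φ n 1 t) (eval-Φ n m t))))
  evalNeg : eval neg T ≡ (-ℚ 1ℚ) *ℚ S
  evalNeg = trans (eval-scale (-ℚ 1ℚ) (sumₚ (Φ n ∘ a)) T)
    (cong (-ℚ 1ℚ *ℚ_) (trans (eval-sumₚ (Φ n ∘ a) T) (sumℚ-cong (λ i → eval-Φ n (a i) t))))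

ZeroAbove : ℕ → Polynomial → Set
ZeroAbove m p = ∀ j → m < j → coeff p j ≡ 0ℚ

rising-zeroAbove : ∀ k {p m} → ZeroAbove m p → ZeroAbove (k + m) (rising k p)
rising-zeroAbove zero    z = z
rising-zeroAbove (suc k) {p} z (suc j) (s≤s lt) = trans (coeff-1+t·-suc (recip k) (rising k p) j)
  (trans (cong₂ (λ x y → x +ℚ recip k *ℚ y) (rising-zeroAbove k z (suc j) (ℕₚ.m≤n⇒m≤1+n lt)) (rising-zeroAbove k z j lt))
    (trans (ℚₚ.+-identityˡ (recip k *ℚ 0ℚ)) (ℚₚ.*-zeroʳ (recip k))))

rising²-zeroAbove : ∀ x y → ZeroAbove (x + y) (rising² x y)
rising²-zeroAbove x y = subst (λ e → ZeroAbove (x + e) (rising² x y)) (ℕₚ.+-identityʳ y)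
  (rising-zeroAbove x {rising y one} {y + 0} (rising-zeroAbove y {one} {0} (λ { (suc j) _ → refl })))

-- For these exponents every correction has coefficient zero, being divisible by `t` and of degree
-- at most `m + 1`. The increments are then all equal instead of increasing, so the exponents are
-- treated apart from the range of `Coefficient`.
OutOfRange : ℕ → ℕ → Set
OutOfRange m j = j ≡ 0 ⊎ suc m < j

Ψ-zero : ∀ x y j → OutOfRange (x + y) j → coeff (Ψ x y) j ≡ 0ℚ
Ψ-zero x y zero    _              = refl
Ψ-zero x y (suc j) (inj₂ (s≤s lt)) = trans (coeff-scale (recip y) (rising² x y) j)
  (trans (cong (recip y *ℚ_) (rising²-zeroAbove x y j lt)) (ℚₚ.*-zeroʳ (recip y)))

Φ-zero : ∀ m j → OutOfRange m j → ∀ a → a ≤ suc m → coeff (Φ (2 + m) a) j ≡ 0ℚ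
Φ-zero m j out zero    _         = refl
Φ-zero m j out (suc p) (s≤s p≤m) = trans (coeff-⊞ (Φ (2 + m) p) (Ψ p (m ∸ p)) j)
  (cong₂ _+ℚ_ (Φ-zero m j out p (ℕₚ.m≤n⇒m≤1+n p≤m))
    (Ψ-zero p (m ∸ p) j (subst (λ e → OutOfRange e j) (sym (ℕₚ.m+[n∸m]≡n p≤m)) out)))

range? : ∀ m j → OutOfRange m j ⊎ (1 ≤ j × j ≤ suc m)
range? m zero    = inj₁ (inj₁ refl)
range? m (suc j) with suc j ℕₚ.≤? suc m
... | yes j≤m = inj₂ (s≤s z≤n , j≤m)
... | no  j≰m = inj₁ (inj₂ (ℕₚ.≰⇒> j≰m))

module Coefficient (m j : ℕ) (1≤j : 1 ≤ j) (j≤ : j ≤ suc m) where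

  δ : ℕ → ℚ
  δ p = coeff (Ψ p (m ∸ p)) j

  -- This is `Ψ-strict` with `x = p`, `y = m - q` and gap `suc d = q - p`. Its condition `x ≤ y`
  -- reads `p + q ≤ m`, which is where the range restriction of `PartialSums` comes from.
  δ-< : ∀ {p q} → p < q → 2 + p + q ≤ 2 + m → δ p <ℚ δ q
  δ-< {p} {q} p<q (s≤s (s≤s p+q≤m)) = subst₂ _<ℚ_
    (cong (λ e → coeff (Ψ p e) j) (sym y+d)) (cong (λ e → coeff (Ψ e y) j) p+d)
    (Ψ-strict p y d (ℕₚ.m+n≤o⇒m≤o∸n p p+q≤m) j 1≤j (subst (λ e → j ≤ suc e) (sym (trans (cong (_+ y) p+d) q+y)) j≤))
    where
    d = proj₁ (ℕₚ.m≤n⇒∃[o]m+o≡n p<q)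
    y = m ∸ q
    p+d : p + suc d ≡ q
    p+d = trans (ℕₚ.+-suc p d) (proj₂ (ℕₚ.m≤n⇒∃[o]m+o≡n p<q))
    q+y : q + y ≡ m
    q+y = ℕₚ.m+[n∸m]≡n (ℕₚ.m+n≤o⇒n≤o p p+q≤m)
    y+d : m ∸ p ≡ y + suc d
    y+d = trans (cong (_∸ p) (trans (sym q+y) (trans (cong (_+ y) (sym p+d)) (ℕₚ.+-assoc p (suc d) y))))
      (trans (ℕₚ.m+n∸m≡n p (suc d + y)) (ℕₚ.+-comm (suc d) y))

  open PartialSums (2 + m) δ δ-< public

  coeff-Φ : ∀ a → coeff (Φ (2 + m) a) j ≡ Δ a
  coeff-Φ zero    = refl
  coeff-Φ (suc p) = trans (coeff-⊞ (Φ (2 + m) p) (Ψ p (m ∸ p)) j) (cong (_+ℚ δ p) (coeff-Φ p))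

  coeff-ehr-Δ : ∀ {s} (a : Fin s → ℕ) →
    coeff (ehr m a) j ≡ coeff (ehrT m) j +ℚ ((Δ 1 +ℚ (Δ 1 +ℚ Δ m)) -ℚ sum (Δ ∘ a))
  coeff-ehr-Δ a = trans (coeff-ehr m a j) (cong (coeff (ehrT m) j +ℚ_)
    (cong₂ _-ℚ_ (cong₂ _+ℚ_ (coeff-Φ 1) (cong₂ _+ℚ_ (coeff-Φ 1) (coeff-Φ m))) (sumℚ-cong (λ i → coeff-Φ (a i)))))

coeff-ehr-out : ∀ {s} m j → OutOfRange m j → (a : Fin s → ℕ) → (∀ i → a i ≤ suc m) → coeff (ehr m a) j ≡ coeff (ehrT m) j
coeff-ehr-out {s} m j out a a≤ = trans (coeff-ehr m a j) (trans (cong (coeff (ehrT m) j +ℚ_)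
  (cong₂ _-ℚ_ (cong₂ _+ℚ_ (z 1 (s≤s z≤n)) (cong₂ _+ℚ_ (z 1 (s≤s z≤n)) (z m (ℕₚ.n≤1+n m))))
    (trans (sumℚ-cong (λ i → z (a i) (a≤ i))) (sumℚ-0 s)))) (ℚₚ.+-identityʳ (coeff (ehrT m) j)))
  where
  z = Φ-zero m j out

private
  sub-≤ : ∀ e x {s s′} → s′ ≤ℚ s → e +ℚ (x -ℚ s) ≤ℚ e +ℚ (x -ℚ s′)
  sub-≤ e x s′≤s = ℚₚ.+-monoʳ-≤ e (ℚₚ.+-monoʳ-≤ x (ℚₚ.neg-antimono-≤ s′≤s))

  sub-< : ∀ e x {s s′} → s′ <ℚ s → e +ℚ (x -ℚ s) <ℚ e +ℚ (x -ℚ s′)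
  sub-< e x s′<s = ℚₚ.+-monoʳ-< e (ℚₚ.+-monoʳ-< x (ℚₚ.neg-antimono-< s′<s))

  cancel : ∀ e x → e +ℚ (x -ℚ x) ≡ e
  cancel e x = trans (cong (e +ℚ_) (ℚₚ.+-inverseʳ x)) (ℚₚ.+-identityʳ e)

sizesT : ℕ → Fin 3 → ℕ
sizesT m zero          = 1
sizesT m 1F = 1
sizesT m (suc (suc _)) = m

coeff-ehr-sizesT : ∀ m j → coeff (ehr m (sizesT m)) j ≡ coeff (ehrT m) j
coeff-ehr-sizesT m j = trans (coeff-ehr m (sizesT m) j)
  (trans (cong (λ e → coeff (ehrT m) j +ℚ (X -ℚ e))
      (cong (λ e → coeff (Φ (2 + m) 1) j +ℚ (coeff (Φ (2 + m) 1) j +ℚ e)) (ℚₚ.+-identityʳ (coeff (Φ (2 + m) m) j))))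
    (cancel (coeff (ehrT m) j) X))
  where
  X = coeff (Φ (2 + m) 1) j +ℚ (coeff (Φ (2 + m) 1) j +ℚ coeff (Φ (2 + m) m) j)

entry≤sum : ∀ {s} (a : Fin s → ℕ) i → a i ≤ sumℕ a
entry≤sum a zero    = ℕₚ.m≤m+n (a zero) _
entry≤sum a (suc i) = ℕₚ.≤-trans (entry≤sum (a ∘ suc) i) (ℕₚ.m≤n+m _ (a zero))

entry+entry≤sum : ∀ {s} (a : Fin s → ℕ) {i j} → i ≢ j → a i + a j ≤ sumℕ a
entry+entry≤sum a {zero}  {zero}  i≢j = contradiction refl i≢j
entry+entry≤sum a {zero}  {suc j} i≢j = ℕₚ.+-monoʳ-≤ (a zero) (entry≤sum (a ∘ suc) j)
entry+entry≤sum a {suc i} {zero}  i≢j = subst (_≤ sumℕ a) (ℕₚ.+-comm (a zero) (a (suc i)))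
    (ℕₚ.+-monoʳ-≤ (a zero) (entry≤sum (a ∘ suc) i))
entry+entry≤sum a {suc i} {suc j} i≢j = ℕₚ.≤-trans (entry+entry≤sum (a ∘ suc) (i≢j ∘ cong suc)) (ℕₚ.m≤n+m _ (a zero))

module Compare (m k : ℕ) (a : Fin (3 + k) → ℕ) (a-pos : ∀ i → 0 < a i) (a-sum : sumℕ a ≡ 2 + m) where

  a< : ∀ i → a i < 2 + m
  a< i = subst (a i <_) a-sum (ℕₚ.<-≤-trans (ℕₚ.m<m+n (a i) (a-pos _)) (entry+entry≤sum a (other-≢ i)))
    where
    other : Fin (3 + k) → Fin (3 + k)
    other zero    = suc zero
    other (suc _) = zero
    other-≢ : ∀ i → i ≢ other i
    other-≢ zero    ()
    other-≢ (suc _) ()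

  private
    A : Fin 3 → ℕ
    A i = pred (a (i Fin.↑ˡ k))

    A-suc : ∀ i → suc (A i) ≡ a (i Fin.↑ˡ k)
    A-suc i = ℕₚ.suc-pred (a (i Fin.↑ˡ k)) {{ℕ.>-nonZero (a-pos (i Fin.↑ˡ k))}}

    rest : Fin k → ℕ
    rest i = a (suc (suc (suc i)))

    total : suc (A zero) + (suc (A 1F) + (suc (A 2F) + sumℕ rest)) ≡ 2 + m
    total = trans (cong₂ _+_ (A-suc zero) (cong₂ _+_ (A-suc 1F) (cong (_+ sumℕ rest) (A-suc 2F))))
        a-sum

  -- The indices live in `Fin 3` and are embedded by `↑ˡ`, so that two classes can be named before
  -- `k ≡ 0` is known.
  NotMinimal : Set
  NotMinimal = ¬ (k ≡ 0 × ∃₂ λ (i j : Fin 3) → i ≢ j × a (i Fin.↑ˡ k) ≡ 1 × a (j Fin.↑ˡ k) ≡ 1)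

  module _ (j : ℕ) (1≤j : 1 ≤ j) (j≤ : j ≤ suc m) where
    open Coefficient m j 1≤j j≤
    open Merge (A zero) (A 1F) (A 2F) rest (λ i → a-pos (suc (suc (suc i)))) total

    private
      sum-a : Δ (suc (A zero)) +ℚ (Δ (suc (A 1F)) +ℚ (Δ (suc (A 2F)) +ℚ sum (Δ ∘ rest))) ≡ sum (Δ ∘ a)
      sum-a = cong₂ _+ℚ_ (cong Δ (A-suc zero))
          (cong₂ _+ℚ_ (cong Δ (A-suc 1F)) (cong (λ x → Δ x +ℚ sum (Δ ∘ rest)) (A-suc 2F)))

      X = Δ 1 +ℚ (Δ 1 +ℚ Δ m)
      e = coeff (ehrT m) j

      A-zero : ∀ i → A i ≡ 0 → a (i Fin.↑ˡ k) ≡ 1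
      A-zero i e = trans (sym (A-suc i)) (cong suc e)

    ehrT-≤ʲ : coeff (ehrT m) j ≤ℚ coeff (ehr m a) j
    ehrT-≤ʲ = subst₂ _≤ℚ_ (cancel e X) (sym (coeff-ehr-Δ a)) (sub-≤ e X (subst (_≤ℚ X) sum-a merge-≤))

    ehrT-< : NotMinimal → coeff (ehrT m) j <ℚ coeff (ehr m a) j
    ehrT-< notMin = subst₂ _<ℚ_ (cancel e X) (sym (coeff-ehr-Δ a)) (sub-< e X (subst (_<ℚ X) sum-a (merge-< λ where
      (k≡0 , inj₁ (p , q)) → notMin (k≡0 , zero , 1F , (λ ()) , A-zero zero p , A-zero 1F q)
      (k≡0 , inj₂ (inj₁ (p , q))) → notMin
          (k≡0 , zero , suc 1F , (λ ()) , A-zero zero p , A-zero 2F q)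
      (k≡0 , inj₂ (inj₂ (p , q))) → notMin
          (k≡0 , 1F , suc 1F , (λ ()) , A-zero 1F p , A-zero 2F q))))

    ≤ʲ-ehrU : coeff (ehr m a) j ≤ℚ coeff (ehr {2 + m} m (λ _ → 1)) j
    ≤ʲ-ehrU = subst₂ _≤ℚ_ (sym (coeff-ehr-Δ a)) (sym (coeff-ehr-Δ {2 + m} (λ _ → 1)))
      (sub-≤ e X (subst (λ s → sum {s} (λ _ → Δ 1) ≤ℚ sum (Δ ∘ a)) a-sum (split-sum-≤ a a<)))

    <-ehrU : (∃ λ i → 1 < a i) → coeff (ehr m a) j <ℚ coeff (ehr {2 + m} m (λ _ → 1)) j
    <-ehrU big = subst₂ _<ℚ_ (sym (coeff-ehr-Δ a)) (sym (coeff-ehr-Δ {2 + m} (λ _ → 1)))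
      (sub-< e X (subst (λ s → sum {s} (λ _ → Δ 1) <ℚ sum (Δ ∘ a)) a-sum (split-sum-< a a< big)))

  ehrT-≤ : ehrT m ≤ᶜ ehr m a
  ehrT-≤ j = [ (λ out → ℚₚ.≤-reflexive (sym (coeff-ehr-out m j out a (ℕₚ.≤-pred ∘ a<))))
             , (λ (1≤j , j≤) → ehrT-≤ʲ j 1≤j j≤) ]′ (range? m j)

  ≤-ehrU : ehr m a ≤ᶜ ehr {2 + m} m (λ _ → 1)
  ≤-ehrU j = [ (λ out → ℚₚ.≤-reflexive
      (trans (coeff-ehr-out m j out a (ℕₚ.≤-pred ∘ a<)) (sym (coeff-ehr-out {2 + m} m j out (λ _ → 1) (λ _ → s≤s z≤n)))))
             , (λ (1≤j , j≤) → ≤ʲ-ehrU j 1≤j j≤) ]′ (range? m j)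

-- The argument is a successor because for two elements the slope is zero: the polytope is a single
-- point and the coefficient of `t` vanishes. Three classes always give at least three elements.
ehrT-positive : ∀ m → PositiveUpTo (suc (suc m)) (ehrT (suc m))
ehrT-positive m = 1+t·-positive {slope (suc m)} {rising (suc m) one}
  (*-pos (0<fromℕ-suc m) (0<recip (suc m))) (rising-nonneg (suc m) one-nonneg)
  (subst (λ e → PositiveUpTo e (rising (suc m) one)) (ℕₚ.+-identityʳ (suc m))
      (rising-positive (suc m) {one} {0} one-nonneg one-positive))

-- Counting lattice points

card-cong : ∀ {A : Set} {P Q : Pred A 0ℓ} {N} → (∀ x → P x ⇔ Q x) → HasCardinality P N → HasCardinality Q N
card-cong P⇔Q (xs , unique , mem , len) =
  xs , unique , (λ x → mk⇔ (to (P⇔Q x) ∘ to (mem x)) (from (mem x) ∘ from (P⇔Q x))) , len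

card-unique : ∀ {A : Set} {P : Pred A 0ℓ} {M N} → HasCardinality P M → HasCardinality P N → M ≡ N
card-unique (xs , ux , memx , refl) (ys , uy , memy , refl) =
  ↭-length (∼bag⇒↭ (unique∧set⇒bag ux uy λ {x} → mk⇔ (from (memy x) ∘ to (memx x)) (from (memx x) ∘ to (memy x))))

card-empty : ∀ {A : Set} {P : Pred A 0ℓ} → (∀ x → ¬ P x) → HasCardinality P 0
card-empty ¬P = [] , AllPairs.[] , (λ x → mk⇔ (λ ()) (λ p → contradiction p (¬P x))) , refl

card-singleton : ∀ {A : Set} {P : Pred A 0ℓ} a → P a → (∀ x → P x → x ≡ a) → HasCardinality P 1
card-singleton a Pa only = a ∷ [] , All.[] AllPairs.∷ AllPairs.[]
  , (λ x → mk⇔ (λ { (Any.here refl) → Pa }) (λ Px → Any.here (only x Px))) , refl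

card-⊎ : ∀ {A : Set} {P Q R : Pred A 0ℓ} {M N} → HasCardinality P M → HasCardinality Q N →
         (∀ x → P x → Q x → Data.Empty.⊥) → (∀ x → R x ⇔ (P x ⊎ Q x)) → HasCardinality R (M + N)
card-⊎ (xs , ux , memx , refl) (ys , uy , memy , refl) disjoint R⇔ =
  xs List.++ ys
  , Uniqueₚ.++⁺ ux uy (λ {x} (x∈xs , x∈ys) → disjoint x (to (memx x) x∈xs) (to (memy x) x∈ys))
  , (λ x → mk⇔ (λ x∈ → from (R⇔ x) ([ (inj₁ ∘ to (memx x)) , (inj₂ ∘ to (memy x)) ]′ (∈-++⁻ xs x∈)))
               (λ Rx → [ (λ p → ∈-++⁺ˡ (from (memx x) p)) , (λ q → ∈-++⁺ʳ xs (from (memy x) q)) ]′ (to (R⇔ x) Rx)))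
  , Listₚ.length-++ xs

card-map : ∀ {A B : Set} {P : Pred A 0ℓ} {Q : Pred B 0ℓ} {N} (f : A → B) → (∀ {x y} → f x ≡ f y → x ≡ y) →
           (∀ y → Q y ⇔ (∃ λ x → P x × y ≡ f x)) → HasCardinality P N → HasCardinality Q N
card-map f inj Q⇔ (xs , ux , memx , refl) =
  List.map f xs
  , Uniqueₚ.map⁺ inj ux
  , (λ y → mk⇔ (λ y∈ → let x , x∈xs , y≡fx = ∈-map⁻ f y∈ in from (Q⇔ y) (x , to (memx x) x∈xs , y≡fx))
               (λ Qy → let x , Px , y≡fx = to (Q⇔ y) Qy
                       in subst (ListMem._∈ List.map f xs) (sym y≡fx) (∈-map⁺ f (from (memx x) Px))))
  , Listₚ.length-map f xs

card-difference : ∀ {A : Set} {R P : Pred A 0ℓ} {K N} → HasCardinality R K → HasCardinality P N → Decidable P →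
                  (∀ x → P x → R x) → ∃ λ L → HasCardinality (λ x → R x × ¬ P x) L × L + N ≡ K
card-difference {R = R} {P} (xs , ux , memx , len) cP P? P⊆R =
  length ys , card , card-unique (card-⊎ card cP (λ _ → λ { (_ , ¬p) p → ¬p p }) cover) (xs , ux , memx , len)
  where
  ys = List.filter (¬? ∘ P?) xs
  card : HasCardinality (λ x → R x × ¬ P x) (length ys)
  card = ys , Uniqueₚ.filter⁺ (¬? ∘ P?) ux
    , (λ x → mk⇔ (λ x∈ → let x∈xs , ¬p = ∈-filter⁻ (¬? ∘ P?) x∈ in to (memx x) x∈xs , ¬p)
                 (λ (r , ¬p) → ∈-filter⁺ (¬? ∘ P?) (from (memx x) r) ¬p)) , refl
  cover : ∀ x → R x ⇔ ((R x × ¬ P x) ⊎ P x)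
  cover x = mk⇔ split [ proj₁ , P⊆R x ]′
    where
    split : R x → (R x × ¬ P x) ⊎ P x
    split r with P? x
    ... | yes p = inj₂ p
    ... | no ¬p = inj₁ (r , ¬p)

-- Vectors with prescribed weights

weight : ∀ {n} → (Fin n → ℕ) → Vec ℕ n → ℕ
weight a x = sumℕ (λ i → a i * lookup x i)

-- Two weight functions of this kind at every coordinate are the indicators of two disjoint sets of
-- coordinates.
data Kind : ℕ → ℕ → Set where
  inA : Kind 1 0
  inB : Kind 0 1
  off : Kind 0 0

-- Coordinates of kind `off` do not contribute to either weight; unless they are forced to zero, the
-- set is infinite.
Level : ∀ {n} → (a b : Fin n → ℕ) → ℕ → ℕ → Pred (Vec ℕ n) 0ℓ
Level a b u v x = weight a x ≡ u × weight b x ≡ v × (∀ i → a i + b i ≡ 0 → lookup x i ≡ 0)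

level-swap : ∀ {n} (a b : Fin n → ℕ) u v x → Level a b u v x → Level b a v u x
level-swap a b u v x (p , q , z) = q , p , λ i e → z i (trans (ℕₚ.+-comm (a i) (b i)) e)

private
  module LevelStep {n} (a b : Fin (suc n) → ℕ)
    (ih : ∀ u v → HasCardinality (Level (a ∘ suc) (b ∘ suc) u v) (h (sumℕ (a ∘ suc)) u * h (sumℕ (b ∘ suc)) v)) where

    A = sumℕ (a ∘ suc)
    B = sumℕ (b ∘ suc)

    weight-0 : ∀ (c : Fin (suc n) → ℕ) x → weight c (0 Vec.∷ x) ≡ weight (c ∘ suc) x
    weight-0 c x = cong (_+ weight (c ∘ suc) x) (ℕₚ.*-zeroʳ (c zero))

    zero-head : ∀ {u v} y → Level a b u v (0 Vec.∷ y) ⇔ Level (a ∘ suc) (b ∘ suc) u v y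
    zero-head y = mk⇔
      (λ (p , q , z) → trans (sym (weight-0 a y)) p , trans (sym (weight-0 b y)) q , z ∘ suc)
      (λ (p , q , z) → trans (weight-0 a y) p , trans (weight-0 b y) q , λ { zero _ → refl ; (suc i) → z i })

    off-case : a zero ≡ 0 → b zero ≡ 0 → ∀ u v → HasCardinality (Level a b u v) (h (a zero + A) u * h (b zero + B) v)
    off-case a≡0 b≡0 u v = subst₂ (λ x y → HasCardinality (Level a b u v) (h (x + A) u * h (y + B) v)) (sym a≡0) (sym b≡0)
      (card-map (0 Vec.∷_) Vecₚ.∷-injectiveʳ char (ih u v))
      where
      char : ∀ y → Level a b u v y ⇔ (∃ λ x → Level (a ∘ suc) (b ∘ suc) u v x × y ≡ 0 Vec.∷ x)
      char (k ∷ x) = mk⇔ (λ l → let k≡0 = proj₂ (proj₂ l) zero (cong₂ _+_ a≡0 b≡0) in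
                             x , to (zero-head x) (subst (λ k → Level a b u v (k ∷ x)) k≡0 l) , cong (Vec._∷ x) k≡0)
                         (λ { (_ , l , refl) → from (zero-head x) l })

    -- Pascal's rule for `h`: the new coordinate is zero, or it can be lowered by one, which lowers
    -- the first weight by one. Hence the inner recursion on `u`.
    A-case : a zero ≡ 1 → b zero ≡ 0 → ∀ u v → HasCardinality (Level a b u v) (h (a zero + A) u * h (b zero + B) v)
    A-case a≡1 b≡0 u v = subst₂ (λ x y → HasCardinality (Level a b u v) (h (x + A) u * h (y + B) v)) (sym a≡1) (sym b≡0)
        (go u)
      where
      weight-a : ∀ k x → weight a (k ∷ x) ≡ k + weight (a ∘ suc) x
      weight-a k x = trans (cong (λ e → e * k + weight (a ∘ suc) x) a≡1) (cong (_+ weight (a ∘ suc) x) (ℕₚ.*-identityˡ k))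
      weight-b : ∀ k x → weight b (k ∷ x) ≡ weight (b ∘ suc) x
      weight-b k x = cong (λ e → e * k + weight (b ∘ suc) x) b≡0
      onlyA : ∀ {P : Set} → a zero + b zero ≡ 0 → P
      onlyA e = contradiction (trans (sym (cong (_+ b zero) a≡1)) e) λ ()
      headFree : ∀ {x : Vec ℕ n} k l → (∀ i → a i + b i ≡ 0 → lookup (k Vec.∷ x) i ≡ 0) → ∀ i → a i + b i ≡ 0 → lookup
          (l Vec.∷ x) i ≡ 0
      headFree k l z zero    e = onlyA e
      headFree k l z (suc i) e = z (suc i) e
      inc : Vec ℕ (suc n) → Vec ℕ (suc n)
      inc (k ∷ x) = suc k ∷ x
      inc-injective : ∀ {x y} → inc x ≡ inc y → x ≡ y
      inc-injective {k ∷ x} {l ∷ y} refl = refl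
      Tail₀ Inc : ℕ → Pred (Vec ℕ (suc n)) 0ℓ
      Tail₀ u y = ∃ λ x → Level (a ∘ suc) (b ∘ suc) u v x × y ≡ 0 Vec.∷ x
      Inc u y = ∃ λ x → Level a b u v x × y ≡ inc x
      go : ∀ u → HasCardinality (Level a b u v) (h (suc A) u * h B v)
      go zero = subst (λ e → HasCardinality (Level a b 0 v) (e * h B v)) (h-zeroʳ A)
          (card-map (0 Vec.∷_) Vecₚ.∷-injectiveʳ char (ih 0 v))
        where
        char : ∀ y → Level a b 0 v y ⇔ Tail₀ 0 y
        char (k ∷ x) = mk⇔
          (λ l → let k≡0 = ℕₚ.m+n≡0⇒m≡0 k (trans (sym (weight-a k x)) (proj₁ l)) in
             x , to (zero-head x) (subst (λ k → Level a b 0 v (k ∷ x)) k≡0 l) , cong (Vec._∷ x) k≡0)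
          (λ { (_ , l , refl) → from (zero-head x) l })
      go (suc u) = subst (HasCardinality (Level a b (suc u) v)) (sym (ℕₚ.*-distribʳ-+ (h B v) (h A (suc u)) (h (suc A) u)))
        (card-⊎ (card-map (0 Vec.∷_) Vecₚ.∷-injectiveʳ (λ _ → mk⇔ id id) (ih (suc u) v))
            (card-map inc inc-injective (λ _ → mk⇔ id id) (go u)) disjoint char)
        where
        disjoint : ∀ y → Tail₀ (suc u) y → Inc u y → Data.Empty.⊥
        disjoint y (x , _ , refl) ((k ∷ x′) , _ , ())
        split : ∀ y → Level a b (suc u) v y → Tail₀ (suc u) y ⊎ Inc u y
        split (zero ∷ x)  l           = inj₁ (x , to (zero-head x) l , refl)
        split (suc k ∷ x) (p , q , z) = inj₂ (k ∷ x
          , (trans (weight-a k x) (ℕₚ.suc-injective (trans (sym (weight-a (suc k) x)) p))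
            , trans (weight-b k x) (trans (sym (weight-b (suc k) x)) q) , headFree (suc k) k z) , refl)
        char : ∀ y → Level a b (suc u) v y ⇔ (Tail₀ (suc u) y ⊎ Inc u y)
        char y = mk⇔ (split y)
          [ (λ { (x , l , refl) → from (zero-head x) l })
          , (λ { (k ∷ x , (p , q , z) , refl) → trans (weight-a (suc k) x) (cong suc (trans (sym (weight-a k x)) p))
               , trans (weight-b (suc k) x) (trans (sym (weight-b k x)) q) , headFree k (suc k) z }) ]′

card-level : ∀ {n} (a b : Fin n → ℕ) → (∀ i → Kind (a i) (b i)) → ∀ u v → HasCardinality (Level a b u v)
    (h (sumℕ a) u * h (sumℕ b) v)
card-level {zero} a b K zero    zero    = card-singleton [] (refl , refl , λ ()) (λ { [] _ → refl })
card-level {zero} a b K zero    (suc v) = card-empty (λ { [] (_ , () , _) })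
card-level {zero} a b K (suc u) v       = card-empty (λ { [] (() , _) })
card-level {suc n} a b K u v = go (K zero) refl refl
  where
  ih = card-level (a ∘ suc) (b ∘ suc) (K ∘ suc)
  ih′ : ∀ v u → HasCardinality (Level (b ∘ suc) (a ∘ suc) v u) (h (sumℕ (b ∘ suc)) v * h (sumℕ (a ∘ suc)) u)
  ih′ v u = subst (HasCardinality _) (ℕₚ.*-comm (h (sumℕ (a ∘ suc)) u) (h (sumℕ (b ∘ suc)) v))
    (card-cong (λ x → mk⇔ (level-swap (a ∘ suc) (b ∘ suc) u v x) (level-swap (b ∘ suc) (a ∘ suc) v u x)) (ih u v))
  go : ∀ {x y} → Kind x y → a zero ≡ x → b zero ≡ y → HasCardinality (Level a b u v) (h (sumℕ a) u * h (sumℕ b) v)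
  go off a≡ b≡ = LevelStep.off-case a b ih a≡ b≡ u v
  go inA a≡ b≡ = LevelStep.A-case a b ih a≡ b≡ u v
  -- The two parts exchange their roles, so that the case of the first part serves again.
  go inB a≡ b≡ = subst (HasCardinality (Level a b u v)) (ℕₚ.*-comm (h (sumℕ b) v) (h (sumℕ a) u))
    (card-cong (λ x → mk⇔ (level-swap b a v u x) (level-swap a b u v x)) (LevelStep.A-case b a ih′ b≡ a≡ v u))

AtLeast : ∀ {n} → (a b : Fin n → ℕ) → ℕ → ℕ → Pred (Vec ℕ n) 0ℓ
AtLeast a b j k x = j ≤ weight a x × weight a x + weight b x ≡ j + k × (∀ i → a i + b i ≡ 0 → lookup x i ≡ 0)

card-atLeast : ∀ {n} (a b : Fin n → ℕ) → (∀ i → Kind (a i) (b i)) → ∀ j k →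
               HasCardinality (AtLeast a b j k) (F (sumℕ a) (sumℕ b) j k)
card-atLeast a b K j zero = subst (HasCardinality (AtLeast a b j 0))
  (trans (cong (h (sumℕ a) j *_) (h-zeroʳ (sumℕ b))) (ℕₚ.*-identityʳ _)) (card-cong char (card-level a b K j 0))
  where
  char : ∀ x → Level a b j 0 x ⇔ AtLeast a b j 0 x
  char x = mk⇔ (λ (p , q , z) → ℕₚ.≤-reflexive (sym p) , cong₂ _+_ p q , z)
    (λ (p , q , z) → let wa≡j = ℕₚ.≤-antisym (ℕₚ.≤-trans (ℕₚ.m≤m+n _ _) (ℕₚ.≤-reflexive (trans q (ℕₚ.+-identityʳ j)))) p in
       wa≡j , ℕₚ.+-cancelˡ-≡ j _ _ (trans (cong (_+ weight b x) (sym wa≡j)) q) , z)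
card-atLeast a b K j (suc k) = card-⊎ (card-level a b K j (suc k)) (card-atLeast a b K (suc j) k)
  (λ x (p , _) (q , _) → ℕₚ.<⇒≢ q (sym p)) (λ x → mk⇔ (split x) [ joinˡ x , joinʳ x ]′)
  where
  split : ∀ x → AtLeast a b j (suc k) x → Level a b j (suc k) x ⊎ AtLeast a b (suc j) k x
  split x (p , q , z) = [ (λ j<w → inj₂ (j<w , trans q (ℕₚ.+-suc j k) , z))
    , (λ j≡w → inj₁ (sym j≡w , ℕₚ.+-cancelˡ-≡ j _ _ (trans (cong (_+ weight b x) j≡w) q) , z)) ]′ (ℕₚ.m≤n⇒m<n∨m≡n p)
  joinˡ : ∀ x → Level a b j (suc k) x → AtLeast a b j (suc k) x
  joinˡ x (p , q , z) = ℕₚ.≤-reflexive (sym p) , cong₂ _+_ p q , z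
  joinʳ : ∀ x → AtLeast a b (suc j) k x → AtLeast a b j (suc k) x
  joinʳ x (p , q , z) = ℕₚ.<⇒≤ p , trans q (sym (ℕₚ.+-suc j k)) , z

-- Labellings by parallel classes

infix 8 _⟦_⟧ _⟦_⟧ᶜ

_⟦_⟧ : ∀ {s} → Maybe (Fin s) → Fin s → ℕ
nothing ⟦ r ⟧ = 0
just q  ⟦ r ⟧ = if does (q Fin.≟ r) then 1 else 0

_⟦_⟧ᶜ : ∀ {s} → Maybe (Fin s) → Fin s → ℕ
nothing ⟦ r ⟧ᶜ = 0
just q  ⟦ r ⟧ᶜ = if does (q Fin.≟ r) then 0 else 1

nonloop : ∀ {s} → Maybe (Fin s) → ℕ
nonloop nothing  = 0
nonloop (just _) = 1

⟦⟧-kind : ∀ {s} (l : Maybe (Fin s)) r → Kind (l ⟦ r ⟧) (l ⟦ r ⟧ᶜ)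
⟦⟧-kind nothing  r = off
⟦⟧-kind (just q) r with q Fin.≟ r
... | yes _ = inA
... | no _  = inB

⟦⟧+⟦⟧ᶜ : ∀ {s} (l : Maybe (Fin s)) r → l ⟦ r ⟧ + l ⟦ r ⟧ᶜ ≡ nonloop l
⟦⟧+⟦⟧ᶜ nothing  r = refl
⟦⟧+⟦⟧ᶜ (just q) r with q Fin.≟ r
... | yes _ = refl
... | no _  = refl

⟦⟧-same : ∀ {s} (r : Fin s) → just r ⟦ r ⟧ ≡ 1
⟦⟧-same r with r Fin.≟ r
... | yes _  = refl
... | no r≢r = contradiction refl r≢r

⟦⟧-diff : ∀ {s} {q r : Fin s} → q ≢ r → just q ⟦ r ⟧ ≡ 0
⟦⟧-diff {q = q} {r} q≢r with q Fin.≟ r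
... | yes q≡r = contradiction q≡r q≢r
... | no _    = refl

⟦⟧≢0⇒ : ∀ {s} (l : Maybe (Fin s)) {r} → l ⟦ r ⟧ ≢ 0 → l ≡ just r
⟦⟧≢0⇒ nothing      ne = contradiction refl ne
⟦⟧≢0⇒ (just q) {r} ne with q Fin.≟ r
... | yes refl = refl
... | no _     = contradiction refl ne

nonloop≡0⇒ : ∀ {s} (l : Maybe (Fin s)) → nonloop l ≡ 0 → l ≡ nothing
nonloop≡0⇒ nothing _ = refl

nonloop-kind : ∀ {s} (l : Maybe (Fin s)) → Kind (nonloop l) 0
nonloop-kind nothing  = off
nonloop-kind (just _) = inA

⟦⟧-sum : ∀ {s} (l : Maybe (Fin s)) → sumℕ (l ⟦_⟧) ≡ nonloop l
⟦⟧-sum {s} nothing             = sumℕ-0 s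
⟦⟧-sum {suc s} (just zero)     = cong suc (sumℕ-0 s)
⟦⟧-sum {suc s} (just (suc q))  = ⟦⟧-sum (just q)

weight-+ : ∀ {n} (a b c : Fin n → ℕ) → (∀ i → a i + b i ≡ c i) → ∀ x → weight a x + weight b x ≡ weight c x
weight-+ a b c e x = trans (sym (sumℕ-+ (λ i → a i * lookup x i) (λ i → b i * lookup x i)))
  (sumℕ-cong (λ i → trans (sym (ℕₚ.*-distribʳ-+ (lookup x i) (a i) (b i))) (cong (_* lookup x i) (e i))))

weight-0s : ∀ {n} (x : Vec ℕ n) → weight (λ _ → 0) x ≡ 0
weight-0s {n} x = sumℕ-0 n

-- f i is nothing for a loop i, and otherwise names the parallel class of i.
Labelling : ℕ → ℕ → Set
Labelling n s = Fin n → Maybe (Fin s)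

module _ {n s} (f : Labelling n s) where

  size : Fin s → ℕ
  size r = sumℕ (λ i → f i ⟦ r ⟧)

  nonloops : ℕ
  nonloops = sumℕ (nonloop ∘ f)

  classWeight : Fin s → Vec ℕ n → ℕ
  classWeight r = weight (λ i → f i ⟦ r ⟧)

  Base : ℕ → Pred (Vec ℕ n) 0ℓ
  Base t x = weight (nonloop ∘ f) x ≡ t + t × (∀ i → f i ≡ nothing → lookup x i ≡ 0)

  Good : ℕ → Pred (Vec ℕ n) 0ℓ
  Good t x = Base t x × (∀ r → classWeight r x ≤ t)

  cosize : Fin s → ℕ
  cosize r = sumℕ (λ i → f i ⟦ r ⟧ᶜ)

  size+cosize : ∀ r → size r + cosize r ≡ nonloops
  size+cosize r = trans (sym (sumℕ-+ (λ i → f i ⟦ r ⟧) (λ i → f i ⟦ r ⟧ᶜ))) (sumℕ-cong (λ i → ⟦⟧+⟦⟧ᶜ (f i) r))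

  sum-size : sumℕ size ≡ nonloops
  sum-size = trans (sumℕ-comm (λ r i → f i ⟦ r ⟧)) (sumℕ-cong (λ i → ⟦⟧-sum (f i)))

  card-Base : ∀ t → HasCardinality (Base t) (h nonloops (t + t))
  card-Base t = subst (HasCardinality (Base t))
    (trans (cong (h nonloops (t + t) *_) (h-zeroʳ (sumℕ {n} (λ _ → 0)))) (ℕₚ.*-identityʳ _))
    (card-cong (λ x → mk⇔
        (λ (p , _ , z) → p , λ i e → z i (cong (λ l → nonloop l + 0) e))
        (λ (p , z) → p , weight-0s x , λ i e → z i (nonloop≡0⇒ (f i) (ℕₚ.m+n≡0⇒m≡0 _ e))))
      (card-level (nonloop ∘ f) (λ _ → 0) (λ i → nonloop-kind (f i)) (t + t) 0))

  weight-split : ∀ r x → classWeight r x + weight (λ i → f i ⟦ r ⟧ᶜ) x ≡ weight (nonloop ∘ f) x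
  weight-split r = weight-+ (λ i → f i ⟦ r ⟧) (λ i → f i ⟦ r ⟧ᶜ) (nonloop ∘ f) (λ i → ⟦⟧+⟦⟧ᶜ (f i) r)

  -- For `t = suc k` the class weight is at least `2 + k` out of the total `(2 + k) + k`, which is
  -- what `F` counts, and `φ-F` applies because the complement of the class has positive size
  -- `suc b`. At `t = 0` the total is zero and no class can exceed it.
  card-Bad : ∀ r t → size r < nonloops → HasCardinality (λ x → Base t x × t < classWeight r x) (φ nonloops (size r) t)
  card-Bad r zero    _  = subst (HasCardinality _) (sym (φ-zero nonloops (size r)))
    (card-empty λ x ((w≡0 , _) , 0<w) → ℕₚ.<⇒≢
        (ℕₚ.<-≤-trans 0<w (ℕₚ.≤-trans (ℕₚ.m≤m+n _ _) (ℕₚ.≤-reflexive (trans (weight-split r x) w≡0)))) refl)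
  card-Bad r (suc k) lt = subst (HasCardinality _) count
    (card-cong char (card-atLeast (λ i → f i ⟦ r ⟧) (λ i → f i ⟦ r ⟧ᶜ) (λ i → ⟦⟧-kind (f i) r) (2 + k) k))
    where
    b = proj₁ (ℕₚ.m≤n⇒∃[o]m+o≡n lt)
    a+b : size r + suc b ≡ nonloops
    a+b = trans (ℕₚ.+-suc (size r) b) (proj₂ (ℕₚ.m≤n⇒∃[o]m+o≡n lt))
    cosize≡ : cosize r ≡ suc b
    cosize≡ = ℕₚ.+-cancelˡ-≡ (size r) _ _ (trans (size+cosize r) (sym a+b))
    count : F (size r) (cosize r) (2 + k) k ≡ φ nonloops (size r) (suc k)
    count = trans (cong (λ e → F (size r) e (2 + k) k) cosize≡)
      (trans (sym (φ-F (size r) b k)) (cong (λ N → φ N (size r) (suc k)) a+b))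
    char : ∀ x → AtLeast (λ i → f i ⟦ r ⟧) (λ i → f i ⟦ r ⟧ᶜ) (2 + k) k x ⇔ (Base (suc k) x × suc k < classWeight r x)
    char x = mk⇔
      (λ (p , q , z) → (trans (sym (weight-split r x)) (trans q (sym (ℕₚ.+-suc (suc k) k)))
                       , (λ i e → z i (trans (⟦⟧+⟦⟧ᶜ (f i) r) (cong nonloop e)))) , p)
      (λ ((p , z) , q) → q , trans (weight-split r x) (trans p (ℕₚ.+-suc (suc k) k))
                       , (λ i e → z i (nonloop≡0⇒ (f i) (trans (sym (⟦⟧+⟦⟧ᶜ (f i) r)) e))))

  classWeights-≤ : ∀ {r q} → r ≢ q → ∀ x → classWeight r x + classWeight q x ≤ weight (nonloop ∘ f) x
  classWeights-≤ {r} {q} r≢q x = subst (classWeight r x + classWeight q x ≤_) (weight-split r x)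
    (ℕₚ.+-monoʳ-≤ (classWeight r x) (sumℕ-mono (λ i → ℕₚ.*-monoˡ-≤ (lookup x i) (disjoint (f i)))))
    where
    sumℕ-mono : ∀ {k} {a b : Fin k → ℕ} → (∀ i → a i ≤ b i) → sumℕ a ≤ sumℕ b
    sumℕ-mono {zero}  le = z≤n
    sumℕ-mono {suc k} le = ℕₚ.+-mono-≤ (le zero) (sumℕ-mono (le ∘ suc))
    disjoint : ∀ l → l ⟦ q ⟧ ≤ l ⟦ r ⟧ᶜ
    disjoint nothing = z≤n
    disjoint (just p) with p Fin.≟ q | p Fin.≟ r
    ... | yes refl | yes refl = contradiction refl r≢q
    ... | yes _    | no _     = ℕₚ.≤-refl
    ... | no _     | _        = z≤n

  -- At most one class can exceed half of the total weight, so the bad sets of different classes are disjoint.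
  card-restricted : (∀ r → size r < nonloops) → ∀ t {k} (R : Fin k → Fin s) → (∀ {p q} → R p ≡ R q → p ≡ q) →
    ∃ λ N → HasCardinality (λ x → Base t x × (∀ q → classWeight (R q) x ≤ t)) N
          × N + sumℕ (λ q → φ nonloops (size (R q)) t) ≡ h nonloops (t + t)
  card-restricted size< t {zero}  R inj = h nonloops (t + t) , card-cong (λ x → mk⇔ (_, λ ()) proj₁) (card-Base t) ,
      ℕₚ.+-identityʳ _
  card-restricted size< t {suc k} R inj = L , card-cong char cardL
      , trans (sym (ℕₚ.+-assoc L _ _)) (trans (cong (_+ sumℕ (λ q → φ nonloops (size (R (suc q))) t)) L+bad≡K) K+rest)
    where
    restricted = card-restricted size< t (R ∘ suc) (Finₚ.suc-injective ∘ inj)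
    K = proj₁ restricted
    K+rest = proj₂ (proj₂ restricted)
    Bad : Pred (Vec ℕ n) 0ℓ
    Bad x = Base t x × t < classWeight (R zero) x
    Base? : Decidable (Base t)
    Base? x = (weight (nonloop ∘ f) x ℕ.≟ t + t) ×-dec Finₚ.all? (λ i → loop? i →-dec (lookup x i ℕ.≟ 0))
      where
      loop? : ∀ i → Dec (f i ≡ nothing)
      loop? i with f i
      ... | nothing = yes refl
      ... | just _  = no λ ()
    Bad⊆ : ∀ x → Bad x → Base t x × (∀ q → classWeight (R (suc q)) x ≤ t)
    Bad⊆ x (base , t<w) = base , λ q → ℕₚ.≮⇒≥ λ t<w′ → ℕₚ.<⇒≱ (ℕₚ.+-mono-< t<w t<w′)
      (ℕₚ.≤-trans (classWeights-≤ (λ e → contradiction (inj e) λ ()) x) (ℕₚ.≤-reflexive (proj₁ base)))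
    difference = card-difference (proj₁ (proj₂ restricted)) (card-Bad (R zero) t (size< (R zero)))
      (λ x → Base? x ×-dec (suc t ℕ.≤? classWeight (R zero) x)) Bad⊆
    L = proj₁ difference
    cardL = proj₁ (proj₂ difference)
    L+bad≡K = proj₂ (proj₂ difference)
    char : ∀ x → ((Base t x × (∀ q → classWeight (R (suc q)) x ≤ t)) × ¬ Bad x) ⇔
        (Base t x × (∀ q → classWeight (R q) x ≤ t))
    char x = mk⇔
      (λ ((base , le) , ¬bad) → base , λ { zero → ℕₚ.≮⇒≥ (λ lt → ¬bad (base , lt)) ; (suc q) → le q })
      (λ (base , le) → (base , le ∘ suc) , λ (_ , lt) → ℕₚ.<⇒≱ lt (le zero))

  card-Good : (∀ r → size r < nonloops) → ∀ t →
    ∃ λ N → HasCardinality (Good t) N × N + sumℕ (λ r → φ nonloops (size r) t) ≡ h nonloops (t + t)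
  card-Good size< t = card-restricted size< t id id

-- A total of `2 t` with both class sums at most `t` forces both sums to be exactly `t`, so the two
-- classes can be filled independently.
card-Good₂ : ∀ {n} (f : Labelling n 2) t → HasCardinality (Good f t) (h (size f zero) t * h (size f 1F) t)
card-Good₂ f t = card-cong char (card-level a b kind t t)
  where
  a b : _ → ℕ
  a i = f i ⟦ zero ⟧
  b i = f i ⟦ 1F ⟧
  kind : ∀ i → Kind (a i) (b i)
  kind i with f i
  ... | nothing         = off
  ... | just zero       = inA
  ... | just 1F = inB
  a+b : ∀ i → a i + b i ≡ nonloop (f i)
  a+b i with f i
  ... | nothing         = refl
  ... | just zero       = refl
  ... | just 1F = refl
  char : ∀ x → Level a b t t x ⇔ Good f t x
  char x = mk⇔
    (λ (p , q , z) → (trans (sym (weight-+ a b _ a+b x)) (cong₂ _+_ p q) , (λ i e → z i (trans (a+b i) (cong nonloop e))))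
       , λ { zero → ℕₚ.≤-reflexive p ; 1F → ℕₚ.≤-reflexive q })
    (λ ((p , z) , le) → let sum≡ = trans (weight-+ a b _ a+b x) p in
        ℕₚ.≤-antisym (le zero) (≥t (sum≡) (le 1F))
      , ℕₚ.≤-antisym (le 1F) (≥t (trans (ℕₚ.+-comm (weight b x) (weight a x)) sum≡) (le zero))
      , λ i e → z i (nonloop≡0⇒ (f i) (trans (sym (a+b i)) e)))
    where
    ≥t : ∀ {u v} → u + v ≡ t + t → v ≤ t → t ≤ u
    ≥t {u} {v} e v≤t = ℕₚ.+-cancelʳ-≤ t t u (ℕₚ.≤-trans (ℕₚ.≤-reflexive (sym e)) (ℕₚ.+-monoʳ-≤ u v≤t))

-- Lattice points of dilated matroid polytopes

Separated : ∀ {n s} → Labelling n s → Fin n → Fin n → Set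
Separated f i j = ∃₂ λ r q → f i ≡ just r × f j ≡ just q × r ≢ q

Labels : ∀ {n s} → Matroid n → Labelling n s → Set
Labels M f = ∀ B → IsBasis M B ⇔ (∃₂ λ i j → Separated f i j × B ≡ ⁅ i ⁆ ∪ ⁅ j ⁆)

unit : ∀ {n} → Fin n → Fin n → ℕ
unit i k = if does (i Fin.≟ k) then 1 else 0

lookup-⁅⁆ : ∀ {n} (i k : Fin n) → lookup ⁅ i ⁆ k ≡ does (i Fin.≟ k)
lookup-⁅⁆ zero    zero    = refl
lookup-⁅⁆ zero    (suc k) = Vecₚ.lookup-replicate k false
lookup-⁅⁆ (suc i) zero    = refl
lookup-⁅⁆ (suc i) (suc k) = lookup-⁅⁆ i k

lookup-pair : ∀ {n} (i j k : Fin n) → lookup (⁅ i ⁆ ∪ ⁅ j ⁆) k ≡ does (i Fin.≟ k) Bool.∨ does (j Fin.≟ k)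
lookup-pair i j k = trans (Vecₚ.lookup-zipWith Bool._∨_ k ⁅ i ⁆ ⁅ j ⁆) (cong₂ Bool._∨_ (lookup-⁅⁆ i k) (lookup-⁅⁆ j k))

separated-≢ : ∀ {n s} {f : Labelling n s} {i j} → Separated f i j → i ≢ j
separated-≢ (r , q , fi , fj , r≢q) refl with trans (sym fi) fj
... | refl = r≢q refl

unit-≢ : ∀ {n} {i k : Fin n} → i ≢ k → unit i k ≡ 0
unit-≢ {i = i} {k} i≢k with i Fin.≟ k
... | yes i≡k = contradiction i≡k i≢k
... | no _    = refl

indicator-pair : ∀ {n} {i j : Fin n} → i ≢ j → ∀ k → indicator (⁅ i ⁆ ∪ ⁅ j ⁆) k ≡ fromℕ (unit i k + unit j k)
indicator-pair {n} {i} {j} i≢j k = trans (cong (λ b → if b then 1ℚ else 0ℚ) (lookup-pair i j k))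
  (trans (fromBool (does (i Fin.≟ k) Bool.∨ does (j Fin.≟ k))) (cong fromℕ units))
  where
  fromBool : ∀ b → (if b then 1ℚ else 0ℚ) ≡ fromℕ (if b then 1 else 0)
  fromBool true  = refl
  fromBool false = refl
  units : (if does (i Fin.≟ k) Bool.∨ does (j Fin.≟ k) then 1 else 0) ≡ unit i k + unit j k
  units with i Fin.≟ k | j Fin.≟ k
  ... | yes refl | yes refl = contradiction refl i≢j
  ... | yes _    | no _     = refl
  ... | no _     | yes _    = refl
  ... | no _     | no _     = refl

⟦⟧+⟦⟧≤1 : ∀ {s} {p q : Fin s} → p ≢ q → ∀ r → just p ⟦ r ⟧ + just q ⟦ r ⟧ ≤ 1
⟦⟧+⟦⟧≤1 {p = p} {q} p≢q r with p Fin.≟ r | q Fin.≟ r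
... | yes refl | yes refl = contradiction refl p≢q
... | yes _    | no _     = ℕₚ.≤-refl
... | no _     | yes _    = ℕₚ.≤-refl
... | no _     | no _     = z≤n

sumℕ-unit : ∀ {n} (a : Fin n → ℕ) i → sumℕ (λ k → a k * unit i k) ≡ a i
sumℕ-unit {suc n} a zero    = trans
    (cong₂ _+_ (ℕₚ.*-identityʳ (a zero)) (trans (sumℕ-cong (λ k → ℕₚ.*-zeroʳ (a (suc k)))) (sumℕ-0 n)))
        (ℕₚ.+-identityʳ (a zero))
sumℕ-unit {suc n} a (suc i) = trans (cong (_+ sumℕ (λ k → a (suc k) * unit i k)) (ℕₚ.*-zeroʳ (a zero)))
    (sumℕ-unit (a ∘ suc) i)

sumℕ-units : ∀ {n} (a : Fin n → ℕ) i j → sumℕ (λ k → a k * (unit i k + unit j k)) ≡ a i + a j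
sumℕ-units a i j = trans (sumℕ-cong (λ k → ℕₚ.*-distribˡ-+ (a k) (unit i k) (unit j k)))
  (trans (sumℕ-+ (λ k → a k * unit i k) (λ k → a k * unit j k)) (cong₂ _+_ (sumℕ-unit a i) (sumℕ-unit a j)))

sumℚ-* : ∀ {k} c (f : Fin k → ℚ) → c *ℚ sum f ≡ sum (λ a → c *ℚ f a)
sumℚ-* {zero}  c f = ℚₚ.*-zeroʳ c
sumℚ-* {suc k} c f = trans (ℚₚ.*-distribˡ-+ c (f zero) (sum (f ∘ suc))) (cong (c *ℚ f zero +ℚ_) (sumℚ-* c (f ∘ suc)))

*-swap : ∀ x y z → x *ℚ (y *ℚ z) ≡ y *ℚ (x *ℚ z)
*-swap = solve 3 (λ x y z → x :* (y :* z) := y :* (x :* z)) refl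
  where open +-*-Solver

dot : ∀ {n} → Point n → Point n → ℚ
dot χ x = sum (λ i → χ i *ℚ x i)

dot-sum : ∀ {n k} (χ : Point n) (w : Fin k → ℚ) (v : Fin k → Point n) →
          dot χ (λ i → sum (λ a → w a *ℚ v a i)) ≡ sum (λ a → w a *ℚ dot χ (v a))
dot-sum χ w v = trans (sumℚ-cong
    (λ i → trans (sumℚ-* (χ i) (λ a → w a *ℚ v a i)) (sumℚ-cong (λ a → *-swap (χ i) (w a) (v a i)))))
  (trans (sumℚ-comm (λ i a → w a *ℚ (χ i *ℚ v a i))) (sumℚ-cong (λ a → sym (sumℚ-* (w a) (λ i → χ i *ℚ v a i)))))

-- The property `R` of numbers only has to be closed under convex combinations; taking `_≤ℚ c` and
-- `_≡ c` yields the inequalities and the equations of the polytope.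
conv-dot : ∀ {n} {S : Pred (Point n) 0ℓ} {x} (χ : Point n) (R : ℚ → Set) →
           (∀ {k} (w c : Fin k → ℚ) → (∀ a → 0ℚ ≤ℚ w a) → sum w ≡ 1ℚ → (∀ a → R (c a)) → R (sum (λ a → w a *ℚ c a))) →
           (∀ v → S v → R (dot χ v)) → conv S x → R (dot χ x)
conv-dot {x = x} χ R closed vertex (k , v , w , Sv , 0≤w , sum≡1 , x≡) =
  subst R (sym (trans (sumℚ-cong (λ i → cong (χ i *ℚ_) (x≡ i))) (dot-sum χ w v)))
    (closed w (λ a → dot χ (v a)) 0≤w sum≡1 (λ a → vertex (v a) (Sv a)))

conv-≤ : ∀ {n} {S : Pred (Point n) 0ℓ} {x} (χ : Point n) c → (∀ v → S v → dot χ v ≤ℚ c) → conv S x → dot χ x ≤ℚ c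
conv-≤ χ c = conv-dot χ (_≤ℚ c) λ w d 0≤w sum≡1 d≤c →
  subst (sum (λ a → w a *ℚ d a) ≤ℚ_)
    (trans (sumℚ-cong (λ a → ℚₚ.*-comm (w a) c)) (trans (sym (sumℚ-* c w)) (trans (cong (c *ℚ_) sum≡1) (ℚₚ.*-identityʳ c))))
    (sum-mono-≤ (λ a → *-monoʳ-≤⁺ (0≤w a) (d≤c a)))

conv-≡ : ∀ {n} {S : Pred (Point n) 0ℓ} {x} (χ : Point n) c → (∀ v → S v → dot χ v ≡ c) → conv S x → dot χ x ≡ c
conv-≡ χ c = conv-dot χ (_≡ c) λ w d 0≤w sum≡1 d≡c →
  trans (sumℚ-cong (λ a → trans (cong (w a *ℚ_) (d≡c a)) (ℚₚ.*-comm (w a) c)))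
    (trans (sym (sumℚ-* c w)) (trans (cong (c *ℚ_) sum≡1) (ℚₚ.*-identityʳ c)))

sum-nonneg : ∀ {k} {f : Fin k → ℚ} → (∀ i → 0ℚ ≤ℚ f i) → 0ℚ ≤ℚ sum f
sum-nonneg {zero}  0≤f = ℚₚ.≤-refl
sum-nonneg {suc k} 0≤f = ℚₚ.+-mono-≤ (0≤f zero) (sum-nonneg (0≤f ∘ suc))

Vertex : ∀ {n} → Matroid n → Pred (Point n) 0ℓ
Vertex M x = ∃ λ B → IsBasis M B × (∀ i → x i ≡ indicator B i)

indicator-nonneg : ∀ {n} (B : Subset n) i → 0ℚ ≤ℚ indicator B i
indicator-nonneg B i with lookup B i
... | true  = ℚₚ.<⇒≤ 0<1ℚ
... | false = ℚₚ.≤-refl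

polytope-nonneg : ∀ {n} (M : Matroid n) {y} → polytope M y → ∀ i → 0ℚ ≤ℚ y i
polytope-nonneg M (k , v , w , Sv , 0≤w , _ , y≡) i = subst (0ℚ ≤ℚ_) (sym (y≡ i))
  (sum-nonneg (λ a → *-nonNeg (0≤w a) (subst (0ℚ ≤ℚ_) (sym (proj₂ (proj₂ (Sv a)) i)) (indicator-nonneg (proj₁ (Sv a)) i))))

basis⇒polytope : ∀ {n} (M : Matroid n) {B} → IsBasis M B → polytope M (indicator B)
basis⇒polytope M {B} basis = 1 , (λ _ → indicator B) , (λ _ → 1ℚ) , (λ _ → B , basis , λ _ → refl) , (λ _ → ℚₚ.<⇒≤ 0<1ℚ)
    , refl
  , λ i → sym (trans (ℚₚ.+-identityʳ (1ℚ *ℚ indicator B i)) (ℚₚ.*-identityˡ (indicator B i)))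

dot-units : ∀ {n} (a : Fin n → ℕ) i j v → (∀ k → v k ≡ fromℕ (unit i k + unit j k)) → dot (fromℕ ∘ a) v ≡ fromℕ (a i + a j)
dot-units a i j v v≡ =
  trans (sumℚ-cong (λ k → trans (cong (fromℕ (a k) *ℚ_) (v≡ k)) (sym (fromℕ-* (a k) (unit i k + unit j k)))))
    (trans (sym (fromℕ-sum (λ k → a k * (unit i k + unit j k)))) (cong fromℕ (sumℕ-units a i j)))

module _ {n s} (M : Matroid n) (f : Labelling n s) (labels : Labels M f) where

  vertex-units : ∀ v → Vertex M v → ∃₂ λ i j → Separated f i j × (∀ k → v k ≡ fromℕ (unit i k + unit j k))
  vertex-units v (B , basis , v≡) = let i , j , sep , B≡ = to (labels B) basis in
    i , j , sep , λ k → trans (v≡ k) (trans (cong (λ B → indicator B k) B≡) (indicator-pair (separated-≢ {f = f} sep) k))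

  dot-vertex : ∀ (a : Fin n → ℕ) v → Vertex M v → ∃₂ λ i j → Separated f i j × dot (fromℕ ∘ a) v ≡ fromℕ (a i + a j)
  dot-vertex a v V = let i , j , sep , v≡ = vertex-units v V in i , j , sep , dot-units a i j v v≡

  polytope-total : ∀ {y} → polytope M y → dot (fromℕ ∘ nonloop ∘ f) y ≡ fromℕ 2
  polytope-total = conv-≡ (fromℕ ∘ nonloop ∘ f) (fromℕ 2) λ v V →
    let _ , _ , (_ , _ , fi , fj , _) , e = dot-vertex (nonloop ∘ f) v V
    in trans e (cong fromℕ (cong₂ _+_ (cong nonloop fi) (cong nonloop fj)))

  polytope-class : ∀ r {y} → polytope M y → dot (λ i → fromℕ (f i ⟦ r ⟧)) y ≤ℚ 1ℚ
  polytope-class r = conv-≤ (λ i → fromℕ (f i ⟦ r ⟧)) 1ℚ λ v V →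
    let _ , _ , (_ , _ , fi , fj , p≢q) , e = dot-vertex (λ i → f i ⟦ r ⟧) v V
    in ℚₚ.≤-trans (ℚₚ.≤-reflexive e)
         (fromℕ-mono-≤ {b = 1} (subst₂ (λ k l → k ⟦ r ⟧ + l ⟦ r ⟧ ≤ 1) (sym fi) (sym fj) (⟦⟧+⟦⟧≤1 p≢q r)))

  polytope-loop : ∀ i → f i ≡ nothing → ∀ {y} → polytope M y → y i ≡ 0ℚ
  polytope-loop i loop (k , v , w , Sv , _ , _ , y≡) = trans (y≡ i)
    (trans (sumℚ-cong (λ a → trans (cong (w a *ℚ_) (vertex (v a) (Sv a))) (ℚₚ.*-zeroʳ (w a)))) (sumℚ-0 k))
    where
    not-loop : ∀ {p r} → f p ≡ just r → p ≢ i
    not-loop fp refl = contradiction (trans (sym fp) loop) λ ()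
    vertex : ∀ v → Vertex M v → v i ≡ 0ℚ
    vertex v V = let p , q , (_ , _ , fp , fq , _) , v≡ = vertex-units v V in
      trans (v≡ i) (cong fromℕ (cong₂ _+_ (unit-≢ {i = p} (not-loop fp)) (unit-≢ {i = q} (not-loop fq))))

  weight-dot : ∀ (a : Fin n → ℕ) (x : Vec ℕ n) t y → (∀ i → fromℕ (lookup x i) ≡ fromℕ t *ℚ y i) →
               fromℕ (weight a x) ≡ fromℕ t *ℚ dot (fromℕ ∘ a) y
  weight-dot a x t y e = trans (fromℕ-sum (λ i → a i * lookup x i))
    (trans (sumℚ-cong (λ i → trans (fromℕ-* (a i) (lookup x i))
        (trans (cong (fromℕ (a i) *ℚ_) (e i)) (*-swap (fromℕ (a i)) (fromℕ t) (y i)))))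
      (sym (sumℚ-* (fromℕ t) (λ i → fromℕ (a i) *ℚ y i))))

  -- The easy inclusion: each condition is linear, holds at the vertices, passes to convex
  -- combinations and scales with `t`. Nonnegativity allows the integers to be replaced by their
  -- absolute values.
  latticePoint⇒good : ∀ t z → LatticePoint (dilate t (polytope M)) z → ∃ λ x → Good f t x × z ≡ Vec.map pos x
  latticePoint⇒good t z (y , Py , z≡) = x , ((total , loops) , classes) , z≡x
    where
    x = Vec.map ℤ.∣_∣ z
    0≤z : ∀ i → ℤ.0ℤ ℤ.≤ lookup z i
    0≤z i = fromℤ-cancel-≤ (subst (0ℚ ≤ℚ_) (sym (z≡ i)) (*-nonNeg (fromℕ-mono-≤ {b = t} z≤n) (polytope-nonneg M Py i)))
    z≡x′ : ∀ i → lookup z i ≡ pos (lookup x i)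
    z≡x′ i = trans (sym (ℤₚ.0≤i⇒+∣i∣≡i (0≤z i))) (cong pos (sym (Vecₚ.lookup-map i ℤ.∣_∣ z)))
    z≡x : z ≡ Vec.map pos x
    z≡x = trans (sym (Vecₚ.tabulate∘lookup z))
        (trans (Vecₚ.tabulate-cong (λ i → trans (z≡x′ i) (sym (Vecₚ.lookup-map i pos x))))
            (Vecₚ.tabulate∘lookup (Vec.map pos x)))
    x≡ : ∀ i → fromℕ (lookup x i) ≡ fromℕ t *ℚ y i
    x≡ i = trans (cong fromℤ (sym (z≡x′ i))) (z≡ i)
    total : weight (nonloop ∘ f) x ≡ t + t
    total = fromℕ-injective (trans (weight-dot (nonloop ∘ f) x t y x≡) (trans (cong (fromℕ t *ℚ_) (polytope-total Py))
      (trans (sym (fromℕ-* t 2)) (cong fromℕ (trans (ℕₚ.*-comm t 2) (cong (t +_) (ℕₚ.+-identityʳ t)))))))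
    loops : ∀ i → f i ≡ nothing → lookup x i ≡ 0
    loops i e = fromℕ-injective (trans (x≡ i) (trans (cong (fromℕ t *ℚ_) (polytope-loop i e Py)) (ℚₚ.*-zeroʳ (fromℕ t))))
    classes : ∀ r → classWeight f r x ≤ t
    classes r = fromℕ-cancel-≤ (subst₂ _≤ℚ_ (sym (weight-dot (λ i → f i ⟦ r ⟧) x t y x≡)) (ℚₚ.*-identityʳ (fromℕ t))
      (*-monoʳ-≤⁺ (fromℕ-mono-≤ {b = t} z≤n) (polytope-class r Py)))

-- Decomposition of lattice points into bases

weight-positive : ∀ {n} (a : Fin n → ℕ) x → 0 < weight a x → ∃ λ i → a i ≢ 0 × lookup x i ≢ 0
weight-positive {n} a x 0<w with Finₚ.any? (λ i → ¬? (a i ℕ.≟ 0) ×-dec ¬? (lookup x i ℕ.≟ 0))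
... | yes found = found
... | no none   = contradiction (trans (sumℕ-cong vanish) (sumℕ-0 n)) (ℕₚ.<⇒≢ 0<w ∘ sym)
  where
  vanish : ∀ i → a i * lookup x i ≡ 0
  vanish i with a i ℕ.≟ 0 | lookup x i ℕ.≟ 0
  ... | yes e | _     = cong (_* lookup x i) e
  ... | no _  | yes e = trans (cong (a i *_) e) (ℕₚ.*-zeroʳ (a i))
  ... | no p  | no q  = contradiction (i , p , q) none

module _ {n s} (f : Labelling n s) where

  Decomposition : ℕ → (Fin n → ℕ) → Set
  Decomposition t x = ∃ λ (p : Fin t → Fin n × Fin n) → (∀ a → Separated f (proj₁ (p a)) (proj₂ (p a)))
    × (∀ k → x k ≡ sumℕ (λ a → unit (proj₁ (p a)) k + unit (proj₂ (p a)) k))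

  private
    module Remove (t : ℕ) (x : Vec ℕ n) (good : Good f (suc t) x) (i j : Fin n) (xi : lookup x i ≢ 0) (xj : lookup x j ≢ 0)
                  (sep : Separated f i j) where

      y : Vec ℕ n
      y = Vec.tabulate (λ k → lookup x k ∸ (unit i k + unit j k))

      -- The ends of a separated pair are distinct, so no coordinate loses more than one unit and
      -- the truncated subtraction in `y` is exact.
      units≤x : ∀ k → unit i k + unit j k ≤ lookup x k
      units≤x k with i Fin.≟ k | j Fin.≟ k
      ... | yes refl | yes refl = contradiction refl (separated-≢ {f = f} sep)
      ... | yes refl | no _     = ℕₚ.n≢0⇒n>0 xi
      ... | no _     | yes refl = ℕₚ.n≢0⇒n>0 xj
      ... | no _     | no _     = z≤n

      x-split : ∀ k → lookup x k ≡ unit i k + unit j k + lookup y k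
      x-split k = sym (trans (cong (unit i k + unit j k +_) (Vecₚ.lookup∘tabulate _ k)) (ℕₚ.m+[n∸m]≡n (units≤x k)))

      weight-x : ∀ a → weight a x ≡ a i + a j + weight a y
      weight-x a = trans (sumℕ-cong (λ k → trans (cong (a k *_) (x-split k))
          (ℕₚ.*-distribˡ-+ (a k) (unit i k + unit j k) (lookup y k))))
        (trans (sumℕ-+ (λ k → a k * (unit i k + unit j k)) (λ k → a k * lookup y k))
            (cong (_+ weight a y) (sumℕ-units a i j)))

      fi = proj₁ (proj₂ (proj₂ sep))
      fj = proj₁ (proj₂ (proj₂ (proj₂ sep)))

      base : Base f t y
      base = ℕₚ.+-cancelˡ-≡ 2 _ _ (trans
          (sym (trans (weight-x (nonloop ∘ f)) (cong₂ (λ k l → nonloop k + nonloop l + weight (nonloop ∘ f) y) fi fj)))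
               (trans (proj₁ (proj₁ good)) (cong suc (ℕₚ.+-suc t t))))
           , λ k loop → ℕₚ.n≤0⇒n≡0 (ℕₚ.≤-trans (ℕₚ.m≤n+m (lookup y k) (unit i k + unit j k))
               (ℕₚ.≤-reflexive (trans (sym (x-split k)) (proj₂ (proj₁ good) k loop))))

      class-y : ∀ r → classWeight f r y ≤ classWeight f r x
      class-y r = ℕₚ.≤-trans (ℕₚ.m≤n+m _ (f i ⟦ r ⟧ + f j ⟦ r ⟧)) (ℕₚ.≤-reflexive (sym (weight-x (λ k → f k ⟦ r ⟧))))

      extend : Decomposition t (lookup y) → Decomposition (suc t) (lookup x)
      extend (p , p-sep , y≡) = q , q-sep , λ k → trans (x-split k) (cong (unit i k + unit j k +_) (y≡ k))
        where
        q : Fin (suc t) → Fin n × Fin n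
        q zero    = i , j
        q (suc a) = p a
        q-sep : ∀ a → Separated f (proj₁ (q a)) (proj₂ (q a))
        q-sep zero    = sep
        q-sep (suc a) = p-sep a

    ⟦⟧ᶜ≢0⇒ : ∀ (l : Maybe (Fin s)) {r} → l ⟦ r ⟧ᶜ ≢ 0 → ∃ λ q → l ≡ just q × r ≢ q
    ⟦⟧ᶜ≢0⇒ nothing      ne = contradiction refl ne
    ⟦⟧ᶜ≢0⇒ (just q) {r} ne with q Fin.≟ r
    ... | yes _  = contradiction refl ne
    ... | no q≢r = q , refl , q≢r ∘ sym

    nonloop≢0⇒ : ∀ (l : Maybe (Fin s)) → nonloop l ≢ 0 → ∃ λ q → l ≡ just q
    nonloop≢0⇒ nothing  ne = contradiction refl ne
    nonloop≢0⇒ (just q) ne = q , refl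

    -- A single class carries at most half of the positive total, so something is left for the other
    -- classes.
    outside : ∀ t x → Good f (suc t) x → ∀ r → ∃ λ j → lookup x j ≢ 0 × ∃ λ q → f j ≡ just q × r ≢ q
    outside t x ((total , _) , le) r = let j , fj≢0 , xj≢0 = weight-positive (λ k → f k ⟦ r ⟧ᶜ) x positive
                                       in j , xj≢0 , ⟦⟧ᶜ≢0⇒ (f j) fj≢0
      where
      positive : 0 < weight (λ k → f k ⟦ r ⟧ᶜ) x
      positive = ℕₚ.≤-trans (s≤s z≤n) (ℕₚ.+-cancelˡ-≤ (suc t) (suc t) _
        (ℕₚ.≤-trans (ℕₚ.≤-reflexive (sym (trans (weight-split f r x) total))) (ℕₚ.+-monoˡ-≤ _ (le r))))

  -- A basis {i, j} is split off, with i from a class of full weight t if there is one and j from another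
  -- class. A full class keeps weight t - 1 out of the total 2 (t - 1), so no other class exceeds t - 1.
  decompose : ∀ t x → Good f t x → Decomposition t (lookup x)
  decompose zero x ((total , loops) , _) = (λ ()) , (λ ()) , vanish
    where
    vanish : ∀ k → lookup x k ≡ 0
    vanish k = go (f k) refl
      where
      go : ∀ l → f k ≡ l → lookup x k ≡ 0
      go nothing  e = loops k e
      go (just r) e = ℕₚ.n≤0⇒n≡0 (ℕₚ.≤-trans
          (ℕₚ.≤-reflexive (sym (trans (cong (λ l → nonloop l * lookup x k) e) (ℕₚ.*-identityˡ _))))
        (ℕₚ.≤-trans (entry≤sum (λ k → nonloop (f k) * lookup x k) k) (ℕₚ.≤-reflexive total)))
  decompose (suc t) x good@((total , _) , le) with Finₚ.any? (λ r → classWeight f r x ℕ.≟ suc t)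
  ... | yes (r , full) = extend (decompose t y (base , class≤))
    where
    found-i = weight-positive (λ k → f k ⟦ r ⟧) x (subst (0 <_) (sym full) (s≤s z≤n))
    i = proj₁ found-i
    fi : f i ≡ just r
    fi = ⟦⟧≢0⇒ (f i) (proj₁ (proj₂ found-i))
    found-j = outside t x good r
    j = proj₁ found-j
    q = proj₁ (proj₂ (proj₂ found-j))
    fj : f j ≡ just q
    fj = proj₁ (proj₂ (proj₂ (proj₂ found-j)))
    r≢q : r ≢ q
    r≢q = proj₂ (proj₂ (proj₂ (proj₂ found-j)))
    open Remove t x good i j (proj₂ (proj₂ found-i)) (proj₁ (proj₂ found-j)) (r , q , fi , fj , r≢q) hiding (fi; fj)
    class-r : classWeight f r y ≡ t
    class-r = ℕₚ.suc-injective (sym (trans (sym full) (trans (weight-x (λ k → f k ⟦ r ⟧))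
      (cong (_+ classWeight f r y) (cong₂ _+_ (trans (cong (_⟦ r ⟧) fi) (⟦⟧-same r))
          (trans (cong (_⟦ r ⟧) fj) (⟦⟧-diff (r≢q ∘ sym))))))))
    class≤ : ∀ r′ → classWeight f r′ y ≤ t
    class≤ r′ with r Fin.≟ r′
    ... | yes refl = ℕₚ.≤-reflexive class-r
    ... | no r≢r′  = ℕₚ.+-cancelˡ-≤ t _ _ (subst (λ w → w + classWeight f r′ y ≤ t + t) class-r
      (ℕₚ.≤-trans (classWeights-≤ f r≢r′ y) (ℕₚ.≤-reflexive (proj₁ base))))
  ... | no none = extend (decompose t y (base , class≤))
    where
    found-i = weight-positive (nonloop ∘ f) x (subst (0 <_) (sym total) (s≤s z≤n))
    i = proj₁ found-i
    r = proj₁ (nonloop≢0⇒ (f i) (proj₁ (proj₂ found-i)))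
    found-j = outside t x good r
    j = proj₁ found-j
    open Remove t x good i j (proj₂ (proj₂ found-i)) (proj₁ (proj₂ found-j))
      (r , proj₁ (proj₂ (proj₂ found-j)) , proj₂ (nonloop≢0⇒ (f i) (proj₁ (proj₂ found-i))) , proj₂ (proj₂ (proj₂ found-j)))
    class≤ : ∀ r′ → classWeight f r′ y ≤ t
    class≤ r′ = ℕₚ.≤-trans (class-y r′) (ℕₚ.≤-pred (ℕₚ.≤∧≢⇒< (le r′) (λ e → none (r′ , e))))

module _ {n s} (M : Matroid n) (f : Labelling n s) (labels : Labels M f) where

  good⇒latticePoint : ∀ t x → Good f t x → LatticePoint (dilate t (polytope M)) (Vec.map pos x)
  good⇒latticePoint t x good = go t (decompose f t x good)
    where
    point≡ : ∀ i → fromℤ (lookup (Vec.map pos x) i) ≡ fromℕ (lookup x i)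
    point≡ i = cong fromℤ (Vecₚ.lookup-map i pos x)
    go : ∀ t → Decomposition f t (lookup x) → LatticePoint (dilate t (polytope M)) (Vec.map pos x)
    -- The dilate by zero is the origin, but it has to be exhibited as zero times a point of the
    -- polytope; any basis provides one.
    go zero (_ , _ , x≡0) = indicator B , basis⇒polytope M (proj₂ (nonempty M)) , λ i → trans (point≡ i)
        (trans (cong fromℕ (x≡0 i)) (sym (ℚₚ.*-zeroˡ (indicator B i))))
      where
      B = proj₁ (nonempty M)
    go (suc t) (p , p-sep , x≡) = (λ i → sum (λ a → r *ℚ v a i)) ,
        (suc t , v , (λ _ → r) , vertices , (λ _ → ℚₚ.<⇒≤ (0<recip t)) , sum-w , λ _ → refl) , λ i →
      trans (point≡ i) (trans (trans (cong fromℕ (x≡ i)) (fromℕ-sum (λ a → unit (proj₁ (p a)) i + unit (proj₂ (p a)) i)))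
        (trans (sumℚ-cong (λ a → trans (sym (indicator-pair (separated-≢ {f = f} (p-sep a)) i)) (rescale (v a i))))
          (sym (sumℚ-* (fromℕ (suc t)) (λ a → r *ℚ v a i)))))
      where
      r = recip t
      v : Fin (suc t) → Point n
      v a = indicator (⁅ proj₁ (p a) ⁆ ∪ ⁅ proj₂ (p a) ⁆)
      vertices : ∀ a → Vertex M (v a)
      vertices a = _ , from (labels _) (_ , _ , p-sep a , refl) , λ _ → refl
      rescale : ∀ x → x ≡ fromℕ (suc t) *ℚ (r *ℚ x)
      rescale x = sym (trans (sym (ℚₚ.*-assoc (fromℕ (suc t)) r x))
          (trans (cong (_*ℚ x) (recip-inverse t)) (ℚₚ.*-identityˡ x)))
      sum-const : ∀ k → sum {k} (λ _ → r) ≡ fromℕ k *ℚ r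
      sum-const zero    = sym (ℚₚ.*-zeroˡ r)
      sum-const (suc k) = trans (cong₂ _+ℚ_ (sym (ℚₚ.*-identityˡ r)) (sum-const k))
        (trans (sym (ℚₚ.*-distribʳ-+ r 1ℚ (fromℕ k))) (cong (_*ℚ r) (sym (fromℕ-+ 1 k))))
      sum-w : sum {suc t} (λ _ → r) ≡ 1ℚ
      sum-w = trans (sum-const (suc t)) (recip-inverse t)

  card-latticePoints : ∀ t {N} → HasCardinality (Good f t) N → HasCardinality (LatticePoint (dilate t (polytope M))) N
  card-latticePoints t = card-map (Vec.map pos) injective λ z → mk⇔ (latticePoint⇒good M f labels t z)
    (λ (x , good , z≡) → subst (LatticePoint (dilate t (polytope M))) (sym z≡) (good⇒latticePoint t x good))
    where
    injective : ∀ {n} {x y : Vec ℕ n} → Vec.map pos x ≡ Vec.map pos y → x ≡ y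
    injective {x = []}    {[]}    e = refl
    injective {x = k ∷ x} {l ∷ y} e = cong₂ Vec._∷_ (ℤₚ.+-injective (cong Vec.head e)) (injective (cong Vec.tail e))

  isEhrhart : ∀ m → nonloops f ≡ 2 + m → (∀ r → size f r < nonloops f) → IsEhrhartPolynomial (polytope M) (ehr m (size f))
  isEhrhart m N≡ size< t = let N , card , count = card-Good f size< t in
    N , card-latticePoints t card
      , eval-ehr m (size f) N t (subst (λ K → N + sumℕ (λ r → φ K (size f r) t) ≡ h K (t + t)) N≡ count)

ehrhart-unique : ∀ {n} {P : Pred (Point n) 0ℓ} p q → IsEhrhartPolynomial P p → IsEhrhartPolynomial P q → ∀ j → coeff p j
    ≡ coeff q j
ehrhart-unique p q p-ehr q-ehr = eval-determines-coeff p q λ t →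
  let M , cardM , p≡M = p-ehr t
      N , cardN , q≡N = q-ehr t
  in trans p≡M (trans (cong fromℕ (card-unique cardM cardN)) (sym q≡N))

isEhrhart₂ : ∀ {n} (M : Matroid n) (f : Labelling n 2) → Labels M f → ∀ {x y} → size f zero ≡ suc x → size f 1F ≡
    suc y →
             IsEhrhartPolynomial (polytope M) (rising² x y)
isEhrhart₂ M f labels {x} {y} ex ey t = _ , card-latticePoints M f labels t (card-Good₂ f t)
  , trans (eval-rising² x y t) (cong₂ (λ k l → fromℕ (h k t * h l t)) (sym ex) (sym ey))

-- Parallel classes of a matroid of rank 2

Subset-≗ : ∀ {n} {A B : Subset n} → (∀ i → lookup A i ≡ lookup B i) → A ≡ B
Subset-≗ {A = A} {B} e = trans (sym (Vecₚ.tabulate∘lookup A)) (trans (Vecₚ.tabulate-cong e) (Vecₚ.tabulate∘lookup B))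

∣∣≡0⇒⊥ : ∀ {n} (B : Subset n) → ∣ B ∣ ≡ 0 → B ≡ Subset.⊥
∣∣≡0⇒⊥ []          _ = refl
∣∣≡0⇒⊥ (false ∷ B) e = cong (false Vec.∷_) (∣∣≡0⇒⊥ B e)

∣∣≡1⇒singleton : ∀ {n} (B : Subset n) → ∣ B ∣ ≡ 1 → ∃ λ i → B ≡ ⁅ i ⁆
∣∣≡1⇒singleton (true ∷ B)  e = zero , cong (true Vec.∷_) (∣∣≡0⇒⊥ B (ℕₚ.suc-injective e))
∣∣≡1⇒singleton (false ∷ B) e = let i , B≡ = ∣∣≡1⇒singleton B e in suc i , cong (false Vec.∷_) B≡

∣∣≡2⇒pair : ∀ {n} (B : Subset n) → ∣ B ∣ ≡ 2 → ∃₂ λ i j → i ≢ j × B ≡ ⁅ i ⁆ ∪ ⁅ j ⁆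
∣∣≡2⇒pair (true ∷ B)  e = let j , B≡ = ∣∣≡1⇒singleton B (ℕₚ.suc-injective e) in
  zero , suc j , (λ ()) , cong (true Vec.∷_) (trans B≡ (sym (Subsetₚ.∪-identityˡ ⁅ j ⁆)))
∣∣≡2⇒pair (false ∷ B) e = let i , j , i≢j , B≡ = ∣∣≡2⇒pair B e in
  suc i , suc j , i≢j ∘ Finₚ.suc-injective , cong (false Vec.∷_) B≡

∣pair∣≡2 : ∀ {n} {i j : Fin n} → i ≢ j → ∣ ⁅ i ⁆ ∪ ⁅ j ⁆ ∣ ≡ 2
∣pair∣≡2 {i = zero}  {zero}  i≢j = contradiction refl i≢j
∣pair∣≡2 {i = zero}  {suc j} i≢j = cong suc (trans (cong ∣_∣ (Subsetₚ.∪-identityˡ ⁅ j ⁆)) (Subsetₚ.∣⁅x⁆∣≡1 j))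
∣pair∣≡2 {i = suc i} {zero}  i≢j = cong suc (trans (cong ∣_∣ (Subsetₚ.∪-identityʳ ⁅ i ⁆)) (Subsetₚ.∣⁅x⁆∣≡1 i))
∣pair∣≡2 {i = suc i} {suc j} i≢j = ∣pair∣≡2 (i≢j ∘ cong suc)

∈-pair⁻ : ∀ {n} {i j k : Fin n} → k Subset.∈ ⁅ i ⁆ ∪ ⁅ j ⁆ → k ≡ i ⊎ k ≡ j
∈-pair⁻ {i = i} {j} k∈ with Subsetₚ.x∈p∪q⁻ ⁅ i ⁆ ⁅ j ⁆ k∈
... | inj₁ k∈i = inj₁ (Subsetₚ.x∈⁅y⁆⇒x≡y i k∈i)
... | inj₂ k∈j = inj₂ (Subsetₚ.x∈⁅y⁆⇒x≡y j k∈j)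

∈-pairˡ : ∀ {n} (i j : Fin n) → i Subset.∈ ⁅ i ⁆ ∪ ⁅ j ⁆
∈-pairˡ i j = Subsetₚ.x∈p∪q⁺ (inj₁ (Subsetₚ.x∈⁅x⁆ i))

∈-pairʳ : ∀ {n} (i j : Fin n) → j Subset.∈ ⁅ i ⁆ ∪ ⁅ j ⁆
∈-pairʳ i j = Subsetₚ.x∈p∪q⁺ (inj₂ (Subsetₚ.x∈⁅x⁆ j))

singleton-minus : ∀ {n} (i : Fin n) → ⁅ i ⁆ Subset.- i ≡ Subset.⊥
singleton-minus zero    = cong (false Vec.∷_) (Subsetₚ.p─⊥≡p _)
singleton-minus (suc i) = cong (false Vec.∷_) (singleton-minus i)

pair-minus : ∀ {n} {i j : Fin n} → i ≢ j → (⁅ i ⁆ ∪ ⁅ j ⁆) Subset.- j ≡ ⁅ i ⁆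
pair-minus {i = zero}  {zero}  i≢j = contradiction refl i≢j
pair-minus {i = zero}  {suc j} i≢j = cong (true Vec.∷_)
    (trans (cong (Subset._- j) (Subsetₚ.∪-identityˡ ⁅ j ⁆)) (singleton-minus j))
pair-minus {i = suc i} {zero}  i≢j = cong (false Vec.∷_) (trans (Subsetₚ.p─⊥≡p _) (Subsetₚ.∪-identityʳ ⁅ i ⁆))
pair-minus {i = suc i} {suc j} i≢j = cong (false Vec.∷_) (pair-minus (i≢j ∘ cong suc))

Onto : ∀ {n s} → Labelling n s → Set
Onto f = ∀ r → ∃ λ i → f i ≡ just r

-- The quotient by a partial equivalence relation; elements unrelated to everything receive
-- `nothing`.
record ClassLabelling {n} (R : Fin n → Fin n → Set) : Set where
  field
    {classes}  : ℕ
    label      : Labelling n classes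
    surjective : Onto label
    sound      : ∀ {i j r} → label i ≡ just r → label j ≡ just r → R i j
    complete   : ∀ {i j} → R i j → ∃ λ r → label i ≡ just r × label j ≡ just r

-- The new element `zero` joins an old class, lies outside the domain of `R`, or founds a class. In
-- the first case it copies the label of a related `j`, which has one because symmetry and
-- transitivity make `j` related to itself.
classLabelling : ∀ {n} (R : Fin n → Fin n → Set) → (∀ i j → Dec (R i j)) → (∀ {i j} → R i j → R j i) →
                 (∀ {i j k} → R i j → R j k → R i k) → ClassLabelling R
classLabelling {zero}  R R? symR transR = record
    { classes = 0 ; label = λ () ; surjective = λ () ; sound = λ { {()} } ; complete = λ { {()} } }
classLabelling {suc n} R R? symR transR with classLabelling (λ i j → R (suc i) (suc j)) (λ i j → R? (suc i) (suc j)) symR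
    transR
... | record { classes = s ; label = f′ ; surjective = surj′ ; sound = sound′ ; complete = complete′ }
  with Finₚ.any? (λ j → R? zero (suc j)) | R? zero zero
... | yes (j , R0j) | _ = record
  { label = f ; surjective = λ r → let i , e = surj′ r in suc i , e
  ; sound = λ {i} {k} → sound i k ; complete = λ {i} {k} → complete i k }
  where
  jj = complete′ (transR (symR R0j) R0j)
  r₀ = proj₁ jj
  fj : f′ j ≡ just r₀
  fj = proj₁ (proj₂ jj)
  f : Labelling (suc n) s
  f zero    = just r₀
  f (suc i) = f′ i
  sound : ∀ i k {r} → f i ≡ just r → f k ≡ just r → R i k
  sound zero    zero    _    _  = transR R0j (symR R0j)
  sound zero    (suc k) refl fk = transR R0j (sound′ fj fk)
  sound (suc i) zero    fi refl = transR (sound′ fi fj) (symR R0j)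
  sound (suc i) (suc k) fi   fk = sound′ fi fk
  via-j : ∀ k → R zero (suc k) → f′ k ≡ just r₀
  via-j k R0k = let r , fj′ , fk = complete′ (transR (symR R0j) R0k) in
    trans fk (cong just (Maybeₚ.just-injective (trans (sym fj′) fj)))
  complete : ∀ i k → R i k → ∃ λ r → f i ≡ just r × f k ≡ just r
  complete zero    zero    _   = r₀ , refl , refl
  complete zero    (suc k) Rik = r₀ , refl , via-j k Rik
  complete (suc i) zero    Rik = r₀ , via-j i (symR Rik) , refl
  complete (suc i) (suc k) Rik = complete′ Rik
... | no none | no ¬R00 = record
  { label = f ; surjective = λ r → let i , e = surj′ r in suc i , e
  ; sound = λ {i} {k} → sound i k ; complete = λ {i} {k} → complete i k }
  where
  f : Labelling (suc n) s
  f zero    = nothing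
  f (suc i) = f′ i
  sound : ∀ i k {r} → f i ≡ just r → f k ≡ just r → R i k
  sound zero    _       () _
  sound (suc i) zero    _  ()
  sound (suc i) (suc k) fi fk = sound′ fi fk
  complete : ∀ i k → R i k → ∃ λ r → f i ≡ just r × f k ≡ just r
  complete zero    zero    Rik = contradiction Rik ¬R00
  complete zero    (suc k) Rik = contradiction (k , Rik) none
  complete (suc i) zero    Rik = contradiction (i , symR Rik) none
  complete (suc i) (suc k) Rik = complete′ Rik
... | no none | yes R00 = record
    { label = f ; surjective = surj ; sound = λ {i} {k} → sound i k ; complete = λ {i} {k} → complete i k }
  where
  f : Labelling (suc n) (suc s)
  f zero    = just zero
  f (suc i) = Maybe.map suc (f′ i)
  lift : ∀ {i r} → f′ i ≡ just r → f (suc i) ≡ just (suc r)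
  lift e = cong (Maybe.map suc) e
  unlift : ∀ l {r : Fin s} → Maybe.map suc l ≡ just (suc r) → l ≡ just r
  unlift (just _) refl = refl
  not-zero : ∀ (l : Maybe (Fin s)) → Maybe.map suc l ≢ just zero
  not-zero nothing  ()
  not-zero (just _) ()
  surj : ∀ r → ∃ λ i → f i ≡ just r
  surj zero    = zero , refl
  surj (suc r) = let i , e = surj′ r in suc i , lift e
  sound : ∀ i k {r} → f i ≡ just r → f k ≡ just r → R i k
  sound zero    zero    _    _    = R00
  sound zero    (suc k) refl fk   = contradiction fk (not-zero (f′ k))
  sound (suc i) zero    fi   refl = contradiction fi (not-zero (f′ i))
  sound (suc i) (suc k) {zero}  fi _  = contradiction fi (not-zero (f′ i))
  sound (suc i) (suc k) {suc r} fi fk = sound′ (unlift (f′ i) fi) (unlift (f′ k) fk)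
  complete : ∀ i k → R i k → ∃ λ r → f i ≡ just r × f k ≡ just r
  complete zero    zero    Rik = zero , refl , refl
  complete zero    (suc k) Rik = contradiction (k , Rik) none
  complete (suc i) zero    Rik = contradiction (i , symR Rik) none
  complete (suc i) (suc k) Rik = let r , fi , fk = complete′ Rik in suc r , lift fi , lift fk

module RankTwo {n} (M : Matroid n) (rk : HasRank M 2) where

  Joined : Fin n → Fin n → Set
  Joined i j = IsBasis M (⁅ i ⁆ ∪ ⁅ j ⁆)

  joined? : ∀ i j → Dec (Joined i j)
  joined? i j = isBasis? M (⁅ i ⁆ ∪ ⁅ j ⁆)

  joined-sym : ∀ {i j} → Joined i j → Joined j i
  joined-sym {i} {j} = subst (IsBasis M) (Subsetₚ.∪-comm ⁅ i ⁆ ⁅ j ⁆)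

  joined-≢ : ∀ {i j} → Joined i j → i ≢ j
  joined-≢ {i} J refl = contradiction (trans (sym (rk J)) (trans (cong ∣_∣ (Subsetₚ.∪-idem ⁅ i ⁆)) (Subsetₚ.∣⁅x⁆∣≡1 i)))
      λ ()

  -- A partial equivalence, reflexive exactly on the nonloops: a nonloop lies in some basis, while
  -- `Joined i i` fails because a singleton has the wrong size.
  Parallel : Fin n → Fin n → Set
  Parallel i j = ∃ (Joined i) × ∃ (Joined j) × ¬ Joined i j

  parallel? : ∀ i j → Dec (Parallel i j)
  parallel? i j = Finₚ.any? (joined? i) ×-dec Finₚ.any? (joined? j) ×-dec ¬? (joined? i j)

  parallel-sym : ∀ {i j} → Parallel i j → Parallel j i
  parallel-sym (pi , pj , ¬J) = pj , pi , ¬J ∘ joined-sym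

  -- Suppose `{i, k}` is a basis and extend `j` to a basis `{j, l}`. Exchanging `l` against `{i, k}`
  -- makes `{j, i}` or `{j, k}` a basis, and if `l` already is `i` or `k` the same holds at once;
  -- both contradict parallelism.
  parallel-trans : ∀ {i j k} → Parallel i j → Parallel j k → Parallel i k
  parallel-trans {i} {j} {k} (pi , (l , Jjl) , ¬Jij) (_ , pk , ¬Jjk) = pi , pk , impossible
    where
    impossible : ¬ Joined i k
    impossible Jik with l Subsetₚ.∈? (⁅ i ⁆ ∪ ⁅ k ⁆)
    ... | yes l∈ = [ (λ { refl → ¬Jij (joined-sym Jjl) }) , (λ { refl → ¬Jjk Jjl }) ]′ (∈-pair⁻ {i = i} {k} l∈)
    ... | no l∉  = let y , y∈ , y∉ , new = exchange M Jjl Jik (∈-pairʳ j l) l∉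
                       Jjy = subst (λ B → IsBasis M (B ∪ ⁅ y ⁆)) (pair-minus (joined-≢ Jjl)) new
                   in [ (λ y≡i → ¬Jij (joined-sym {j} {i} (subst (Joined j) y≡i Jjy)))
                      , (λ y≡k → ¬Jjk (subst (Joined j) y≡k Jjy)) ]′ (∈-pair⁻ {i = i} {k} y∈)

  open ClassLabelling (classLabelling Parallel parallel? parallel-sym parallel-trans) public

  nonloop-label : ∀ {i j} → Joined i j → ∃ λ r → label i ≡ just r
  nonloop-label {i} {j} J = let r , e , _ = complete ((j , J) , (j , J) , λ Jii → joined-≢ Jii refl) in r , e

  labels : Labels M label
  labels B = mk⇔ forward backward
    where
    forward : IsBasis M B → ∃₂ λ i j → Separated label i j × B ≡ ⁅ i ⁆ ∪ ⁅ j ⁆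
    forward b = let i , j , _ , B≡ = ∣∣≡2⇒pair B (rk b)
                    J = subst (IsBasis M) B≡ b
                    r , fi = nonloop-label J
                    q , fj = nonloop-label (joined-sym J)
                in i , j , (r , q , fi , fj , λ r≡q → proj₂ (proj₂ (sound fi (trans fj (cong just (sym r≡q))))) J) , B≡
    backward : (∃₂ λ i j → Separated label i j × B ≡ ⁅ i ⁆ ∪ ⁅ j ⁆) → IsBasis M B
    backward (i , j , (r , q , fi , fj , r≢q) , refl) with joined? i j
    ... | yes J = J
    ... | no ¬J = let p , fi′ , fj′ = complete {i} {j} (proj₁ (sound fi fi) , proj₁ (sound fj fj) , ¬J) in
      contradiction (Maybeₚ.just-injective (trans (sym fi) (trans fi′ (trans (sym fj′) fj)))) r≢q

  size-positive : ∀ r → 0 < size label r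
  size-positive r = let i , fi = surjective r in
    ℕₚ.≤-trans (ℕₚ.≤-reflexive (sym (trans (cong (_⟦ r ⟧) fi) (⟦⟧-same r)))) (entry≤sum (λ i → label i ⟦ r ⟧) i)

sumℕ-1 : ∀ n → sumℕ {n} (λ _ → 1) ≡ n
sumℕ-1 zero    = refl
sumℕ-1 (suc n) = cong suc (sumℕ-1 n)

labelU : ∀ n → Labelling n n
labelU n = just

labelsU : ∀ {n} (2≤n : 2 ≤ n) → Labels (uniform 2≤n) (labelU n)
labelsU 2≤n B = mk⇔
  (λ b → let i , j , i≢j , B≡ = ∣∣≡2⇒pair B b in i , j , (i , j , refl , refl , i≢j) , B≡)
  (λ { (i , j , sep , refl) → ∣pair∣≡2 (separated-≢ {f = labelU _} sep) })

size-labelU : ∀ {n} r → size (labelU n) r ≡ 1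
size-labelU {n} r = trans (sumℕ-cong entry) (sumℕ-unit (λ _ → 1) r)
  where
  entry : ∀ i → just i ⟦ r ⟧ ≡ 1 * unit r i
  entry i with i Fin.≟ r | r Fin.≟ i
  ... | yes _   | yes _   = refl
  ... | yes i≡r | no r≢i  = contradiction (sym i≡r) r≢i
  ... | no i≢r  | yes r≡i = contradiction (sym r≡i) i≢r
  ... | no _    | no _    = refl

labelT : ∀ m → Labelling (2 + m) 3
labelT m zero          = just zero
labelT m 1F = just 1F
labelT m (suc (suc _)) = just 2F

labelsT : ∀ {m} (2≤n : 2 ≤ 2 + m) → Labels (minimal₂ 2≤n) (labelT m)
labelsT {m} 2≤n B = mk⇔ forward backward
  where
  Target = ∃₂ λ i j → Separated (labelT m) i j × B ≡ ⁅ i ⁆ ∪ ⁅ j ⁆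
  forward : MinimalBasis B → Target
  forward (inj₁ (zero , 1F , _ , _ , B≡)) = zero , 1F , (zero , 1F , refl , refl , λ ()) , B≡
  forward (inj₂ (zero , suc (suc k) , _ , _ , B≡)) = zero , suc (suc k) , (zero , suc 1F , refl , refl , λ ()) , B≡
  forward (inj₂ (1F , suc (suc k) , _ , _ , B≡)) = 1F , suc (suc k) ,
      (1F , suc 1F , refl , refl , λ ()) , B≡
  forward (inj₂ (_ , 1F , _ , s≤s () , _))
  forward (inj₂ (suc (suc _) , _ , s≤s (s≤s ()) , _ , _))
  2≤ : ∀ (k : Fin m) → 2 ≤ Fin.toℕ (Fin.suc (Fin.suc k))
  2≤ k = s≤s (s≤s z≤n)
  backward : Target → MinimalBasis B
  backward (zero , zero , (_ , _ , refl , refl , ne) , _) = contradiction refl ne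
  backward (zero , 1F , _ , B≡) = inj₁ (zero , 1F , refl , refl , B≡)
  backward (zero , suc (suc k) , _ , B≡) = inj₂ (zero , suc (suc k) , s≤s z≤n , 2≤ k , B≡)
  backward (1F , zero , _ , B≡) = inj₁
      (zero , 1F , refl , refl , trans B≡ (Subsetₚ.∪-comm ⁅ 1F ⁆ ⁅ zero ⁆))
  backward (1F , 1F , (_ , _ , refl , refl , ne) , _) = contradiction refl ne
  backward (1F , suc (suc k) , _ , B≡) = inj₂ (1F , suc (suc k) , s≤s (s≤s z≤n) , 2≤ k , B≡)
  backward (suc (suc k) , zero , _ , B≡) = inj₂
      (zero , suc (suc k) , s≤s z≤n , 2≤ k , trans B≡ (Subsetₚ.∪-comm ⁅ suc (suc k) ⁆ ⁅ zero ⁆))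
  backward (suc (suc k) , 1F , _ , B≡) = inj₂
      (1F , suc (suc k) , s≤s (s≤s z≤n) , 2≤ k , trans B≡ (Subsetₚ.∪-comm ⁅ suc (suc k) ⁆ ⁅ 1F ⁆))
  backward (suc (suc k) , suc (suc l) , (_ , _ , refl , refl , ne) , _) = contradiction refl ne

size-labelT : ∀ m r → size (labelT m) r ≡ sizesT m r
size-labelT m zero             = cong suc (sumℕ-0 m)
size-labelT m 1F = cong suc (sumℕ-0 m)
size-labelT m 2F = sumℕ-1 m

-- Direct sums and isomorphisms

restrict : ∀ {k n} → (Fin k → Fin n) → Subset n → Subset k
restrict e B = Vec.tabulate (λ a → lookup B (e a))

restrict-∪ : ∀ {k n} (e : Fin k → Fin n) A B → restrict e (A ∪ B) ≡ restrict e A ∪ restrict e B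
restrict-∪ e A B = Subset-≗ λ a → trans (Vecₚ.lookup∘tabulate _ a) (trans (Vecₚ.lookup-zipWith Bool._∨_ (e a) A B)
  (sym (trans (Vecₚ.lookup-zipWith Bool._∨_ a (restrict e A) (restrict e B))
    (cong₂ Bool._∨_ (Vecₚ.lookup∘tabulate (lookup A ∘ e) a) (Vecₚ.lookup∘tabulate (lookup B ∘ e) a)))))

restrict-singleton : ∀ {k n} (e : Fin k → Fin n) → (∀ {a b} → e a ≡ e b → a ≡ b) → ∀ a → restrict e ⁅ e a ⁆ ≡ ⁅ a ⁆
restrict-singleton e inj a = Subset-≗ λ b → trans (Vecₚ.lookup∘tabulate _ b)
    (trans (lookup-⁅⁆ (e a) (e b)) (trans (same b) (sym (lookup-⁅⁆ a b))))
  where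
  same : ∀ b → does (e a Fin.≟ e b) ≡ does (a Fin.≟ b)
  same b with e a Fin.≟ e b | a Fin.≟ b
  ... | yes _ | yes _    = refl
  ... | yes p | no a≢b   = contradiction (inj p) a≢b
  ... | no p  | yes refl = contradiction refl p
  ... | no _  | no _     = refl

restrict-missed : ∀ {k n} (e : Fin k → Fin n) i → (∀ a → e a ≢ i) → restrict e ⁅ i ⁆ ≡ Subset.⊥
restrict-missed e i miss = Subset-≗ λ b → trans (Vecₚ.lookup∘tabulate _ b)
  (trans (lookup-⁅⁆ i (e b)) (trans (differ b) (sym (Vecₚ.lookup-replicate b false))))
  where
  differ : ∀ b → does (i Fin.≟ e b) ≡ false
  differ b with i Fin.≟ e b
  ... | yes i≡ = contradiction (sym i≡) (miss b)
  ... | no _   = refl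

restrict-pair : ∀ {k n} (e : Fin k → Fin n) → (∀ {a b} → e a ≡ e b → a ≡ b) → ∀ a b → restrict e (⁅ e a ⁆ ∪ ⁅ e b ⁆) ≡ ⁅
    a ⁆ ∪ ⁅ b ⁆
restrict-pair e inj a b = trans (restrict-∪ e ⁅ e a ⁆ ⁅ e b ⁆)
    (cong₂ _∪_ (restrict-singleton e inj a) (restrict-singleton e inj b))

restrict-≗ : ∀ {k n} (e : Fin k → Fin n) A B → restrict e A ≡ restrict e B → ∀ a → lookup A (e a) ≡ lookup B (e a)
restrict-≗ e A B eq a = trans (sym (Vecₚ.lookup∘tabulate (lookup A ∘ e) a))
    (trans (cong (λ C → lookup C a) eq) (Vecₚ.lookup∘tabulate (lookup B ∘ e) a))

record Enumeration {n} (mask : Fin n → Bool) : Set where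
  field
    {count}   : ℕ
    element   : Fin count → Fin n
    injective : ∀ {a b} → element a ≡ element b → a ≡ b
    hits      : ∀ a → mask (element a) ≡ true
    covers    : ∀ i → mask i ≡ true → ∃ λ a → element a ≡ i
    count≡    : count ≡ sumℕ (λ i → if mask i then 1 else 0)

enumerate : ∀ {n} (mask : Fin n → Bool) → Enumeration mask
enumerate {zero} mask = record { count = 0 ; element = λ () ; injective = λ { {()} } ; hits = λ () ; covers = λ () ;
    count≡ = refl }
enumerate {suc n} mask = go (mask zero) refl
  where
  open Enumeration (enumerate (mask ∘ suc))
  go : ∀ b → mask zero ≡ b → Enumeration mask
  go true m0 = record
    { element = element′ ; injective = λ {a} {b} → injective′ a b ; hits = λ { zero → m0 ; (suc a) → hits a }
    ; covers = λ { zero _ → zero , refl ; (suc i) m → let a , e = covers i m in suc a , cong suc e }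
    ; count≡ = trans (cong suc count≡)
        (cong (λ b → (if b then 1 else 0) + sumℕ (λ i → if mask (suc i) then 1 else 0)) (sym m0)) }
    where
    element′ : Fin (suc count) → Fin (suc n)
    element′ zero    = zero
    element′ (suc a) = suc (element a)
    injective′ : ∀ a b → element′ a ≡ element′ b → a ≡ b
    injective′ zero    zero    _ = refl
    injective′ (suc a) (suc b) e = cong suc (injective (Finₚ.suc-injective e))
  go false m0 = record
    { element = suc ∘ element ; injective = injective ∘ Finₚ.suc-injective ; hits = hits
    ; covers = λ { zero m → contradiction (trans (sym m0) m) λ () ; (suc i) m → let a , e = covers i m in a , cong suc e }
    ; count≡ = trans count≡ (cong (λ b → (if b then 1 else 0) + sumℕ (λ i → if mask (suc i) then 1 else 0)) (sym m0)) }

-- The permutation points against `e` because `image` reads a subset through the inverse map: in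
-- this orientation `image` is `restrict e` by definition.
bijection⇒permutation : ∀ {k n} (e : Fin k → Fin n) → (∀ {a b} → e a ≡ e b → a ≡ b) → (∀ i → ∃ λ a → e a ≡ i) →
    Permutation.Permutation n k
bijection⇒permutation e inj surj = Permutation.permutation (proj₁ ∘ surj) e (λ a → inj (proj₂ (surj (e a))))
    (λ i → proj₂ (surj i))

take-tabulate : ∀ k {l} (g : Fin (k + l) → Bool) → Vec.take k (Vec.tabulate g) ≡ Vec.tabulate (λ a → g (a Fin.↑ˡ l))
take-tabulate zero    g = refl
take-tabulate (suc k) g = cong (g zero Vec.∷_) (take-tabulate k (g ∘ suc))

drop-tabulate : ∀ k {l} (g : Fin (k + l) → Bool) → Vec.drop k (Vec.tabulate g) ≡ Vec.tabulate (λ b → g (k Fin.↑ʳ b))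
drop-tabulate zero    g = refl
drop-tabulate (suc k) g = drop-tabulate k (g ∘ suc)

-- Lists the elements selected by `mask` before the others, since `_⊕_` takes its summands as an
-- initial and a final segment of the ground set.
module Splitting {n} (mask : Fin n → Bool) where

  module E₁ = Enumeration (enumerate mask)
  module E₂ = Enumeration (enumerate (Bool.not ∘ mask))

  k l : ℕ
  k = E₁.count
  l = E₂.count

  apart : ∀ a b → E₁.element a ≢ E₂.element b
  apart a b e = contradiction (trans (sym (E₂.hits b)) (cong Bool.not (trans (cong mask (sym e)) (E₁.hits a)))) λ ()

  part : Fin k ⊎ Fin l → Fin n
  part = [ E₁.element , E₂.element ]′

  part-injective : ∀ x y → part x ≡ part y → x ≡ y
  part-injective (inj₁ a) (inj₁ b) e = cong inj₁ (E₁.injective e)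
  part-injective (inj₁ a) (inj₂ b) e = contradiction e (apart a b)
  part-injective (inj₂ a) (inj₁ b) e = contradiction (sym e) (apart b a)
  part-injective (inj₂ a) (inj₂ b) e = cong inj₂ (E₂.injective e)

  part-surjective : ∀ i → ∃ λ x → part x ≡ i
  part-surjective i = go (mask i) refl
    where
    go : ∀ b → mask i ≡ b → ∃ λ x → part x ≡ i
    go true  m = let a , e = E₁.covers i m in inj₁ a , e
    go false m = let a , e = E₂.covers i (cong Bool.not m) in inj₂ a , e

  π : Permutation.Permutation n (k + l)
  π = bijection⇒permutation (part ∘ Fin.splitAt k)
    (λ {a} {b} e → trans (sym (Finₚ.join-splitAt k l a))
        (trans (cong (Fin.join k l) (part-injective (Fin.splitAt k a) (Fin.splitAt k b) e)) (Finₚ.join-splitAt k l b)))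
    (λ i → let x , e = part-surjective i in Fin.join k l x , trans (cong part (Finₚ.splitAt-join k l x)) e)

  k+l≡n : k + l ≡ n
  k+l≡n = sym (Permutation.↔⇒≡ π)

  restrict-jointly-injective : ∀ {A B} → restrict E₁.element A ≡ restrict E₁.element B → restrict E₂.element A ≡ restrict
      E₂.element B → A ≡ B
  restrict-jointly-injective {A} {B} e₁ e₂ = Subset-≗ λ i → let x , e = part-surjective i
    in subst (λ i → lookup A i ≡ lookup B i) e (go x)
    where
    go : ∀ x → lookup A (part x) ≡ lookup B (part x)
    go (inj₁ a) = restrict-≗ E₁.element A B e₁ a
    go (inj₂ b) = restrict-≗ E₂.element A B e₂ b

  splitting-≅ : (M : Matroid n) (M₁ : Matroid k) (M₂ : Matroid l) →
    (∀ B → IsBasis M B ⇔ (IsBasis M₁ (restrict E₁.element B) × IsBasis M₂ (restrict E₂.element B))) → M ≅ M₁ ⊕ M₂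
  splitting-≅ M M₁ M₂ char = π , λ B → mk⇔
    (λ b → let b₁ , b₂ = to (char B) b in subst (IsBasis M₁) (sym (left B)) b₁ , subst (IsBasis M₂) (sym (right B)) b₂)
    (λ (b₁ , b₂) → from (char B) (subst (IsBasis M₁) (left B) b₁ , subst (IsBasis M₂) (right B) b₂))
    where
    left : ∀ B → Vec.take k (image π B) ≡ restrict E₁.element B
    left B = trans (take-tabulate k _) (Vecₚ.tabulate-cong (λ a → cong (lookup B ∘ part) (Finₚ.splitAt-↑ˡ k a l)))
    right : ∀ B → Vec.drop k (image π B) ≡ restrict E₂.element B
    right B = trans (drop-tabulate k _) (Vecₚ.tabulate-cong (λ b → cong (lookup B ∘ part) (Finₚ.splitAt-↑ʳ k l b)))

-- Consequences of connectedness

separated? : ∀ {n s} (f : Labelling n s) i j → Dec (Separated f i j)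
separated? f i j = Finₚ.any? λ r → Finₚ.any? λ q →
  Maybeₚ.≡-dec Fin._≟_ (f i) (just r) ×-dec Maybeₚ.≡-dec Fin._≟_ (f j) (just q) ×-dec ¬? (r Fin.≟ q)

separated-sym : ∀ {n s} {f : Labelling n s} {i j} → Separated f i j → Separated f j i
separated-sym (r , q , fi , fj , r≢q) = q , r , fj , fi , r≢q ∘ sym

-- Supplies the summand that is left when loops are split off. For the exchange, let `i` be the
-- element that is kept: the two elements of the other basis have different labels, so at least one
-- of them is separated from `i`.
labelMatroid : ∀ {n s} (f : Labelling n s) → ∃₂ (Separated f) → Matroid n
labelMatroid {n} f (i₀ , j₀ , sep₀) = record
  { IsBasis  = Pairs
  ; isBasis? = λ B → Finₚ.any? λ i → Finₚ.any? λ j → separated? f i j ×-dec Vecₚ.≡-dec Bool._≟_ B (⁅ i ⁆ ∪ ⁅ j ⁆)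
  ; nonempty = _ , i₀ , j₀ , sep₀ , refl
  ; exchange = λ { (i , j , sep , refl) basisB x∈A x∉B → [ (λ { refl → swapped i j sep basisB x∉B }) ,
      (λ { refl → replace i j sep basisB x∉B }) ]′ (∈-pair⁻ {i = i} {j} x∈A) }
  }
  where
  Pairs : Subset n → Set
  Pairs B = ∃₂ λ i j → Separated f i j × B ≡ ⁅ i ⁆ ∪ ⁅ j ⁆
  Result : Subset n → Subset n → Fin n → Set
  Result A B x = ∃ λ y → y Subset.∈ B × y Subset.∉ A × Pairs ((A Subset.- x) ∪ ⁅ y ⁆)
  finish : ∀ i j → Separated f i j → ∀ {B y} → y Subset.∈ B → j Subset.∉ B → Separated f i y → Result (⁅ i ⁆ ∪ ⁅ j ⁆) B j
  finish i j sep {B} {y} y∈B j∉B sep′ = y , y∈B , y∉A , i , y , sep′ , cong (_∪ ⁅ y ⁆)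
      (pair-minus (separated-≢ {f = f} sep))
    where
    y∉A : y Subset.∉ ⁅ i ⁆ ∪ ⁅ j ⁆
    y∉A y∈ = [ (λ y≡i → separated-≢ {f = f} sep′ (sym y≡i)) , (λ y≡j → j∉B (subst (Subset._∈ B) y≡j y∈B)) ]′
        (∈-pair⁻ {i = i} {j} y∈)
  replace : ∀ i j → Separated f i j → ∀ {B} → Pairs B → j Subset.∉ B → Result (⁅ i ⁆ ∪ ⁅ j ⁆) B j
  replace i j sep@(r , _ , fi , _ , _) (p , q , (a , b , fp , fq , a≢b) , refl) j∉B with r Fin.≟ a
  ... | no r≢a   = finish i j sep (∈-pairˡ p q) j∉B (r , a , fi , fp , r≢a)
  ... | yes refl = finish i j sep (∈-pairʳ p q) j∉B (r , b , fi , fq , a≢b)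
  swapped : ∀ i j → Separated f i j → ∀ {B} → Pairs B → i Subset.∉ B → Result (⁅ i ⁆ ∪ ⁅ j ⁆) B i
  swapped i j sep {B} basisB i∉B = subst (λ A → Result A B i) (Subsetₚ.∪-comm ⁅ j ⁆ ⁅ i ⁆)
      (replace j i (separated-sym {f = f} sep) basisB i∉B)

module _ {n s} (M : Matroid n) (f : Labelling n s) (labels : Labels M f) (connected : Connected M) where

  private
    some-pair : ∃₂ λ i j → Separated f i j
    some-pair = let i , j , sep , _ = to (labels (proj₁ (nonempty M))) (proj₂ (nonempty M)) in i , j , sep

  -- Otherwise `M` is the sum of the rank 0 matroid on its loops and its restriction to the
  -- nonloops. Both ground sets are proper: one contains the given loop, the other a basis.
  connected⇒loopless : ∀ i → f i ≢ nothing
  connected⇒loopless loop floop = connected k<n l<n M₁ M₂ (splitting-≅ M M₁ M₂ char)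
    where
    isLoop : Fin n → Bool
    isLoop i = Maybe.is-nothing (f i)
    open Splitting isLoop
    g : Labelling l s
    g = f ∘ E₂.element
    isLoop-just : ∀ {i r} → f i ≡ just r → isLoop i ≡ false
    isLoop-just e = cong Maybe.is-nothing e
    index : ∀ {i r} → f i ≡ just r → ∃ λ b → E₂.element b ≡ i
    index {i} e = E₂.covers i (cong Bool.not (isLoop-just e))
    missed : ∀ {i r} → f i ≡ just r → ∀ a → E₁.element a ≢ i
    missed e a refl = contradiction (trans (sym (E₁.hits a)) (isLoop-just e)) λ ()
    sep-index : ∀ {i j} → Separated f i j → ∃₂ λ a b → E₂.element a ≡ i × E₂.element b ≡ j × Separated g a b
    sep-index (r , q , fi , fj , r≢q) = let a , a≡ = index fi
                                            b , b≡ = index fj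
      in a , b , a≡ , b≡ , r , q , trans (cong f a≡) fi , trans (cong f b≡) fj , r≢q
    M₁ : Matroid k
    M₁ = uniform {0} z≤n
    M₂ : Matroid l
    M₂ = labelMatroid g (let a , b , _ , _ , sep = sep-index (proj₂ (proj₂ some-pair)) in a , b , sep)
    no-loops-in : ∀ {i j} → Separated f i j → restrict E₁.element (⁅ i ⁆ ∪ ⁅ j ⁆) ≡ Subset.⊥
    no-loops-in {i} {j} (r , q , fi , fj , _) = trans (restrict-∪ E₁.element ⁅ i ⁆ ⁅ j ⁆)
      (trans (cong₂ _∪_ (restrict-missed E₁.element i (missed fi)) (restrict-missed E₁.element j (missed fj)))
          (Subsetₚ.∪-idem Subset.⊥))
    char : ∀ B → IsBasis M B ⇔ (IsBasis M₁ (restrict E₁.element B) × IsBasis M₂ (restrict E₂.element B))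
    char B = mk⇔ forward backward
      where
      forward : IsBasis M B → IsBasis M₁ (restrict E₁.element B) × IsBasis M₂ (restrict E₂.element B)
      forward basis with to (labels B) basis
      ... | i , j , sep , refl with sep-index sep
      ... | a , b , refl , refl , sep′ = trans (cong ∣_∣ (no-loops-in sep)) (Subsetₚ.∣⊥∣≡0 k) , a , b , sep′ ,
          restrict-pair E₂.element E₂.injective a b
      backward : IsBasis M₁ (restrict E₁.element B) × IsBasis M₂ (restrict E₂.element B) → IsBasis M B
      backward (∣∣≡0 , a , b , sep , eq) = from (labels B) (E₂.element a , E₂.element b , sep
        , restrict-jointly-injective (trans (∣∣≡0⇒⊥ _ ∣∣≡0) (sym (no-loops-in sep)))
            (trans eq (sym (restrict-pair E₂.element E₂.injective a b))))
    0<k : 0 < k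
    0<k = ℕₚ.≤-trans (s≤s z≤n) (Finₚ.toℕ<n (proj₁ (E₁.covers loop (cong Maybe.is-nothing floop))))
    0<l : 0 < l
    0<l = ℕₚ.≤-trans (s≤s z≤n) (Finₚ.toℕ<n (proj₁ (sep-index (proj₂ (proj₂ some-pair)))))
    k<n : k < n
    k<n = subst (k <_) k+l≡n (ℕₚ.m<m+n k 0<l)
    l<n : l < n
    l<n = subst (l <_) k+l≡n (ℕₚ.m<n+m l 0<k)

-- A basis picks one element from each of the two classes, so `M` is a sum of two uniform matroids
-- of rank 1, and `Onto` makes both ground sets nonempty.
connected⇒¬2-classes : ∀ {n} (M : Matroid n) (f : Labelling n 2) → Labels M f → Onto f → ¬ Connected M
connected⇒¬2-classes {n} M f labels surj connected = connected k<n l<n M₁ M₂ (splitting-≅ M M₁ M₂ char)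
  where
  loopless = connected⇒loopless M f labels connected
  isFirst : Maybe (Fin 2) → Bool
  isFirst (just zero) = true
  isFirst _           = false
  open Splitting (isFirst ∘ f)
  hits₁ : ∀ a → f (E₁.element a) ≡ just zero
  hits₁ a = go (f (E₁.element a)) (E₁.hits a)
    where
    go : ∀ l → isFirst l ≡ true → l ≡ just zero
    go (just zero) _ = refl
  hits₂ : ∀ b → f (E₂.element b) ≡ just 1F
  hits₂ b = go (f (E₂.element b)) (loopless (E₂.element b)) (E₂.hits b)
    where
    go : ∀ l → l ≢ nothing → Bool.not (isFirst l) ≡ true → l ≡ just 1F
    go nothing           ne _ = contradiction refl ne
    go (just 1F) _ _ = refl
  index₁ : ∀ {i} → f i ≡ just zero → ∃ λ a → E₁.element a ≡ i
  index₁ {i} e = E₁.covers i (cong isFirst e)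
  index₂ : ∀ {i} → f i ≡ just 1F → ∃ λ b → E₂.element b ≡ i
  index₂ {i} e = E₂.covers i (cong (Bool.not ∘ isFirst) e)
  0<k : 0 < k
  0<k = ℕₚ.≤-trans (s≤s z≤n) (Finₚ.toℕ<n (proj₁ (index₁ (proj₂ (surj zero)))))
  0<l : 0 < l
  0<l = ℕₚ.≤-trans (s≤s z≤n) (Finₚ.toℕ<n (proj₁ (index₂ (proj₂ (surj 1F)))))
  k<n : k < n
  k<n = subst (k <_) k+l≡n (ℕₚ.m<m+n k 0<l)
  l<n : l < n
  l<n = subst (l <_) k+l≡n (ℕₚ.m<n+m l 0<k)
  M₁ : Matroid k
  M₁ = uniform {1} 0<k
  M₂ : Matroid l
  M₂ = uniform {1} 0<l
  restrict₁ : ∀ a b → restrict E₁.element (⁅ E₁.element a ⁆ ∪ ⁅ E₂.element b ⁆) ≡ ⁅ a ⁆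
  restrict₁ a b = trans (restrict-∪ E₁.element ⁅ E₁.element a ⁆ ⁅ E₂.element b ⁆)
    (trans (cong₂ _∪_ (restrict-singleton E₁.element E₁.injective a)
        (restrict-missed E₁.element (E₂.element b) (λ a → apart a b))) (Subsetₚ.∪-identityʳ ⁅ a ⁆))
  restrict₂ : ∀ a b → restrict E₂.element (⁅ E₁.element a ⁆ ∪ ⁅ E₂.element b ⁆) ≡ ⁅ b ⁆
  restrict₂ a b = trans (restrict-∪ E₂.element ⁅ E₁.element a ⁆ ⁅ E₂.element b ⁆)
    (trans (cong₂ _∪_ (restrict-missed E₂.element (E₁.element a) (λ b → apart a b ∘ sym))
        (restrict-singleton E₂.element E₂.injective b)) (Subsetₚ.∪-identityˡ ⁅ b ⁆))
  char : ∀ B → IsBasis M B ⇔ (∣ restrict E₁.element B ∣ ≡ 1 × ∣ restrict E₂.element B ∣ ≡ 1)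
  char B = mk⇔ forward backward
    where
    Target = ∣ restrict E₁.element B ∣ ≡ 1 × ∣ restrict E₂.element B ∣ ≡ 1
    ordered : ∀ {i j} → f i ≡ just zero → f j ≡ just 1F → B ≡ ⁅ i ⁆ ∪ ⁅ j ⁆ → Target
    ordered fi fj refl with index₁ fi | index₂ fj
    ... | a , refl | b , refl = trans (cong ∣_∣ (restrict₁ a b)) (Subsetₚ.∣⁅x⁆∣≡1 a) , trans (cong ∣_∣ (restrict₂ a b))
        (Subsetₚ.∣⁅x⁆∣≡1 b)
    forward : IsBasis M B → Target
    forward basis with to (labels B) basis
    ... | i , j , (zero     , zero     , fi , fj , r≢q) , B≡ = contradiction refl r≢q
    ... | i , j , (zero , 1F , fi , fj , r≢q) , B≡ = ordered fi fj B≡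
    ... | i , j , (1F , zero , fi , fj , r≢q) , B≡ = ordered fj fi (trans B≡ (Subsetₚ.∪-comm ⁅ i ⁆ ⁅ j ⁆))
    ... | i , j , (1F , 1F , fi , fj , r≢q) , B≡ = contradiction refl r≢q
    backward : Target → IsBasis M B
    backward (c₁ , c₂) = let a , e₁ = ∣∣≡1⇒singleton _ c₁
                             b , e₂ = ∣∣≡1⇒singleton _ c₂
      in from (labels B) (E₁.element a , E₂.element b , (zero , 1F , hits₁ a , hits₂ b , λ ())
           , restrict-jointly-injective (trans e₁ (sym (restrict₁ a b))) (trans e₂ (sym (restrict₂ a b))))

relabelling-≅ : ∀ {n n′ s s′} {M : Matroid n} {N : Matroid n′} {f : Labelling n s} {g : Labelling n′ s′} → Labels M f →
    Labels N g →
  (e : Fin n′ → Fin n) → (∀ {a b} → e a ≡ e b → a ≡ b) → (∀ i → ∃ λ a → e a ≡ i) →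
  (σ : Fin s′ → Fin s) → (∀ {r q} → σ r ≡ σ q → r ≡ q) → (∀ a → ∃ λ r → g a ≡ just r × f (e a) ≡ just (σ r)) → M ≅ N
relabelling-≅ {M = M} {N} {f} {g} labelsM labelsN e inj surj σ σ-inj σ-label = bijection⇒permutation e inj surj , λ B →
    mk⇔ (forward B) (backward B)
  where
  sep⁺ : ∀ {a b} → Separated f (e a) (e b) → Separated g a b
  sep⁺ {a} {b} (r , q , fa , fb , r≢q) = let r′ , ga , fa′ = σ-label a
                                             q′ , gb , fb′ = σ-label b
    in r′ , q′ , ga , gb , λ r′≡q′ →
         r≢q (Maybeₚ.just-injective (trans (sym fa) (trans fa′ (trans (cong (just ∘ σ) r′≡q′) (trans (sym fb′) fb)))))
  sep⁻ : ∀ {a b} → Separated g a b → Separated f (e a) (e b)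
  sep⁻ {a} {b} (r , q , ga , gb , r≢q) = let r′ , ga′ , fa = σ-label a
                                             q′ , gb′ , fb = σ-label b
    in σ r′ , σ q′ , fa , fb , λ σr≡σq →
         r≢q (Maybeₚ.just-injective (trans (sym ga) (trans ga′ (trans (cong just (σ-inj σr≡σq)) (trans (sym gb′) gb)))))
  forward : ∀ B → IsBasis M B → IsBasis N (restrict e B)
  forward B basis with to (labelsM B) basis
  ... | i , j , sep , refl with surj i | surj j
  ... | a , refl | b , refl = from (labelsN _) (a , b , sep⁺ sep , restrict-pair e inj a b)
  backward : ∀ B → IsBasis N (restrict e B) → IsBasis M B
  backward B basis = let a , b , sep , eq = to (labelsN _) basis in
    from (labelsM B) (e a , e b , sep⁻ sep , Subset-≗ λ i →
      let c , c≡ = surj i in subst (λ i → lookup B i ≡ lookup (⁅ e a ⁆ ∪ ⁅ e b ⁆) i) c≡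
        (restrict-≗ e B (⁅ e a ⁆ ∪ ⁅ e b ⁆) (trans eq (sym (restrict-pair e inj a b))) c))

third : ∀ {i j : Fin 3} → i ≢ j → ∃ λ k → k ≢ i × k ≢ j × (∀ q → q ≡ i ⊎ q ≡ j ⊎ q ≡ k)
third {i} {j} i≢j = go i j i≢j
  where
  go : ∀ i j → i ≢ j → ∃ λ k → k ≢ i × k ≢ j × (∀ q → q ≡ i ⊎ q ≡ j ⊎ q ≡ k)
  go 0F 0F ne = contradiction refl ne
  go 1F 1F ne = contradiction refl ne
  go 2F 2F ne = contradiction refl ne
  go 0F 1F ne = 2F , (λ ()) , (λ ()) , λ
      { 0F → inj₁ refl ; 1F → inj₂ (inj₁ refl) ; 2F → inj₂ (inj₂ refl) }
  go 0F 2F ne = 1F , (λ ()) , (λ ()) , λ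
      { 0F → inj₁ refl ; 1F → inj₂ (inj₂ refl) ; 2F → inj₂ (inj₁ refl) }
  go 1F 0F ne = 2F , (λ ()) , (λ ()) , λ
      { 0F → inj₂ (inj₁ refl) ; 1F → inj₁ refl ; 2F → inj₂ (inj₂ refl) }
  go 1F 2F ne = 0F , (λ ()) , (λ ()) , λ
      { 0F → inj₂ (inj₂ refl) ; 1F → inj₁ refl ; 2F → inj₂ (inj₁ refl) }
  go 2F 0F ne = 1F , (λ ()) , (λ ()) , λ
      { 0F → inj₂ (inj₁ refl) ; 1F → inj₂ (inj₂ refl) ; 2F → inj₁ refl }
  go 2F 1F ne = 0F , (λ ()) , (λ ()) , λ
      { 0F → inj₂ (inj₂ refl) ; 1F → inj₂ (inj₁ refl) ; 2F → inj₁ refl }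

same-label⇒2≤size : ∀ {n s} (f : Labelling n s) {i j r} → i ≢ j → f i ≡ just r → f j ≡ just r → 2 ≤ size f r
same-label⇒2≤size f {i} {j} {r} i≢j fi fj = ℕₚ.≤-trans
  (ℕₚ.≤-reflexive (sym (cong₂ _+_ (trans (cong (_⟦ r ⟧) fi) (⟦⟧-same r)) (trans (cong (_⟦ r ⟧) fj) (⟦⟧-same r)))))
  (entry+entry≤sum (λ k → f k ⟦ r ⟧) i≢j)

two-singletons⇒≅T : ∀ {m} (M : Matroid (2 + m)) (2≤n : 2 ≤ 2 + m) (f : Labelling (2 + m) 3) → Labels M f →
    (∀ i → f i ≢ nothing) →
  Onto f → ∀ {i j} → i ≢ j → size f i ≡ 1 → size f j ≡ 1 → M ≅ minimal₂ 2≤n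
two-singletons⇒≅T {m} M 2≤n f labels loopless surj {i} {j} i≢j size-i size-j = build E E-injective E-surjective σ-label
    (ℕₚ.+-cancelˡ-≡ 2 count m (sym (Permutation.↔⇒≡ (bijection⇒permutation E E-injective E-surjective))))
  where
  u = proj₁ (surj i)
  fu = proj₂ (surj i)
  w = proj₁ (surj j)
  fw = proj₂ (surj j)
  k = proj₁ (third i≢j)
  k≢i = proj₁ (proj₂ (third i≢j))
  k≢j = proj₁ (proj₂ (proj₂ (third i≢j)))
  cases = proj₂ (proj₂ (proj₂ (third i≢j)))
  isK : Fin (2 + m) → Bool
  isK x = does (Maybeₚ.≡-dec Fin._≟_ (f x) (just k))
  open Enumeration (enumerate isK)
  isK⁺ : ∀ {x} → f x ≡ just k → isK x ≡ true
  isK⁺ {x} e with Maybeₚ.≡-dec Fin._≟_ (f x) (just k)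
  ... | yes _ = refl
  ... | no ne = contradiction e ne
  isK⁻ : ∀ {x} → isK x ≡ true → f x ≡ just k
  isK⁻ {x} _ with Maybeₚ.≡-dec Fin._≟_ (f x) (just k)
  isK⁻ {x} _ | yes e = e
  isK⁻ {x} () | no _
  E : Fin (2 + count) → Fin (2 + m)
  E 0F = u
  E 1F = w
  E (suc (suc a)) = element a
  σ : Fin 3 → Fin 3
  σ 0F = i
  σ 1F = j
  σ 2F = k
  σ-injective : ∀ r q → σ r ≡ σ q → r ≡ q
  σ-injective 0F 0F _ = refl
  σ-injective 0F 1F e = contradiction e i≢j
  σ-injective 0F 2F e = contradiction (sym e) k≢i
  σ-injective 1F 0F e = contradiction (sym e) i≢j
  σ-injective 1F 1F _ = refl
  σ-injective 1F 2F e = contradiction (sym e) k≢j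
  σ-injective 2F 0F e = contradiction e k≢i
  σ-injective 2F 1F e = contradiction e k≢j
  σ-injective 2F 2F _ = refl
  σ-label : ∀ a → ∃ λ r → labelT count a ≡ just r × f (E a) ≡ just (σ r)
  σ-label 0F = 0F , refl , fu
  σ-label 1F = 1F , refl , fw
  σ-label (suc (suc a)) = suc 1F , refl , isK⁻ (hits a)
  clash : ∀ {x r q} → f x ≡ just r → f x ≡ just q → r ≡ q
  clash e e′ = Maybeₚ.just-injective (trans (sym e) e′)
  E-injective′ : ∀ a b → E a ≡ E b → a ≡ b
  E-injective′ 0F 0F _ = refl
  E-injective′ 0F 1F e = contradiction (clash fu (trans (cong f e) fw)) i≢j
  E-injective′ 0F (suc (suc b)) e = contradiction (clash (isK⁻ (hits b)) (trans (cong f (sym e)) fu)) k≢i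
  E-injective′ 1F 0F e = contradiction (clash fu (trans (cong f (sym e)) fw)) i≢j
  E-injective′ 1F 1F _ = refl
  E-injective′ 1F (suc (suc b)) e = contradiction (clash (isK⁻ (hits b)) (trans (cong f (sym e)) fw)) k≢j
  E-injective′ (suc (suc a)) 0F e = contradiction (clash (isK⁻ (hits a)) (trans (cong f e) fu)) k≢i
  E-injective′ (suc (suc a)) 1F e = contradiction (clash (isK⁻ (hits a)) (trans (cong f e) fw)) k≢j
  E-injective′ (suc (suc a)) (suc (suc b)) e = cong (λ x → suc (suc x)) (injective e)
  E-injective : ∀ {a b} → E a ≡ E b → a ≡ b
  E-injective {a} {b} = E-injective′ a b
  only : ∀ {r x y} → size f r ≡ 1 → f x ≡ just r → f y ≡ just r → x ≡ y
  only {x = x} {y} size≡1 fx fy with x Fin.≟ y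
  ... | yes e = e
  ... | no ne = contradiction (ℕₚ.≤-trans (same-label⇒2≤size f ne fx fy) (ℕₚ.≤-reflexive size≡1)) λ { (s≤s ()) }
  E-surjective : ∀ x → ∃ λ a → E a ≡ x
  E-surjective x = go (f x) refl
    where
    go : ∀ l → f x ≡ l → ∃ λ a → E a ≡ x
    go nothing  fx = contradiction fx (loopless x)
    go (just q) fx = [ (λ q≡i → zero , only size-i fu (trans fx (cong just q≡i)))
      , [ (λ q≡j → 1F , only size-j fw (trans fx (cong just q≡j)))
        , (λ q≡k → let a , e = covers x (isK⁺ (trans fx (cong just q≡k))) in suc (suc a) , e) ]′ ]′ (cases q)
  -- The size `count` of the third class equals `m` only by a cardinality argument; with a variable
  -- `c` in its place the equation can be matched.
  build : ∀ {c} (e : Fin (2 + c) → Fin (2 + m)) → (∀ {a b} → e a ≡ e b → a ≡ b) → (∀ x → ∃ λ a → e a ≡ x) →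
          (∀ a → ∃ λ r → labelT c a ≡ just r × f (e a) ≡ just (σ r)) → c ≡ m → M ≅ minimal₂ 2≤n
  build e inj surj label≡ refl = relabelling-≅ {M = M} {N = minimal₂ 2≤n} {f = f} {g = labelT m} labels (labelsT 2≤n) e
      inj surj σ (λ {r} {q} → σ-injective r q) label≡

-- Dimension

sumℚ-single : ∀ {k} (g : Fin k → ℚ) a → (∀ b → b ≢ a → g b ≡ 0ℚ) → sum g ≡ g a
sumℚ-single {suc k} g zero    z = trans (cong (g zero +ℚ_) (trans (sumℚ-cong (λ b → z (suc b) λ ())) (sumℚ-0 k)))
    (ℚₚ.+-identityʳ (g zero))
sumℚ-single {suc k} g (suc a) z = trans
    (cong₂ _+ℚ_ (z zero λ ()) (sumℚ-single (g ∘ suc) a (λ b b≢a → z (suc b) (b≢a ∘ Finₚ.suc-injective))))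
        (ℚₚ.+-identityˡ (g (suc a)))

-- Gaussian elimination for a homogeneous system with fewer equations than unknowns, the equations
-- being the rows that `mask` selects. A zero row is dropped; any other row eliminates one unknown.
solvable : ∀ {n k} (mask : Fin n → Bool) (E : Fin n → Fin k → ℚ) → sumℕ (λ i → if mask i then 1 else 0) < k →
           ∃ λ (c : Fin k → ℚ) → (∃ λ a → c a ≢ 0ℚ) × (∀ i → mask i ≡ true → sum (λ a → c a *ℚ E i a) ≡ 0ℚ)
solvable {zero}  {suc k} mask E _ = (λ _ → 1ℚ) , (zero , λ ()) , λ ()
solvable {suc n} {k} mask E lt = go (mask zero) refl
  where
  rest = sumℕ (λ i → if mask (suc i) then 1 else 0)
  Goal : Set
  Goal = ∃ λ (c : Fin k → ℚ) → (∃ λ a → c a ≢ 0ℚ) × (∀ i → mask i ≡ true → sum (λ a → c a *ℚ E i a) ≡ 0ℚ)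
  drop-first : (∀ (c : Fin k → ℚ) → mask zero ≡ true → sum (λ a → c a *ℚ E zero a) ≡ 0ℚ) → Goal
  drop-first trivial = let c , nonzero , solves = solvable (mask ∘ suc) (E ∘ suc) (ℕₚ.≤-<-trans (ℕₚ.m≤n+m rest _) lt)
    in c , nonzero , λ { zero → trivial c ; (suc i) → solves i }
  pivot : ∀ {k} (E : Fin (suc n) → Fin k → ℚ) a₀ → E zero a₀ ≢ 0ℚ → suc rest < k →
          ∃ λ (c : Fin k → ℚ) → (∃ λ a → c a ≢ 0ℚ) × (∀ i → mask i ≡ true → sum (λ a → c a *ℚ E i a) ≡ 0ℚ)
  pivot {suc k′} E a₀ E≢0 (s≤s lt′) = c , nonzero , solves
    where
    e = E zero a₀
    instance _ = ℚ.≢-nonZero E≢0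
    others : Fin k′ → Fin (suc k′)
    others = Fin.punchIn a₀
    -- The first row solved for the pivot unknown gives `c a₀ = - Σ c b · g b`; substituting this
    -- into the other rows yields `E′`.
    g : Fin k′ → ℚ
    g b = E zero (others b) *ℚ ℚ.1/ e
    E′ : Fin n → Fin k′ → ℚ
    E′ i b = E (suc i) (others b) -ℚ E (suc i) a₀ *ℚ g b
    ih = solvable (mask ∘ suc) E′ lt′
    c′ = proj₁ ih
    c₀ : ℚ
    c₀ = -ℚ sum (λ b → c′ b *ℚ g b)
    c : Fin (suc k′) → ℚ
    c = VecF.insertAt c′ a₀ c₀
    c-others : ∀ b → c (others b) ≡ c′ b
    c-others b = VecFₚ.insertAt-punchIn c′ a₀ c₀ b
    nonzero : ∃ λ a → c a ≢ 0ℚ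
    nonzero = let b , c′b≢0 = proj₁ (proj₂ ih) in others b , λ z → c′b≢0 (trans (sym (c-others b)) z)
    eliminate : ∀ (r : Fin (suc k′) → ℚ) → sum (λ a → c a *ℚ r a) ≡ sum (λ b → c′ b *ℚ (r (others b) -ℚ r a₀ *ℚ g b))
    eliminate r = begin
      sum (λ a → c a *ℚ r a)                                                  ≡⟨ sumℚ-remove {i = a₀} (λ a → c a *ℚ r a) ⟩
      c a₀ *ℚ r a₀ +ℚ sum (λ b → c (others b) *ℚ r (others b))                ≡⟨ cong₂ _+ℚ_
          (cong (_*ℚ r a₀) (VecFₚ.insertAt-lookup c′ a₀ c₀)) (sumℚ-cong (λ b → cong (_*ℚ r (others b)) (c-others b))) ⟩
      c₀ *ℚ r a₀ +ℚ sum (λ b → c′ b *ℚ r (others b))                          ≡⟨ cong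
          (_+ℚ sum (λ b → c′ b *ℚ r (others b)))
              (trans (negate (sum (λ b → c′ b *ℚ g b)) (r a₀)) (sumℚ-* (-ℚ r a₀) (λ b → c′ b *ℚ g b))) ⟩
      sum (λ b → -ℚ r a₀ *ℚ (c′ b *ℚ g b)) +ℚ sum (λ b → c′ b *ℚ r (others b)) ≡⟨ sumℚ-+ (λ b → -ℚ r a₀ *ℚ (c′ b *ℚ g b))
          (λ b → c′ b *ℚ r (others b)) ⟨
      sum (λ b → -ℚ r a₀ *ℚ (c′ b *ℚ g b) +ℚ c′ b *ℚ r (others b))            ≡⟨ sumℚ-cong
          (λ b → factor (r a₀) (c′ b) (g b) (r (others b))) ⟩
      sum (λ b → c′ b *ℚ (r (others b) -ℚ r a₀ *ℚ g b))                       ∎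
      where
      open ≡-Reasoning
      open +-*-Solver
      negate : ∀ x y → (-ℚ x) *ℚ y ≡ (-ℚ y) *ℚ x
      negate = solve 2 (λ x y → (:- x) :* y := (:- y) :* x) refl
      factor : ∀ x y z w → (-ℚ x) *ℚ (y *ℚ z) +ℚ y *ℚ w ≡ y *ℚ (w -ℚ x *ℚ z)
      factor = solve 4 (λ x y z w → (:- x) :* (y :* z) :+ y :* w := y :* (w :- x :* z)) refl
    solves : ∀ i → mask i ≡ true → sum (λ a → c a *ℚ E i a) ≡ 0ℚ
    solves (suc i) m = trans (eliminate (E (suc i))) (proj₂ (proj₂ ih) i m)
    solves zero    _ = trans (eliminate (E zero))
        (trans (sumℚ-cong (λ b → trans (cong (c′ b *ℚ_) (cancel-pivot (E zero (others b)))) (ℚₚ.*-zeroʳ (c′ b))))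
            (sumℚ-0 k′))
      where
      cancel-pivot : ∀ x → x -ℚ e *ℚ (x *ℚ ℚ.1/ e) ≡ 0ℚ
      cancel-pivot x = trans (solve 3 (λ x e i → x :- e :* (x :* i) := x :- x :* (e :* i)) refl x e (ℚ.1/ e))
        (trans (cong (λ u → x -ℚ x *ℚ u) (ℚₚ.*-inverseʳ e)) (solve 1 (λ x → x :- x :* con 1ℚ := con 0ℚ) refl x))
        where open +-*-Solver
  go : ∀ b → mask zero ≡ b → Goal
  go false m0 = drop-first (λ c m → contradiction (trans (sym m0) m) λ ())
  go true  m0 = pivot? (Finₚ.any? (λ a → ¬? (E zero a ℚ.≟ 0ℚ)))
    where
    pivot? : Dec (∃ λ a → E zero a ≢ 0ℚ) → Goal
    pivot? (yes (a₀ , E≢0)) = pivot E a₀ E≢0 (subst (λ b → (if b then 1 else 0) + rest < k) m0 lt)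
    pivot? (no none) = drop-first λ c _ → trans (sumℚ-cong (λ a → trans (cong (c a *ℚ_) (vanish a)) (ℚₚ.*-zeroʳ (c a))))
        (sumℚ-0 k)
      where
      vanish : ∀ a → E zero a ≡ 0ℚ
      vanish a = decidable-stable (E zero a ℚ.≟ 0ℚ) (λ ne → none (a , ne))

dot-0 : ∀ {n} (χ x : Point n) → (∀ i → x i ≡ 0ℚ) → dot χ x ≡ 0ℚ
dot-0 {n} χ x x≡0 = trans (sumℚ-cong (λ i → trans (cong (χ i *ℚ_) (x≡0 i)) (ℚₚ.*-zeroʳ (χ i)))) (sumℚ-0 n)

functional-kills : ∀ {n k} (χ : Point n) (c d : Fin k → ℚ) (v : Fin k → Point n) → (∀ a → dot χ (v a) ≡ d a) →
                   dot χ (λ i → sum (λ a → c a *ℚ v a i)) ≡ 0ℚ → sum (λ a → c a *ℚ d a) ≡ 0ℚ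
functional-kills χ c d v dot≡ zero≡ = trans (sumℚ-cong (λ a → cong (c a *ℚ_) (sym (dot≡ a))))
    (trans (sym (dot-sum χ c v)) zero≡)

scaled-sum≡0 : ∀ {k} (c : Fin k → ℚ) m → sum (λ a → c a *ℚ fromℕ (suc m)) ≡ 0ℚ → sum c ≡ 0ℚ
scaled-sum≡0 c m e = *-zero-cancel {fromℕ (suc m)} (fromℕ-suc≢0 m)
  (trans (sumℚ-* (fromℕ (suc m)) c) (trans (sumℚ-cong (λ a → ℚₚ.*-comm (fromℕ (suc m)) (c a))) e))

isClass : ∀ {s} → Maybe (Fin s) → Bool
isClass nothing  = false
isClass (just _) = true

isClass-count : ∀ {s} (l : Maybe (Fin s)) → (if isClass l then 1 else 0) ≡ nonloop l
isClass-count nothing  = refl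
isClass-count (just _) = refl

isClass-false : ∀ {s} (l : Maybe (Fin s)) → isClass l ≡ false → l ≡ nothing
isClass-false nothing _ = refl

unit-same : ∀ {n} (i : Fin n) → unit i i ≡ 1
unit-same i with i Fin.≟ i
... | yes _  = refl
... | no i≢i = contradiction refl i≢i

module Dimension {n s} (M : Matroid n) (f : Labelling n s) (labels : Labels M f) (r₀ r₁ : Fin s) (r₀≢r₁ : r₀ ≢ r₁)
                 (u₀ u₁ : Fin n) (fu₀ : f u₀ ≡ just r₀) (fu₁ : f u₁ ≡ just r₁) where

  -- The nonloops other than `u₀`. They index the independent family of the lower bound and, for two
  -- classes, the equations of the upper bound.
  mask : Fin n → Bool
  mask i = isClass (f i) Bool.∧ Bool.not (does (u₀ Fin.≟ i))

  mask-u₀ : mask u₀ ≢ true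
  mask-u₀ e with u₀ Fin.≟ u₀
  ... | no ne = contradiction refl ne
  ... | yes _ = contradiction (trans (sym (Boolₚ.∧-zeroʳ (isClass (f u₀)))) e) λ ()

  mask-false : ∀ i → mask i ≡ false → f i ≡ nothing ⊎ i ≡ u₀
  mask-false i e with u₀ Fin.≟ i
  ... | yes u₀≡i = inj₂ (sym u₀≡i)
  ... | no _     = inj₁ (isClass-false (f i) (trans (sym (Boolₚ.∧-identityʳ (isClass (f i)))) e))

  mask-true⁻ : ∀ i → mask i ≡ true → ∃ λ r → f i ≡ just r
  mask-true⁻ i m = go (f i) refl
    where
    go : ∀ l → f i ≡ l → ∃ λ r → f i ≡ just r
    go (just r) fi = r , fi
    go nothing  fi = contradiction (trans (sym (cong (λ l → isClass l Bool.∧ Bool.not (does (u₀ Fin.≟ i))) fi)) m) λ ()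

  maskSize : ℕ
  maskSize = sumℕ (λ i → if mask i then 1 else 0)

  suc-maskSize : suc maskSize ≡ nonloops f
  suc-maskSize = trans (ℕₚ.+-comm 1 maskSize)
      (trans (cong (maskSize +_) (sym
          (trans (sumℕ-cong (λ i → sym (ℕₚ.*-identityˡ (unit u₀ i)))) (sumℕ-unit (λ _ → 1) u₀))))
    (trans (sym (sumℕ-+ (λ i → if mask i then 1 else 0) (unit u₀))) (sumℕ-cong entry)))
    where
    entry : ∀ i → (if mask i then 1 else 0) + unit u₀ i ≡ nonloop (f i)
    entry i with u₀ Fin.≟ i
    ... | yes refl = trans (cong (λ b → (if b then 1 else 0) + 1) (Boolₚ.∧-zeroʳ (isClass (f u₀)))) (sym (cong nonloop fu₀))
    ... | no _     = trans (ℕₚ.+-identityʳ _)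
        (trans (cong (λ b → if b then 1 else 0) (Boolₚ.∧-identityʳ (isClass (f i)))) (isClass-count (f i)))

  Dependency : ∀ {k} → (Fin k → Point n) → Set
  Dependency {k} v = ∃ λ (c : Fin k → ℚ) → (∃ λ a → c a ≢ 0ℚ) × sum c ≡ 0ℚ × (∀ i → sum (λ a → c a *ℚ v a i) ≡ 0ℚ)

  dependency⇒¬independent : ∀ {k} (v : Fin k → Point n) → Dependency v → ¬ AffinelyIndependent v
  dependency⇒¬independent v (c , (a , c≢0) , sum≡0 , z) independent = c≢0 (independent c sum≡0 z a)

  loop-coordinate : ∀ {k} (c : Fin k → ℚ) (v : Fin k → Point n) → (∀ a → polytope M (v a)) → ∀ i → f i ≡ nothing → sum
      (λ a → c a *ℚ v a i) ≡ 0ℚ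
  loop-coordinate {k} c v Pv i floop = trans
      (sumℚ-cong (λ a → trans (cong (c a *ℚ_) (polytope-loop M f labels i floop (Pv a))) (ℚₚ.*-zeroʳ (c a)))) (sumℚ-0 k)

  -- One equation for each nonloop is enough: loop coordinates vanish on the whole polytope, and
  -- since every point has total 2, the coefficients sum to zero as soon as the combination is zero.
  dependent : ∀ {k} (v : Fin k → Point n) → (∀ a → polytope M (v a)) → nonloops f < k → Dependency v
  dependent v Pv lt = c , proj₁ (proj₂ solution) , sum-c , coordinate
    where
    solution = solvable (isClass ∘ f) (λ i a → v a i)
        (ℕₚ.≤-<-trans (ℕₚ.≤-reflexive (sumℕ-cong (λ i → isClass-count (f i)))) lt)
    c = proj₁ solution
    coordinate : ∀ i → sum (λ a → c a *ℚ v a i) ≡ 0ℚ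
    coordinate i = go (isClass (f i)) refl
      where
      go : ∀ b → isClass (f i) ≡ b → sum (λ a → c a *ℚ v a i) ≡ 0ℚ
      go true  e = proj₂ (proj₂ solution) i e
      go false e = loop-coordinate c v Pv i (isClass-false (f i) e)
    sum-c : sum c ≡ 0ℚ
    sum-c = scaled-sum≡0 c 1 (functional-kills (fromℕ ∘ nonloop ∘ f) c (λ _ → fromℕ 2) v
        (λ a → polytope-total M f labels (Pv a))
      (dot-0 (fromℕ ∘ nonloop ∘ f) _ coordinate))

  -- With only two classes both class sums are constant on the polytope, which saves one more equation.
  dependent₂ : (∀ r {y} → polytope M y → dot (λ i → fromℕ (f i ⟦ r ⟧)) y ≡ 1ℚ) →
               ∀ {k} (v : Fin k → Point n) → (∀ a → polytope M (v a)) → maskSize < k → Dependency v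
  dependent₂ class≡1 v Pv lt = c , proj₁ (proj₂ solution) , sum-c , coordinate
    where
    solution = solvable mask (λ i a → v a i) lt
    c = proj₁ solution
    y : Point n
    y i = sum (λ a → c a *ℚ v a i)
    coordinate′ : ∀ i → i ≢ u₀ → y i ≡ 0ℚ
    coordinate′ i i≢u₀ = go (mask i) refl
      where
      go : ∀ b → mask i ≡ b → y i ≡ 0ℚ
      go true  e = proj₂ (proj₂ solution) i e
      go false e = [ loop-coordinate c v Pv i , (λ i≡u₀ → contradiction i≡u₀ i≢u₀) ]′ (mask-false i e)
    dot-u₀ : ∀ r → dot (λ i → fromℕ (f i ⟦ r ⟧)) y ≡ fromℕ (f u₀ ⟦ r ⟧) *ℚ y u₀
    dot-u₀ r = sumℚ-single (λ i → fromℕ (f i ⟦ r ⟧) *ℚ y i) u₀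
        (λ i i≢u₀ → trans (cong (fromℕ (f i ⟦ r ⟧) *ℚ_) (coordinate′ i i≢u₀)) (ℚₚ.*-zeroʳ (fromℕ (f i ⟦ r ⟧))))
    -- The class of `r₁` does not contain `u₀`, so its sum involves only coordinates already known
    -- to vanish. The class of `r₀` then recovers the missing coordinate at `u₀`.
    sum-c : sum c ≡ 0ℚ
    sum-c = scaled-sum≡0 c 0 (functional-kills (λ i → fromℕ (f i ⟦ r₁ ⟧)) c (λ _ → 1ℚ) v (λ a → class≡1 r₁ (Pv a))
      (trans (dot-u₀ r₁) (trans (cong (λ x → fromℕ x *ℚ y u₀) (trans (cong (_⟦ r₁ ⟧) fu₀) (⟦⟧-diff r₀≢r₁)))
          (ℚₚ.*-zeroˡ (y u₀)))))
    y-u₀ : y u₀ ≡ 0ℚ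
    y-u₀ = begin
      y u₀                                     ≡⟨ ℚₚ.*-identityˡ (y u₀) ⟨
      fromℕ 1 *ℚ y u₀                          ≡⟨ cong (λ x → fromℕ x *ℚ y u₀) (trans (cong (_⟦ r₀ ⟧) fu₀) (⟦⟧-same r₀)) ⟨
      fromℕ (f u₀ ⟦ r₀ ⟧) *ℚ y u₀              ≡⟨ dot-u₀ r₀ ⟨
      dot (λ i → fromℕ (f i ⟦ r₀ ⟧)) y         ≡⟨ dot-sum (λ i → fromℕ (f i ⟦ r₀ ⟧)) c v ⟩
      sum (λ a → c a *ℚ dot (λ i → fromℕ (f i ⟦ r₀ ⟧)) (v a)) ≡⟨ sumℚ-cong
          (λ a → trans (cong (c a *ℚ_) (class≡1 r₀ (Pv a))) (ℚₚ.*-identityʳ (c a))) ⟩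
      sum c                                    ≡⟨ sum-c ⟩
      0ℚ                                       ∎
      where open ≡-Reasoning
    coordinate : ∀ i → y i ≡ 0ℚ
    coordinate i = go (i Fin.≟ u₀)
      where
      go : Dec (i ≡ u₀) → y i ≡ 0ℚ
      go (yes i≡u₀) = trans (cong y i≡u₀) y-u₀
      go (no i≢u₀)  = coordinate′ i i≢u₀

  open Enumeration (enumerate mask)

  element≢u₀ : ∀ a → element a ≢ u₀
  element≢u₀ a e = mask-u₀ (trans (cong mask (sym e)) (hits a))

  -- In the complete multipartite graph whose edges are the bases, joining each nonloop except `u₀`
  -- to its partner gives a spanning tree: a double star with centres `u₀` and `u₁`. The edge
  -- vectors of a tree are linearly independent.
  partner : Fin n → Fin n
  partner i = if does (Maybeₚ.≡-dec Fin._≟_ (f i) (just r₀)) then u₁ else u₀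

  partner-r₀ : ∀ {i} → f i ≡ just r₀ → partner i ≡ u₁
  partner-r₀ {i} fi with Maybeₚ.≡-dec Fin._≟_ (f i) (just r₀)
  ... | yes _ = refl
  ... | no ne = contradiction fi ne

  partner-≢r₀ : ∀ {i} → f i ≢ just r₀ → partner i ≡ u₀
  partner-≢r₀ {i} ne with Maybeₚ.≡-dec Fin._≟_ (f i) (just r₀)
  ... | yes e = contradiction e ne
  ... | no _  = refl

  partner-separated : ∀ {i r} → f i ≡ just r → Separated f (partner i) i
  partner-separated {i} {r} fi with r Fin.≟ r₀
  ... | yes refl = r₁ , r₀ , trans (cong f (partner-r₀ fi)) fu₁ , fi , r₀≢r₁ ∘ sym
  ... | no r≢r₀  = r₀ , r , trans (cong f (partner-≢r₀ λ e → r≢r₀ (Maybeₚ.just-injective (trans (sym fi) e)))) fu₀ , fi ,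
      r≢r₀ ∘ sym

  point : Fin count → Point n
  point a = indicator (⁅ partner (element a) ⁆ ∪ ⁅ element a ⁆)

  point-separated : ∀ a → Separated f (partner (element a)) (element a)
  point-separated a = partner-separated (proj₂ (mask-true⁻ (element a) (hits a)))

  point∈polytope : ∀ a → polytope M (point a)
  point∈polytope a = basis⇒polytope M (from (labels _) (_ , _ , point-separated a , refl))

  point-units : ∀ a k → point a k ≡ fromℕ (unit (partner (element a)) k + unit (element a) k)
  point-units a = indicator-pair (separated-≢ {f = f} (point-separated a))

  partner-cases : ∀ i → partner i ≡ u₁ ⊎ partner i ≡ u₀
  partner-cases i with Maybeₚ.≡-dec Fin._≟_ (f i) (just r₀)
  ... | yes _ = inj₁ refl
  ... | no _  = inj₂ refl

  -- An element other than u₀ and u₁ lies in its own basis only; once its coefficients are gone, the basis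
  -- of u₁ is the only one left.
  independent : (c : Fin count → ℚ) → (∀ i → sum (λ a → c a *ℚ point a i) ≡ 0ℚ) → ∀ a → c a ≡ 0ℚ
  independent c z = all-zero
    where
    single : ∀ a i → (∀ b → b ≢ a → c b *ℚ point b i ≡ 0ℚ) → point a i ≡ 1ℚ → c a ≡ 0ℚ
    single a i others point≡1 = trans (sym (ℚₚ.*-identityʳ (c a))) (trans (cong (c a *ℚ_) (sym point≡1))
      (trans (sym (sumℚ-single (λ b → c b *ℚ point b i) a others)) (z i)))
    zero-coordinate : ∀ b i → partner (element b) ≢ i → element b ≢ i → point b i ≡ 0ℚ
    zero-coordinate b i p≢i e≢i = trans (point-units b i)
        (cong fromℕ (cong₂ _+_ (unit-≢ {i = partner (element b)} p≢i) (unit-≢ {i = element b} e≢i)))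
    partner≢ : ∀ b {i} → i ≢ u₁ → i ≢ u₀ → partner (element b) ≢ i
    partner≢ b i≢u₁ i≢u₀ e = [ (λ p → i≢u₁ (trans (sym e) p)) , (λ p → i≢u₀ (trans (sym e) p)) ]′
        (partner-cases (element b))
    generic : ∀ a → element a ≢ u₁ → c a ≡ 0ℚ
    generic a a≢u₁ = single a (element a)
      (λ b b≢a → trans (cong (c b *ℚ_)
          (zero-coordinate b (element a) (partner≢ b a≢u₁ (element≢u₀ a)) (b≢a ∘ injective))) (ℚₚ.*-zeroʳ (c b)))
      (trans (point-units a (element a))
          (cong fromℕ (cong₂ _+_ (unit-≢ {i = partner (element a)} (partner≢ a a≢u₁ (element≢u₀ a)))
              (unit-same (element a)))))
    last : ∀ a → element a ≡ u₁ → c a ≡ 0ℚ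
    last a a≡u₁ = single a u₀
      (λ b b≢a → trans (cong (_*ℚ point b u₀) (generic b (λ b≡u₁ → b≢a (injective (trans b≡u₁ (sym a≡u₁))))))
          (ℚₚ.*-zeroˡ (point b u₀)))
      (trans (point-units a u₀) (cong fromℕ
          (cong₂ _+_ (trans (cong (λ p → unit p u₀) partner≡u₀) (unit-same u₀)) (unit-≢ {i = element a} (element≢u₀ a)))))
      where
      partner≡u₀ : partner (element a) ≡ u₀
      partner≡u₀ = partner-≢r₀ λ e → r₀≢r₁ (Maybeₚ.just-injective (trans (sym e) (trans (cong f a≡u₁) fu₁)))
    all-zero : ∀ a → c a ≡ 0ℚ
    all-zero a = go (element a Fin.≟ u₁)
      where
      go : Dec (element a ≡ u₁) → c a ≡ 0ℚ
      go (yes e) = last a e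
      go (no ne) = generic a ne

  dimension₂ : (∀ r {y} → polytope M y → dot (λ i → fromℕ (f i ⟦ r ⟧)) y ≡ 1ℚ) → ∀ {d} → nonloops f ≡ 2 + d →
      HasDimension (polytope M) d
  dimension₂ class≡1 {d} nonloops≡ =
    subst (λ k → ∃ λ (v : Fin k → Point n) → (∀ a → polytope M (v a)) × AffinelyIndependent v) count≡suc
      (point , point∈polytope , λ c _ → independent c)
    , λ v Pv → dependency⇒¬independent v (dependent₂ class≡1 v Pv (ℕₚ.≤-reflexive (cong suc maskSize≡)))
    where
    maskSize≡ : maskSize ≡ suc d
    maskSize≡ = ℕₚ.suc-injective (trans suc-maskSize nonloops≡)
    count≡suc : count ≡ suc d
    count≡suc = trans count≡ maskSize≡

  module _ (r₂ : Fin s) (r₂≢r₀ : r₂ ≢ r₀) (r₂≢r₁ : r₂ ≢ r₁) (u₂ : Fin n) (fu₂ : f u₂ ≡ just r₂) where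

    private
      sep₁₂ : Separated f u₁ u₂
      sep₁₂ = r₁ , r₂ , fu₁ , fu₂ , r₂≢r₁ ∘ sym

      -- This edge closes the triangle on `u₀`, `u₁`, `u₂`. The odd cycle raises the dimension by
      -- one compared with the bipartite case of two classes.
      extra : Point n
      extra = indicator (⁅ u₁ ⁆ ∪ ⁅ u₂ ⁆)

      points : Fin (suc count) → Point n
      points zero    = extra
      points (suc a) = point a

      inClass₀ : Fin n → ℕ
      inClass₀ i = f i ⟦ r₀ ⟧

      extra-class : dot (fromℕ ∘ inClass₀) extra ≡ 0ℚ
      extra-class = trans (dot-units inClass₀ u₁ u₂ extra (indicator-pair (separated-≢ {f = f} sep₁₂)))
        (cong fromℕ (cong₂ _+_ (trans (cong (_⟦ r₀ ⟧) fu₁) (⟦⟧-diff (r₀≢r₁ ∘ sym)))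
            (trans (cong (_⟦ r₀ ⟧) fu₂) (⟦⟧-diff r₂≢r₀))))

      partner-class : ∀ i {r} → f i ≡ just r → inClass₀ (partner i) + inClass₀ i ≡ 1
      partner-class i {r} fi with r Fin.≟ r₀
      ... | yes refl = cong₂ _+_ (trans (cong (_⟦ r₀ ⟧) (trans (cong f (partner-r₀ fi)) fu₁)) (⟦⟧-diff (r₀≢r₁ ∘ sym)))
          (trans (cong (_⟦ r₀ ⟧) fi) (⟦⟧-same r₀))
      ... | no r≢r₀  = cong₂ _+_ (trans
          (cong (_⟦ r₀ ⟧) (trans (cong f (partner-≢r₀ λ e → r≢r₀ (Maybeₚ.just-injective (trans (sym fi) e)))) fu₀))
              (⟦⟧-same r₀))
                         (trans (cong (_⟦ r₀ ⟧) fi) (⟦⟧-diff r≢r₀))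

      point-class : ∀ a → dot (fromℕ ∘ inClass₀) (point a) ≡ 1ℚ
      point-class a = trans (dot-units inClass₀ (partner (element a)) (element a) (point a) (point-units a))
        (cong fromℕ (partner-class (element a) (proj₂ (mask-true⁻ (element a) (hits a)))))

      -- The class of r₀ has sum 0 at the extra point and sum 1 at all others.
      independent⁺ : AffinelyIndependent points
      independent⁺ c sum≡0 z = λ { zero → c0 ; (suc a) → independent (c ∘ suc) z′ a }
        where
        killed : c zero *ℚ 0ℚ +ℚ sum (λ a → c (suc a) *ℚ 1ℚ) ≡ 0ℚ
        killed = functional-kills (fromℕ ∘ inClass₀) c (λ { zero → 0ℚ ; (suc _) → 1ℚ }) points
            (λ { zero → extra-class ; (suc a) → point-class a })
          (dot-0 (fromℕ ∘ inClass₀) (λ i → sum (λ a → c a *ℚ points a i)) z)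
        rest≡0 : sum (c ∘ suc) ≡ 0ℚ
        rest≡0 = trans (sumℚ-cong (λ a → sym (ℚₚ.*-identityʳ (c (suc a)))))
          (trans (sym (trans (cong (_+ℚ sum (λ a → c (suc a) *ℚ 1ℚ)) (ℚₚ.*-zeroʳ (c zero)))
              (ℚₚ.+-identityˡ (sum (λ a → c (suc a) *ℚ 1ℚ))))) killed)
        c0 : c zero ≡ 0ℚ
        c0 = trans (sym (ℚₚ.+-identityʳ (c zero))) (trans (cong (c zero +ℚ_) (sym rest≡0)) sum≡0)
        z′ : ∀ i → sum (λ a → c (suc a) *ℚ point a i) ≡ 0ℚ
        z′ i = trans (sym (trans (cong (_+ℚ sum (λ a → c (suc a) *ℚ point a i))
            (trans (cong (_*ℚ extra i) c0) (ℚₚ.*-zeroˡ (extra i))))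
                (ℚₚ.+-identityˡ (sum (λ a → c (suc a) *ℚ point a i))))) (z i)

    dimension₃ : ∀ {d} → nonloops f ≡ suc d → HasDimension (polytope M) d
    dimension₃ {d} nonloops≡ =
      subst (λ k → ∃ λ (v : Fin (suc k) → Point n) → (∀ a → polytope M (v a)) × AffinelyIndependent v)
        (trans count≡ (ℕₚ.suc-injective (trans suc-maskSize nonloops≡)))
        (points , (λ { zero → basis⇒polytope M (from (labels _) (u₁ , u₂ , sep₁₂ , refl)) ; (suc a) → point∈polytope a })
            , independent⁺)
      , λ v Pv → dependency⇒¬independent v (dependent v Pv (ℕₚ.≤-reflexive (cong suc nonloops≡)))

-- Ehrhart polynomials of matroids of rank 2

ehr-cong : ∀ {s} m {a b : Fin s → ℕ} → (∀ r → a r ≡ b r) → ∀ j → coeff (ehr m a) j ≡ coeff (ehr m b) j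
ehr-cong m {a} {b} e j = trans (coeff-ehr m a j) (trans
  (cong (λ S → coeff (ehrT m) j +ℚ (X -ℚ S)) (sumℚ-cong (λ r → cong (λ x → coeff (Φ (2 + m) x) j) (e r))))
      (sym (coeff-ehr m b j)))
  where X = coeff (Φ (2 + m) 1) j +ℚ (coeff (Φ (2 + m) 1) j +ℚ coeff (Φ (2 + m) m) j)

≤ᶜ⇒⪯ : ∀ {p q} → p ≤ᶜ q → p ⪯ q
≤ᶜ⇒⪯ {p} {q} p≤q j = subst (_≤ℚ coeff q j -ℚ coeff p j) (ℚₚ.+-inverseʳ (coeff p j)) (ℚₚ.+-monoˡ-≤ (-ℚ coeff p j) (p≤q j))

nonloops-loopless : ∀ {n s} (f : Labelling n s) → (∀ i → f i ≢ nothing) → nonloops f ≡ n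
nonloops-loopless {n} f loopless = trans (sumℕ-cong (λ i → go (f i) (loopless i))) (sumℕ-1 n)
  where
  go : ∀ l → l ≢ nothing → nonloop l ≡ 1
  go nothing  ne = contradiction refl ne
  go (just _) _  = refl

isEhrhartT : ∀ m (2≤n : 2 ≤ 2 + m) → IsEhrhartPolynomial (polytope (minimal₂ 2≤n)) (ehr m (size (labelT m)))
isEhrhartT m 2≤n = isEhrhart (minimal₂ 2≤n) (labelT m) (labelsT 2≤n) m nonloops≡
  (λ r → subst₂ _<_ (sym (size-labelT m r)) (sym nonloops≡) (sizesT< r))
  where
  nonloops≡ : nonloops (labelT m) ≡ 2 + m
  nonloops≡ = cong (2 +_) (sumℕ-1 m)
  sizesT< : ∀ r → sizesT m r < 2 + m
  sizesT< zero             = s≤s (s≤s z≤n)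
  sizesT< 1F = s≤s (s≤s z≤n)
  sizesT< 2F = s≤s (ℕₚ.n≤1+n m)

isEhrhartU : ∀ m (2≤n : 2 ≤ 2 + m) → IsEhrhartPolynomial (polytope (uniform 2≤n)) (ehr m (size (labelU (2 + m))))
isEhrhartU m 2≤n = isEhrhart (uniform 2≤n) (labelU (2 + m)) (labelsU 2≤n) m (sumℕ-1 (2 + m))
  (λ r → subst₂ _<_ (sym (size-labelU r)) (sym (sumℕ-1 (2 + m))) (s≤s (s≤s z≤n)))

module ThreeClasses {m k} (M : Matroid (2 + m)) (rk : HasRank M 2) (f : Labelling (2 + m) (3 + k)) (labels : Labels M f)
  (surj : ∀ r → ∃ λ i → f i ≡ just r) (size-pos : ∀ r → 0 < size f r) (loopless : ∀ i → f i ≢ nothing) where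

  private
    T = minimal₂ (rank≤size M rk)
    U = uniform (rank≤size M rk)

    nonloops≡ : nonloops f ≡ 2 + m
    nonloops≡ = nonloops-loopless f loopless

  open Compare m k (size f) size-pos (trans (sum-size f) nonloops≡)

  notMinimal : ¬ (M ≅ T) → NotMinimal
  notMinimal ¬M≅T (k≡0 , i , j , i≢j , size-i , size-j) = go k≡0 f labels loopless surj size-i size-j
    where
    -- Everything whose type mentions `k` is abstracted, so that `k ≡ 0` can be matched and exactly
    -- three labels remain.
    go : ∀ {k} → k ≡ 0 → (f : Labelling (2 + m) (3 + k)) → Labels M f → (∀ i → f i ≢ nothing) →
        Onto f →
         size f (i Fin.↑ˡ k) ≡ 1 → size f (j Fin.↑ˡ k) ≡ 1 → Data.Empty.⊥
    go refl f labels loopless surj size-i size-j = ¬M≅T (two-singletons⇒≅T M (rank≤size M rk) f labels loopless surj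
      (i≢j ∘ Finₚ.↑ˡ-injective 0 i j) size-i size-j)

  -- Whether some class has two elements is decidable. If none has, distinct elements always carry
  -- distinct labels, and every pair is a basis.
  notUniform : ¬ (IsBasis M ≐ IsBasis U) → ∃ λ r → 1 < size f r
  notUniform ¬uniform = go (Finₚ.any? (λ r → 2 ℕ.≤? size f r))
    where
    go : Dec (∃ λ r → 1 < size f r) → ∃ λ r → 1 < size f r
    go (yes big) = big
    go (no none) = Data.Empty.⊥-elim (¬uniform ((λ {B} → rk {B}) , λ {B} → backward {B}))
      where
      label-of : ∀ i → ∃ λ r → f i ≡ just r
      label-of i = split (f i) refl
        where
        split : ∀ l → f i ≡ l → ∃ λ r → f i ≡ just r
        split nothing  e = contradiction e (loopless i)
        split (just r) e = r , e
      backward : ∀ {B} → ∣ B ∣ ≡ 2 → IsBasis M B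
      backward {B} size≡2 = let i , j , i≢j , B≡ = ∣∣≡2⇒pair B size≡2
                                r , fi = label-of i
                                q , fj = label-of j
        in from (labels B) (i , j , (r , q , fi , fj , λ r≡q →
             none (q , same-label⇒2≤size f i≢j (trans fi (cong just r≡q)) fj)) , B≡)

  module _ (pT pM pU : Polynomial) (T-ehr : IsEhrhartPolynomial (polytope T) pT)
      (M-ehr : IsEhrhartPolynomial (polytope M) pM)
           (U-ehr : IsEhrhartPolynomial (polytope U) pU) where

    private
      coeffT : ∀ j → coeff (ehrT m) j ≡ coeff pT j
      coeffT j = sym (trans (ehrhart-unique pT (ehr m (size (labelT m))) T-ehr (isEhrhartT m (rank≤size M rk)) j)
        (trans (ehr-cong {3} m {size (labelT m)} {sizesT m} (size-labelT m) j) (coeff-ehr-sizesT m j)))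

      coeffM : ∀ j → coeff (ehr m (size f)) j ≡ coeff pM j
      coeffM j = ehrhart-unique (ehr m (size f)) pM
          (isEhrhart M f labels m nonloops≡ (λ r → subst (size f r <_) (sym nonloops≡) (a< r))) M-ehr j

      coeffU : ∀ j → coeff (ehr {2 + m} m (λ _ → 1)) j ≡ coeff pU j
      coeffU j = sym (trans (ehrhart-unique pU (ehr m (size (labelU (2 + m)))) U-ehr (isEhrhartU m (rank≤size M rk)) j)
        (ehr-cong {2 + m} m {size (labelU (2 + m))} {λ _ → 1} size-labelU j))

    lower : pT ⪯ pM
    lower = ≤ᶜ⇒⪯ {pT} {pM} λ j → subst₂ _≤ℚ_ (coeffT j) (coeffM j) (ehrT-≤ j)

    upper : pM ⪯ pU
    upper = ≤ᶜ⇒⪯ {pM} {pU} λ j → subst₂ _≤ℚ_ (coeffM j) (coeffU j) (≤-ehrU j)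

    strict : ¬ (M ≅ T) → ¬ (IsBasis M ≐ IsBasis U) → ∀ j → 1 ≤ j → j ≤ suc m → (coeff pT j <ℚ coeff pM j) ×
        (coeff pM j <ℚ coeff pU j)
    strict ¬M≅T ¬uniform j 1≤j j≤ =
        subst₂ _<ℚ_ (coeffT j) (coeffM j) (ehrT-< j 1≤j j≤ (notMinimal ¬M≅T))
      , subst₂ _<ℚ_ (coeffM j) (coeffU j) (<-ehrU j 1≤j j≤ (notUniform ¬uniform))

no-separation : ∀ {n s} (f : Labelling n s) → s < 2 → ∀ {i j} → ¬ Separated f i j
no-separation f (s≤s z≤n)       (() , _)
no-separation f (s≤s (s≤s z≤n)) (zero , zero , _ , _ , ne) = ne refl

polytope-class₂ : ∀ {n} (M : Matroid n) (f : Labelling n 2) → Labels M f → ∀ r {y} → polytope M y → dot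
    (λ i → fromℕ (f i ⟦ r ⟧)) y ≡ 1ℚ
polytope-class₂ M f labels r = conv-≡ (λ i → fromℕ (f i ⟦ r ⟧)) 1ℚ λ v V →
  let _ , _ , (p , q , fi , fj , p≢q) , e = dot-vertex M f labels (λ i → f i ⟦ r ⟧) v V
  in trans e (cong fromℕ (trans (cong₂ (λ k l → k ⟦ r ⟧ + l ⟦ r ⟧) fi fj) (exactly-one p q r p≢q)))
  where
  exactly-one : ∀ (p q r : Fin 2) → p ≢ q → just p ⟦ r ⟧ + just q ⟦ r ⟧ ≡ 1
  exactly-one zero       zero       r          ne = contradiction refl ne
  exactly-one zero 1F zero ne = refl
  exactly-one zero 1F 1F ne = refl
  exactly-one 1F zero zero ne = refl
  exactly-one 1F zero 1F ne = refl
  exactly-one 1F 1F r ne = contradiction refl ne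

positive₂ : ∀ {n} (M : Matroid n) (f : Labelling n 2) → Labels M f → Onto f → (∀ r → 0 < size f r) →
            EhrhartPositive (polytope M)
positive₂ M f labels surj size-pos = rising² x y , x + y , isEhrhart₂ M f labels size₀ size₁
  , Dimension.dimension₂ M f labels zero 1F (λ ()) (proj₁ (surj zero)) (proj₁ (surj 1F))
      (proj₂ (surj zero)) (proj₂ (surj 1F))
      (polytope-class₂ M f labels) nonloops≡
  , rising²-positive x y
  where
  x = pred (size f zero)
  y = pred (size f 1F)
  size₀ : size f zero ≡ suc x
  size₀ = sym (ℕₚ.suc-pred (size f zero) {{ℕ.>-nonZero (size-pos zero)}})
  size₁ : size f 1F ≡ suc y
  size₁ = sym (ℕₚ.suc-pred (size f 1F) {{ℕ.>-nonZero (size-pos 1F)}})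
  nonloops≡ : nonloops f ≡ 2 + (x + y)
  nonloops≡ = trans (sym (sum-size f))
      (trans (cong₂ _+_ size₀ (trans (ℕₚ.+-identityʳ (size f 1F)) size₁)) (cong suc (ℕₚ.+-suc x y)))

-- Each coefficient is at least the one of `ehrT`, which is positive up to the dimension. As loops
-- may occur, the comparison is made with the number of nonloops, `3 + m`, in place of `n`.
positive₃ : ∀ {n k} (M : Matroid n) (f : Labelling n (3 + k)) → Labels M f → Onto f →
    (∀ r → 0 < size f r) →
            EhrhartPositive (polytope M)
positive₃ {n} {k} M f labels surj size-pos = ehr (suc m) (size f) , 2 + m
  , isEhrhart M f labels (suc m) nonloops≡ (λ r → subst (size f r <_) (sym nonloops≡) (C.a< r))
  , Dimension.dimension₃ M f labels zero 1F (λ ()) (proj₁ (surj zero)) (proj₁ (surj 1F))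
      (proj₂ (surj zero)) (proj₂ (surj 1F))
      2F (λ ()) (λ ()) (proj₁ (surj 2F)) (proj₂ (surj 2F)) nonloops≡
  , λ j j≤ → ℚₚ.<-≤-trans (ehrT-positive m j j≤) (C.ehrT-≤ j)
  where
  3≤nonloops : 3 ≤ nonloops f
  3≤nonloops = subst (3 ≤_) (sum-size f)
      (ℕₚ.+-mono-≤ (size-pos zero) (ℕₚ.+-mono-≤ (size-pos 1F)
          (ℕₚ.≤-trans (size-pos 2F) (ℕₚ.m≤m+n _ _))))
  m = proj₁ (ℕₚ.m≤n⇒∃[o]m+o≡n 3≤nonloops)
  nonloops≡ : nonloops f ≡ 3 + m
  nonloops≡ = sym (proj₂ (ℕₚ.m≤n⇒∃[o]m+o≡n 3≤nonloops))
  module C = Compare (suc m) k (size f) size-pos (trans (sum-size f) nonloops≡)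

ehrhartPositive : ∀ {n} (N : Matroid n) → HasRank N 2 → EhrhartPositive (polytope N)
ehrhartPositive N rk = go classes label labels surjective size-positive
  where
  open RankTwo N rk
  go : ∀ s (f : Labelling _ s) → Labels N f → Onto f → (∀ r → 0 < size f r) → EhrhartPositive
      (polytope N)
  go 0 f labels _ _ = contradiction (proj₁ (proj₂ (proj₂ (to (labels _) (proj₂ (nonempty N)))))) (no-separation f (s≤s z≤n))
  go 1 f labels _ _ = contradiction (proj₁ (proj₂ (proj₂ (to (labels _) (proj₂ (nonempty N))))))
      (no-separation f (s≤s (s≤s z≤n)))
  go 2 f = positive₂ N f
  go (suc (suc (suc k))) f = positive₃ N f

theorem1p2 :
      (∀ {n : ℕ} (M : Matroid n) (rk : HasRank M 2) → Connected M →
       let T = minimal₂ (rank≤size M rk)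
           U = uniform (rank≤size M rk)
       in
       ∀ pT pM pU →
       IsEhrhartPolynomial (polytope T) pT →
       IsEhrhartPolynomial (polytope M) pM →
       IsEhrhartPolynomial (polytope U) pU →
         (pT ⪯ pM × pM ⪯ pU)
       × (¬ (M ≅ T) → ¬ (IsBasis M ≐ IsBasis U) →
          ∀ j → 1 ≤ j → j ≤ n ∸ 1 →
            (coeff pT j <ℚ coeff pM j) × (coeff pM j <ℚ coeff pU j)))
    × (∀ {n : ℕ} (N : Matroid n) → HasRank N 2 → EhrhartPositive (polytope N))
theorem1p2 = connected , ehrhartPositive
  where
  Claim : ∀ {n} (M : Matroid n) → HasRank M 2 → Set
  Claim {n} M rk = let T = minimal₂ (rank≤size M rk)
                       U = uniform (rank≤size M rk)
    in ∀ pT pM pU →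
       IsEhrhartPolynomial (polytope T) pT → IsEhrhartPolynomial (polytope M) pM → IsEhrhartPolynomial (polytope U) pU →
         (pT ⪯ pM × pM ⪯ pU)
       × (¬ (M ≅ T) → ¬ (IsBasis M ≐ IsBasis U) → ∀ j → 1 ≤ j → j ≤ n ∸ 1 → (coeff pT j <ℚ coeff pM j) ×
           (coeff pM j <ℚ coeff pU j))
  connected : ∀ {n} (M : Matroid n) (rk : HasRank M 2) → Connected M → Claim M rk
  connected {0} M rk _ = contradiction (rank≤size M rk) λ ()
  connected {1} M rk _ = contradiction (rank≤size M rk) λ { (s≤s ()) }
  connected {suc (suc m)} M rk conn = go classes label labels surjective size-positive
    where
    open RankTwo M rk
    go : ∀ s (f : Labelling _ s) → Labels M f → Onto f → (∀ r → 0 < size f r) → Claim M rk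
    go 0 f labels _ _ = contradiction (proj₁ (proj₂ (proj₂ (to (labels _) (proj₂ (nonempty M))))))
        (no-separation f (s≤s z≤n))
    go 1 f labels _ _ = contradiction (proj₁ (proj₂ (proj₂ (to (labels _) (proj₂ (nonempty M))))))
        (no-separation f (s≤s (s≤s z≤n)))
    go 2 f labels surj _ = λ _ _ _ _ _ _ → Data.Empty.⊥-elim
        (connected⇒¬2-classes M f labels surj (λ {k} {l} → conn {k} {l}))
    go (suc (suc (suc k))) f labels surj size-pos pT pM pU T-ehr M-ehr U-ehr =
      (C.lower pT pM pU T-ehr M-ehr U-ehr , C.upper pT pM pU T-ehr M-ehr U-ehr) , C.strict pT pM pU T-ehr M-ehr U-ehr
      where module C = ThreeClasses M rk f labels surj size-pos (connected⇒loopless M f labels (λ {k} {l} → conn {k} {l}))
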